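{- Let $k$ be a positive integer and let $G$ be a $k$-connected irregular graph of order $n$ and size $m$. If the maximum degree of $G$ is $\Delta$, then $$\Delta-\lambda_{1}(G)>\frac{(n\Delta-2m)k^{2}}{(n\Delta-2m)\left((n-1)^{2}-(n-k-1)(\Delta-k+1)\right)+nk^{2}}.$$
   Context: All graphs are finite and simple. The order of $G$ is its number of vertices and the size is its number of edges. $\lambda_1(G)$ denotes the spectral radius of $G$, i.e. the largest eigenvalue of its adjacency matrix. A graph is irregular if its vertices do not all have the same degree. A graph is $k$-connected in the usual (vertex-connectivity) sense: it has more than $k$ vertices and remains connected after removal of any fewer than $k$ vertices. -}

module Defs where

open import Algebra.Properties.CommutativeMonoid.Sum using (sum)
open import Data.Bool.Base using (Bool; true; false; _∧_; if_then_else_)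
open import Data.Fin.Base using (Fin)
import Data.Fin.Properties as Fin
open import Data.Fin.Subset using (Subset; _∉_; ∣_∣)
open import Data.Integer.Base using (+_)
open import Data.Nat.Base as ℕ using (ℕ)
import Data.Nat.Properties as ℕ
open import Data.Product.Base using (Σ-syntax; ∃-syntax; _×_; _,_)
open import Data.Rational.Base as ℚ using (ℚ; 0ℚ; 1ℚ; ½)
import Data.Rational.Properties as ℚ
open import Data.Rational.Solver using (module +-*-Solver)
open import Data.Sum.Base using (_⊎_)
open import Data.Vec.Base using (tabulate)
open import Data.Vec.Functional using (foldr)
open import Relation.Binary.Construct.Closure.ReflexiveTransitive using (Star)
open import Relation.Binary.PropositionalEquality
open import Relation.Nullary using (¬_)
open import Relation.Nullary.Decidable using (⌊_⌋)

ℕ→ℚ : ℕ → ℚ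
ℕ→ℚ n = + n ℚ./ 1

-- Real numbers are Cauchy sequences of rationals, compared up to _≈ʳ_.

IsCauchy : (ℕ → ℚ) → Set
IsCauchy x = ∀ ε → 0ℚ ℚ.< ε →
  ∃[ N ] (∀ m n → N ℕ.≤ m → N ℕ.≤ n → ℚ.∣ x m ℚ.- x n ∣ ℚ.< ε)

record ℝ : Set where
  constructor mkℝ
  field
    seq    : ℕ → ℚ
    cauchy : IsCauchy seq

open ℝ public

infix 4 _≈ʳ_ _<ʳ_ _≤ʳ_ _#ʳ_

_≈ʳ_ : ℝ → ℝ → Set
x ≈ʳ y = ∀ ε → 0ℚ ℚ.< ε →
  ∃[ N ] (∀ n → N ℕ.≤ n → ℚ.∣ seq x n ℚ.- seq y n ∣ ℚ.< ε)

-- The sequences must be separated by a fixed gap: a termwise strict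
-- inequality would not survive passage to the limit.
_<ʳ_ : ℝ → ℝ → Set
x <ʳ y = Σ[ ε ∈ ℚ ] 0ℚ ℚ.< ε ×
  (∃[ N ] (∀ n → N ℕ.≤ n → seq x n ℚ.+ ε ℚ.< seq y n))

_≤ʳ_ : ℝ → ℝ → Set
x ≤ʳ y = ∀ ε → 0ℚ ℚ.< ε →
  ∃[ N ] (∀ n → N ℕ.≤ n → seq x n ℚ.< seq y n ℚ.+ ε)

-- The constructive form of x ≠ y.
_#ʳ_ : ℝ → ℝ → Set
x #ʳ y = x <ʳ y ⊎ y <ʳ x

private
  half+half : ∀ ε → ½ ℚ.* ε ℚ.+ ½ ℚ.* ε ≡ ε
  half+half ε = begin
    ½ ℚ.* ε ℚ.+ ½ ℚ.* ε  ≡⟨ ℚ.*-distribʳ-+ ε ½ ½ ⟨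
    (½ ℚ.+ ½) ℚ.* ε      ≡⟨⟩
    1ℚ ℚ.* ε             ≡⟨ ℚ.*-identityˡ ε ⟩
    ε                    ∎
    where open ≡-Reasoning

  *-pos : ∀ {p q} → 0ℚ ℚ.< p → 0ℚ ℚ.< q → 0ℚ ℚ.< p ℚ.* q
  *-pos {p} {q} 0<p 0<q =
    ℚ.positive⁻¹ _ {{ℚ.pos*pos⇒pos p {{ℚ.positive 0<p}} q {{ℚ.positive 0<q}}}}

  half-pos : ∀ {ε} → 0ℚ ℚ.< ε → 0ℚ ℚ.< ½ ℚ.* ε
  half-pos = *-pos (ℚ.positive⁻¹ ½)

  const-cauchy : ∀ q → IsCauchy (λ _ → q)
  const-cauchy q ε 0<ε = 0 , λ _ _ _ _ →
    subst (λ p → ℚ.∣ p ∣ ℚ.< ε) (sym (ℚ.+-inverseʳ q)) 0<ε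

  +-cauchy : ∀ {x y} → IsCauchy x → IsCauchy y → IsCauchy (λ n → x n ℚ.+ y n)
  +-cauchy {x} {y} cx cy ε 0<ε =
    let N₁ , h₁ = cx (½ ℚ.* ε) (half-pos 0<ε)
        N₂ , h₂ = cy (½ ℚ.* ε) (half-pos 0<ε)
    in N₁ ℕ.⊔ N₂ , λ m n N≤m N≤n → begin-strict
      ℚ.∣ (x m ℚ.+ y m) ℚ.- (x n ℚ.+ y n) ∣
        ≡⟨ cong ℚ.∣_∣ (rearrange (x m) (y m) (x n) (y n)) ⟩
      ℚ.∣ (x m ℚ.- x n) ℚ.+ (y m ℚ.- y n) ∣
        ≤⟨ ℚ.∣p+q∣≤∣p∣+∣q∣ (x m ℚ.- x n) (y m ℚ.- y n) ⟩
      ℚ.∣ x m ℚ.- x n ∣ ℚ.+ ℚ.∣ y m ℚ.- y n ∣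
        <⟨ ℚ.+-mono-< (h₁ m n (ℕ.m⊔n≤o⇒m≤o N₁ N₂ N≤m) (ℕ.m⊔n≤o⇒m≤o N₁ N₂ N≤n))
                      (h₂ m n (ℕ.m⊔n≤o⇒n≤o N₁ N₂ N≤m) (ℕ.m⊔n≤o⇒n≤o N₁ N₂ N≤n)) ⟩
      ½ ℚ.* ε ℚ.+ ½ ℚ.* ε
        ≡⟨ half+half ε ⟩
      ε ∎
    where
    open ℚ.≤-Reasoning
    rearrange : ∀ a b c d → (a ℚ.+ b) ℚ.- (c ℚ.+ d) ≡ (a ℚ.- c) ℚ.+ (b ℚ.- d)
    rearrange = solve 4 (λ a b c d → (a :+ b) :- (c :+ d) := (a :- c) :+ (b :- d)) refl
      where open +-*-Solver

  neg-cauchy : ∀ {x} → IsCauchy x → IsCauchy (λ n → ℚ.- x n)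
  neg-cauchy {x} cx ε 0<ε =
    let N , h = cx ε 0<ε
    in N , λ m n N≤m N≤n →
      subst (ℚ._< ε)
        (trans (sym (ℚ.∣-p∣≡∣p∣ (x m ℚ.- x n)))
               (cong ℚ.∣_∣ (ℚ.neg-distrib-+ (x m) (ℚ.- x n))))
        (h m n N≤m N≤n)

  eventually-bounded : ∀ {x} → IsCauchy x →
    ∃[ N ] ∃[ B ] (0ℚ ℚ.< B × (∀ n → N ℕ.≤ n → ℚ.∣ x n ∣ ℚ.< B))
  eventually-bounded {x} cx =
    let N , h = cx 1ℚ (ℚ.positive⁻¹ 1ℚ)
        bound : ∀ n → N ℕ.≤ n → ℚ.∣ x n ∣ ℚ.< 1ℚ ℚ.+ ℚ.∣ x N ∣
        bound n N≤n = begin-strict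
          ℚ.∣ x n ∣                          ≡⟨ cong ℚ.∣_∣ (split (x n) (x N)) ⟩
          ℚ.∣ (x n ℚ.- x N) ℚ.+ x N ∣        ≤⟨ ℚ.∣p+q∣≤∣p∣+∣q∣ (x n ℚ.- x N) (x N) ⟩
          ℚ.∣ x n ℚ.- x N ∣ ℚ.+ ℚ.∣ x N ∣    <⟨ ℚ.+-monoˡ-< ℚ.∣ x N ∣ (h n N N≤n ℕ.≤-refl) ⟩
          1ℚ ℚ.+ ℚ.∣ x N ∣                   ∎
    in N , 1ℚ ℚ.+ ℚ.∣ x N ∣ ,
       ℚ.≤-<-trans (ℚ.0≤∣p∣ (x N)) (bound N ℕ.≤-refl) , bound
    where
    open ℚ.≤-Reasoning
    split : ∀ a b → a ≡ (a ℚ.- b) ℚ.+ b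
    split = solve 2 (λ a b → a := (a :- b) :+ b) refl
      where open +-*-Solver

  ∣*∣-bound : ∀ {a b A B} → ℚ.∣ a ∣ ℚ.< A → ℚ.∣ b ∣ ℚ.< B → 0ℚ ℚ.< A →
    ℚ.∣ a ℚ.* b ∣ ℚ.< A ℚ.* B
  ∣*∣-bound {a} {b} {A} {B} a<A b<B 0<A = begin-strict
    ℚ.∣ a ℚ.* b ∣          ≡⟨ ℚ.∣p*q∣≡∣p∣*∣q∣ a b ⟩
    ℚ.∣ a ∣ ℚ.* ℚ.∣ b ∣    ≤⟨ ℚ.*-monoʳ-≤-nonNeg ℚ.∣ b ∣ {{ℚ.∣-∣-nonNeg b}} (ℚ.<⇒≤ a<A) ⟩
    A ℚ.* ℚ.∣ b ∣          <⟨ ℚ.*-monoʳ-<-pos A {{ℚ.positive 0<A}} b<B ⟩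
    A ℚ.* B                ∎
    where open ℚ.≤-Reasoning

  *-shrink : ∀ {A ε} → 0ℚ ℚ.< A → 0ℚ ℚ.< ε → ∃[ δ ] (0ℚ ℚ.< δ × A ℚ.* δ ≡ ε)
  *-shrink {A} {ε} 0<A 0<ε = A⁻¹ ℚ.* ε ,
    *-pos (ℚ.positive⁻¹ A⁻¹ {{ℚ.1/pos⇒pos A {{A>0}}}}) 0<ε ,
    (begin
      A ℚ.* (A⁻¹ ℚ.* ε)    ≡⟨ ℚ.*-assoc A A⁻¹ ε ⟨
      A ℚ.* A⁻¹ ℚ.* ε      ≡⟨ cong (ℚ._* ε) (ℚ.*-inverseʳ A {{A≢0}}) ⟩
      1ℚ ℚ.* ε             ≡⟨ ℚ.*-identityˡ ε ⟩
      ε                    ∎)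
    where
    open ≡-Reasoning
    A>0 : ℚ.Positive A
    A>0 = ℚ.positive 0<A
    A≢0 : ℚ.NonZero A
    A≢0 = ℚ.pos⇒nonZero A {{A>0}}
    A⁻¹ : ℚ
    A⁻¹ = (ℚ.1/ A) {{A≢0}}

  *-cauchy : ∀ {x y} → IsCauchy x → IsCauchy y → IsCauchy (λ n → x n ℚ.* y n)
  *-cauchy {x} {y} cx cy ε 0<ε =
    let Nx , A , 0<A , boundx = eventually-bounded cx
        Ny , B , 0<B , boundy = eventually-bounded cy
        δ₁ , 0<δ₁ , Aδ₁≡½ε = *-shrink 0<A (half-pos 0<ε)
        δ₂ , 0<δ₂ , Bδ₂≡½ε = *-shrink 0<B (half-pos 0<ε)
        N₁ , h₁ = cy δ₁ 0<δ₁
        N₂ , h₂ = cx δ₂ 0<δ₂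
        M₁ = Nx ℕ.⊔ N₁
        M₂ = Ny ℕ.⊔ N₂
    in M₁ ℕ.⊔ M₂ , λ m n M≤m M≤n →
      let M₁≤m = ℕ.m⊔n≤o⇒m≤o M₁ M₂ M≤m
          M₂≤m = ℕ.m⊔n≤o⇒n≤o M₁ M₂ M≤m
          M₁≤n = ℕ.m⊔n≤o⇒m≤o M₁ M₂ M≤n
          M₂≤n = ℕ.m⊔n≤o⇒n≤o M₁ M₂ M≤n
      in begin-strict
      ℚ.∣ x m ℚ.* y m ℚ.- x n ℚ.* y n ∣
        ≡⟨ cong ℚ.∣_∣ (rearrange (x m) (y m) (x n) (y n)) ⟩
      ℚ.∣ x m ℚ.* (y m ℚ.- y n) ℚ.+ y n ℚ.* (x m ℚ.- x n) ∣
        ≤⟨ ℚ.∣p+q∣≤∣p∣+∣q∣ (x m ℚ.* (y m ℚ.- y n)) (y n ℚ.* (x m ℚ.- x n)) ⟩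
      ℚ.∣ x m ℚ.* (y m ℚ.- y n) ∣ ℚ.+ ℚ.∣ y n ℚ.* (x m ℚ.- x n) ∣
        <⟨ ℚ.+-mono-<
             (∣*∣-bound {x m} {y m ℚ.- y n}
               (boundx m (ℕ.m⊔n≤o⇒m≤o Nx N₁ M₁≤m))
               (h₁ m n (ℕ.m⊔n≤o⇒n≤o Nx N₁ M₁≤m) (ℕ.m⊔n≤o⇒n≤o Nx N₁ M₁≤n)) 0<A)
             (∣*∣-bound {y n} {x m ℚ.- x n}
               (boundy n (ℕ.m⊔n≤o⇒m≤o Ny N₂ M₂≤n))
               (h₂ m n (ℕ.m⊔n≤o⇒n≤o Ny N₂ M₂≤m) (ℕ.m⊔n≤o⇒n≤o Ny N₂ M₂≤n)) 0<B) ⟩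
      A ℚ.* δ₁ ℚ.+ B ℚ.* δ₂
        ≡⟨ cong₂ ℚ._+_ Aδ₁≡½ε Bδ₂≡½ε ⟩
      ½ ℚ.* ε ℚ.+ ½ ℚ.* ε
        ≡⟨ half+half ε ⟩
      ε ∎
    where
    open ℚ.≤-Reasoning
    rearrange : ∀ a b c d →
      a ℚ.* b ℚ.- c ℚ.* d ≡ a ℚ.* (b ℚ.- d) ℚ.+ d ℚ.* (a ℚ.- c)
    rearrange = solve 4 (λ a b c d →
      a :* b :- c :* d := a :* (b :- d) :+ d :* (a :- c)) refl
      where open +-*-Solver

fromℚ : ℚ → ℝ
fromℚ q = mkℝ (λ _ → q) (const-cauchy q)

infixl 6 _+ʳ_ _-ʳ_
infixl 7 _*ʳ_
infix  8 -ʳ_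

_+ʳ_ : ℝ → ℝ → ℝ
x +ʳ y = mkℝ (λ n → seq x n ℚ.+ seq y n) (+-cauchy {seq x} {seq y} (cauchy x) (cauchy y))

-ʳ_ : ℝ → ℝ
-ʳ x = mkℝ (λ n → ℚ.- seq x n) (neg-cauchy {seq x} (cauchy x))

_-ʳ_ : ℝ → ℝ → ℝ
x -ʳ y = x +ʳ (-ʳ y)

_*ʳ_ : ℝ → ℝ → ℝ
x *ʳ y = mkℝ (λ n → seq x n ℚ.* seq y n) (*-cauchy {seq x} {seq y} (cauchy x) (cauchy y))

0ʳ 1ʳ : ℝ
0ʳ = fromℚ 0ℚ
1ʳ = fromℚ 1ℚ

∑ʳ : ∀ {n} → (Fin n → ℝ) → ℝ
∑ʳ = foldr _+ʳ_ 0ʳ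

IsEigenvalue : ∀ {n} → (Fin n → Fin n → ℝ) → ℝ → Set
IsEigenvalue {n} A μ = Σ[ v ∈ (Fin n → ℝ) ]
  (∃[ i ] v i #ʳ 0ʳ) ×
  (∀ i → ∑ʳ (λ j → A i j *ʳ v j) ≈ʳ μ *ʳ v i)

IsLargestEigenvalue : ∀ {n} → (Fin n → Fin n → ℝ) → ℝ → Set
IsLargestEigenvalue A μ =
  IsEigenvalue A μ × (∀ ν → IsEigenvalue A ν → ν ≤ʳ μ)

record Graph (n : ℕ) : Set where
  field
    adj        : Fin n → Fin n → Bool
    adj-sym    : ∀ i j → adj i j ≡ adj j i
    adj-irrefl : ∀ i → adj i i ≡ false

open Graph public

module _ {n : ℕ} (G : Graph n) where

  neighbours : Fin n → Subset n
  neighbours i = tabulate (adj G i)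

  degree : Fin n → ℕ
  degree i = ∣ neighbours i ∣

  maxDegree : ℕ
  maxDegree = foldr ℕ._⊔_ 0 degree

  -- Each edge {i, j} is counted once, at its smaller endpoint.
  size : ℕ
  size = sum ℕ.+-0-commutativeMonoid
    (λ i → ∣ tabulate (λ j → ⌊ i Fin.<? j ⌋ ∧ adj G i j) ∣)

  Irregular : Set
  Irregular = ¬ (∀ i j → degree i ≡ degree j)

  AdjacentOutside : Subset n → Fin n → Fin n → Set
  AdjacentOutside S i j = i ∉ S × j ∉ S × adj G i j ≡ true

  ConnectedOutside : Subset n → Set
  ConnectedOutside S = ∀ i j → i ∉ S → j ∉ S → Star (AdjacentOutside S) i j

  -- Since ∣ S ∣ < k < n, the graph G − S is never empty.
  KConnected : ℕ → Set
  KConnected k = k ℕ.< n × (∀ (S : Subset n) → ∣ S ∣ ℕ.< k → ConnectedOutside S)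

  adjacencyMatrix : Fin n → Fin n → ℝ
  adjacencyMatrix i j = if adj G i j then 1ʳ else 0ʳ

IsSpectralRadius : ∀ {n} → Graph n → ℝ → Set
IsSpectralRadius G = IsLargestEigenvalue (adjacencyMatrix G)

{-# OPTIONS --safe #-}
module Submission where

-- With dᵢ = Δ − deg i and p = Σ dᵢ, the form Δ‖x‖² − xᵀAx equals Σ dᵢ xᵢ² + Σ over edges of (xᵢ − xⱼ)².
-- Replacing x by |x| and subtracting its minimum a leaves z ≥ 0 with a zero, and form x ≥ p a² + form z,
-- so everything reduces to k² ‖z‖² ≤ T · form z, where T = (n−1)² − (n−k−1)(Δ−k+1).
-- This needs no Menger theorem.  Rank the vertices by z, so that z is an increasing sequence
-- u 0 = 0 ≤ u 1 ≤ … ≤ u N with N = n − 1.  By k-connectivity (Whitney's argument) at least k − (t − s)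
-- edges join the ranks ≤ s to the ranks > t.  Expanding squares in the nonnegative gaps of u, this says
-- that the edge energy dominates Σₐ (u (a+1) − u (a+1−k))², with u constant beyond N.  This
-- one-dimensional energy gives the bound after a case distinction on Δ and N.
-- Passing to the limit along a real eigenvector keeps the inequality strict because the rational bound
-- has an explicit slack.

open import Defs
open import Algebra.Bundles using (CommutativeRing)
import Algebra.Properties.Semiring.Sum as Sum
open import Data.Bool.Base as Bool using (Bool; true; false; _∧_; _∨_; not; if_then_else_)
import Data.Bool.Properties as Bool
open import Data.Empty using (⊥; ⊥-elim)
open import Data.Fin.Base as Fin using (Fin; zero; suc; toℕ; fromℕ<)
open import Data.Fin.Permutation as Perm using (Permutation′; _⟨$⟩ʳ_; _⟨$⟩ˡ_)
import Data.Fin.Properties as Fin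
open import Data.Fin.Subset using (Subset; _∉_) renaming (∣_∣ to card)
import Data.Integer.Base as ℤ
import Data.Integer.Properties as ℤ
open import Data.Nat.Base as ℕ using (ℕ; zero; suc)
import Data.Nat.Coprimality as Coprimality
open import Data.Nat.DivMod using (_/_; _%_; m≡m%n+[m/n]*n)
import Data.Nat.Properties as ℕ
import Data.Nat.Tactic.RingSolver as ℕ-Solver
open import Data.Product.Base using (Σ-syntax; ∃-syntax; _×_; _,_; proj₁; proj₂)
open import Data.Rational.Base as ℚ using (ℚ; mkℚ; 0ℚ; ½; NonZero; 1ℚ; _+_; _-_; _*_; _÷_; -_; _≤_; _<_; ∣_∣)
import Data.Rational.Properties as ℚ
open import Data.Sum.Base using (_⊎_; inj₁; inj₂; [_,_]′)
open import Data.Vec.Base as Vec using (tabulate; lookup)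
open import Data.Vec.Functional using (foldr)
import Data.Vec.Properties as Vec
open import Function.Base using (_∘_; case_of_)
open import Relation.Binary.Construct.Closure.ReflexiveTransitive using (Star; ε; _◅_; gmap)
open import Relation.Binary.PropositionalEquality
open import Relation.Nullary using (¬_; Dec; yes; no; does)
open import Relation.Nullary.Decidable using (⌊_⌋; dec⇒maybe; dec-true; dec-false)
open import Tactic.RingSolver using (solve-∀)
open import Tactic.RingSolver.Core.AlmostCommutativeRing using (AlmostCommutativeRing; fromCommutativeRing)

-- The windows of length k arise from a coincidence of counts: of all windows of k consecutive gaps,
-- k - (t - s) contain both gap s and gap t, for s ≤ t < s + k, which is also the number of edges
-- that connectivity forces across both gaps. Both energies are quadratic forms in the gaps with
-- such counts as coefficients, so one comparison of coefficients replaces a system of disjoint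
-- paths. The case distinction is forced because the window energy does not see Δ, whereas T
-- decreases as Δ grows. For large Δ part of the estimate must come from the form itself: a graph on
-- Δ vertices has spectral radius at most Δ - 1. The order on Cauchy reals is undecidable, so a real
-- eigenvector can be neither sorted nor split at its minimum. Hence every inequality is proved for
-- all rational vectors and is applied to the terms of the sequences that represent the eigenvector,
-- which satisfy the eigenvalue equation only up to a residual.

module ∑ℚ = Sum (CommutativeRing.semiring ℚ.+-*-commutativeRing)
module ∑ℕ = Sum ℕ.+-*-semiring

open ∑ℚ using (sum)

ℚ-ring : AlmostCommutativeRing _ _
ℚ-ring = fromCommutativeRing ℚ.+-*-commutativeRing (λ q → dec⇒maybe (0ℚ ℚ.≟ q))

-- Ordered-field arithmetic

2ℚ : ℚ
2ℚ = 1ℚ + 1ℚ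

+-nonneg : ∀ {p q} → 0ℚ ≤ p → 0ℚ ≤ q → 0ℚ ≤ p + q
+-nonneg = ℚ.+-mono-≤

*-nonneg : ∀ {p q} → 0ℚ ≤ p → 0ℚ ≤ q → 0ℚ ≤ p * q
*-nonneg {p} {q} 0≤p 0≤q = ℚ.nonNegative⁻¹ (p * q)
  {{ℚ.nonNeg*nonNeg⇒nonNeg p {{ℚ.nonNegative 0≤p}} q {{ℚ.nonNegative 0≤q}}}}

*-positive : ∀ {p q} → 0ℚ < p → 0ℚ < q → 0ℚ < p * q
*-positive {p} {q} 0<p 0<q =
  ℚ.positive⁻¹ (p * q) {{ℚ.pos*pos⇒pos p {{ℚ.positive 0<p}} q {{ℚ.positive 0<q}}}}

square-nonneg : ∀ p → 0ℚ ≤ p * p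
square-nonneg p with ℚ.≤-total 0ℚ p
... | inj₁ 0≤p = *-nonneg 0≤p 0≤p
... | inj₂ p≤0 = subst (0ℚ ≤_) (neg-square p) (*-nonneg 0≤-p 0≤-p)
  where
  0≤-p : 0ℚ ≤ - p
  0≤-p = ℚ.neg-antimono-≤ p≤0
  neg-square : ∀ p → (- p) * (- p) ≡ p * p
  neg-square = solve-∀ ℚ-ring

*-mono-≤ˡ : ∀ r {p q} → 0ℚ ≤ r → p ≤ q → r * p ≤ r * q
*-mono-≤ˡ r 0≤r = ℚ.*-monoˡ-≤-nonNeg r {{ℚ.nonNegative 0≤r}}

*-mono-≤ʳ : ∀ r {p q} → 0ℚ ≤ r → p ≤ q → p * r ≤ q * r
*-mono-≤ʳ r 0≤r = ℚ.*-monoʳ-≤-nonNeg r {{ℚ.nonNegative 0≤r}}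

*-cancel-≤ˡ : ∀ r {p q} → 0ℚ < r → r * p ≤ r * q → p ≤ q
*-cancel-≤ˡ r 0<r = ℚ.*-cancelˡ-≤-pos r {{ℚ.positive 0<r}}

square-mono-≤ : ∀ {p q} → 0ℚ ≤ p → p ≤ q → p * p ≤ q * q
square-mono-≤ {p} {q} 0≤p p≤q =
  ℚ.≤-trans (*-mono-≤ˡ p 0≤p p≤q) (*-mono-≤ʳ q (ℚ.≤-trans 0≤p p≤q) p≤q)

offset-≤ : ∀ {p q} r → q ≡ p + r → 0ℚ ≤ r → p ≤ q
offset-≤ {p} {q} r q≡p+r 0≤r = begin
  p       ≡⟨ ℚ.+-identityʳ p ⟨
  p + 0ℚ  ≤⟨ ℚ.+-monoʳ-≤ p 0≤r ⟩
  p + r   ≡⟨ q≡p+r ⟨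
  q       ∎
  where open ℚ.≤-Reasoning

offset-< : ∀ {p q} r → q ≡ p + r → 0ℚ < r → p < q
offset-< {p} {q} r q≡p+r 0<r = begin-strict
  p       ≡⟨ ℚ.+-identityʳ p ⟨
  p + 0ℚ  <⟨ ℚ.+-monoʳ-< p 0<r ⟩
  p + r   ≡⟨ q≡p+r ⟨
  q       ∎
  where open ℚ.≤-Reasoning

p≤q⇒0≤q-p : ∀ {p q} → p ≤ q → 0ℚ ≤ q - p
p≤q⇒0≤q-p {p} {q} p≤q = subst (_≤ q - p) (ℚ.+-inverseʳ p) (ℚ.+-monoˡ-≤ (- p) p≤q)

0≤q-p⇒p≤q : ∀ {p q} → 0ℚ ≤ q - p → p ≤ q
0≤q-p⇒p≤q {p} {q} = offset-≤ (q - p) (lemma q p)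
  where
  lemma : ∀ q p → q ≡ p + (q - p)
  lemma = solve-∀ ℚ-ring

p<q⇒0<q-p : ∀ {p q} → p < q → 0ℚ < q - p
p<q⇒0<q-p {p} {q} p<q = subst (_< q - p) (ℚ.+-inverseʳ p) (ℚ.+-monoˡ-< (- p) p<q)

p≤∣p∣ : ∀ p → p ≤ ∣ p ∣
p≤∣p∣ p with ℚ.≤-total 0ℚ p
... | inj₁ 0≤p = ℚ.≤-reflexive (sym (ℚ.0≤p⇒∣p∣≡p 0≤p))
... | inj₂ p≤0 = ℚ.≤-trans p≤0 (ℚ.0≤∣p∣ p)

∣p∣*∣p∣≡p*p : ∀ p → ∣ p ∣ * ∣ p ∣ ≡ p * p
∣p∣*∣p∣≡p*p p = trans (sym (ℚ.∣p*q∣≡∣p∣*∣q∣ p p)) (ℚ.0≤p⇒∣p∣≡p (square-nonneg p))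

-- `_/_` normalises by a gcd and is stuck on a variable. In this canonical form sums and products of
-- rationals compute, which the next two lemmas rely on.
ℕ→ℚ-mkℚ : ∀ n → ℕ→ℚ n ≡ mkℚ (ℤ.+ n) 0 (Coprimality.sym (Coprimality.1-coprimeTo n))
ℕ→ℚ-mkℚ n = ℚ.normalize-coprime _

ℕ→ℚ-+ : ∀ m n → ℕ→ℚ (m ℕ.+ n) ≡ ℕ→ℚ m + ℕ→ℚ n
ℕ→ℚ-+ m n rewrite ℕ→ℚ-mkℚ m | ℕ→ℚ-mkℚ n =
  sym (cong (ℚ._/ 1) (cong₂ ℤ._+_ (ℤ.*-identityʳ (ℤ.+ m)) (ℤ.*-identityʳ (ℤ.+ n))))

ℕ→ℚ-* : ∀ m n → ℕ→ℚ (m ℕ.* n) ≡ ℕ→ℚ m * ℕ→ℚ n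
ℕ→ℚ-* m n rewrite ℕ→ℚ-mkℚ m | ℕ→ℚ-mkℚ n = cong (ℚ._/ 1) (ℤ.pos-* m n)

0≤ℕ→ℚ : ∀ n → 0ℚ ≤ ℕ→ℚ n
0≤ℕ→ℚ n = ℚ.nonNegative⁻¹ (ℕ→ℚ n) {{ℚ.normalize-nonNeg n 1}}

ℕ→ℚ-mono-≤ : ∀ {m n} → m ℕ.≤ n → ℕ→ℚ m ≤ ℕ→ℚ n
ℕ→ℚ-mono-≤ {m} {n} m≤n = offset-≤ (ℕ→ℚ (n ℕ.∸ m))
  (trans (cong ℕ→ℚ (sym (ℕ.m+[n∸m]≡n m≤n))) (ℕ→ℚ-+ m (n ℕ.∸ m))) (0≤ℕ→ℚ (n ℕ.∸ m))

0<ℕ→ℚ : ∀ {n} → 0 ℕ.< n → 0ℚ < ℕ→ℚ n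
0<ℕ→ℚ 0<n = ℚ.<-≤-trans (ℚ.positive⁻¹ 1ℚ) (ℕ→ℚ-mono-≤ 0<n)

-- Finite sums

sum-mono : ∀ {n} {f g : Fin n → ℚ} → (∀ i → f i ≤ g i) → sum f ≤ sum g
sum-mono {zero}  f≤g = ℚ.≤-refl
sum-mono {suc n} f≤g = ℚ.+-mono-≤ (f≤g zero) (sum-mono (f≤g ∘ suc))

sum-const : ∀ n q → sum {n} (λ _ → q) ≡ ℕ→ℚ n * q
sum-const zero    q = sym (ℚ.*-zeroˡ q)
sum-const (suc n) q = begin
  q + sum {n} (λ _ → q)  ≡⟨ cong (q +_) (sum-const n q) ⟩
  q + ℕ→ℚ n * q          ≡⟨ lemma q (ℕ→ℚ n) ⟩
  (1ℚ + ℕ→ℚ n) * q       ≡⟨ cong (_* q) (ℕ→ℚ-+ 1 n) ⟨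
  ℕ→ℚ (suc n) * q        ∎
  where
  open ≡-Reasoning
  lemma : ∀ q m → q + m * q ≡ (1ℚ + m) * q
  lemma = solve-∀ ℚ-ring

sum-zero : ∀ n → sum {n} (λ _ → 0ℚ) ≡ 0ℚ
sum-zero n = trans (sum-const n 0ℚ) (ℚ.*-zeroʳ (ℕ→ℚ n))

sum-nonneg : ∀ {n} {f : Fin n → ℚ} → (∀ i → 0ℚ ≤ f i) → 0ℚ ≤ sum f
sum-nonneg {n} {f} 0≤f = subst (_≤ sum f) (sum-zero n) (sum-mono 0≤f)

sum-neg : ∀ {n} (f : Fin n → ℚ) → sum (λ i → - f i) ≡ - sum f
sum-neg {zero}  f = refl
sum-neg {suc n} f = trans (cong (- f zero +_) (sum-neg (f ∘ suc)))
  (sym (ℚ.neg-distrib-+ (f zero) (sum (f ∘ suc))))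

sum-sub : ∀ {n} (f g : Fin n → ℚ) → sum (λ i → f i - g i) ≡ sum f - sum g
sum-sub f g = trans (∑ℚ.∑-distrib-+ f (λ i → - g i)) (cong (sum f +_) (sum-neg g))

sum-scale : ∀ {n} q (f : Fin n → ℚ) → sum (λ i → q * f i) ≡ q * sum f
sum-scale q f = sym (∑ℚ.*-distribˡ-sum q f)

sum-product : ∀ {m n} (f : Fin m → ℚ) (g : Fin n → ℚ) →
  sum f * sum g ≡ sum (λ i → sum (λ j → f i * g j))
sum-product f g = trans (∑ℚ.*-distribʳ-sum (sum g) f)
  (∑ℚ.sum-cong-≗ (λ i → ∑ℚ.*-distribˡ-sum (f i) g))

sum-ℕ→ℚ : ∀ {n} (f : Fin n → ℕ) → sum (ℕ→ℚ ∘ f) ≡ ℕ→ℚ (∑ℕ.sum f)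
sum-ℕ→ℚ {zero}  f = refl
sum-ℕ→ℚ {suc n} f = trans (cong (ℕ→ℚ (f zero) +_) (sum-ℕ→ℚ (f ∘ suc)))
  (sym (ℕ→ℚ-+ (f zero) (∑ℕ.sum (f ∘ suc))))

term≤sum : ∀ {n} {f : Fin n → ℚ} → (∀ i → 0ℚ ≤ f i) → ∀ i → f i ≤ sum f
term≤sum {f = f} 0≤f zero = offset-≤ (sum (f ∘ suc)) refl (sum-nonneg (0≤f ∘ suc))
term≤sum {f = f} 0≤f (suc i) = ℚ.≤-trans (term≤sum (0≤f ∘ suc) i)
  (offset-≤ (f zero) (ℚ.+-comm (f zero) _) (0≤f zero))

-- Indicators and counting

𝟙 : Bool → ℕ
𝟙 b = if b then 1 else 0

𝟙-mono : ∀ {b c} → (b ≡ true → c ≡ true) → 𝟙 b ℕ.≤ 𝟙 c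
𝟙-mono {false} _ = ℕ.z≤n
𝟙-mono {true} {c} b⇒c rewrite b⇒c refl = ℕ.≤-refl

∧-true : ∀ {b c} → b ≡ true → c ≡ true → b ∧ c ≡ true
∧-true refl refl = refl

∧-trueˡ : ∀ b {c} → b ∧ c ≡ true → b ≡ true
∧-trueˡ true _ = refl

∧-trueʳ : ∀ b {c} → b ∧ c ≡ true → c ≡ true
∧-trueʳ true c≡true = c≡true

<ᵇ-true : ∀ {m n} → m ℕ.< n → (m ℕ.<ᵇ n) ≡ true
<ᵇ-true {m} {n} m<n = dec-true (m ℕ.<? n) m<n

<ᵇ-true⁻¹ : ∀ m n → (m ℕ.<ᵇ n) ≡ true → m ℕ.< n
<ᵇ-true⁻¹ m n eq = ℕ.<ᵇ⇒< m n (subst Bool.T (sym eq) _)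

sumℕ-mono : ∀ {n} {f g : Fin n → ℕ} → (∀ i → f i ℕ.≤ g i) → ∑ℕ.sum f ℕ.≤ ∑ℕ.sum g
sumℕ-mono {zero}  f≤g = ℕ.≤-refl
sumℕ-mono {suc n} f≤g = ℕ.+-mono-≤ (f≤g zero) (sumℕ-mono (f≤g ∘ suc))

termℕ≤sum : ∀ {n} (f : Fin n → ℕ) i → f i ℕ.≤ ∑ℕ.sum f
termℕ≤sum f zero    = ℕ.m≤m+n _ _
termℕ≤sum f (suc i) = ℕ.≤-trans (termℕ≤sum (f ∘ suc) i) (ℕ.m≤n+m _ (f zero))

sumℕ-const : ∀ n c → ∑ℕ.sum {n} (λ _ → c) ≡ n ℕ.* c
sumℕ-const zero    c = refl
sumℕ-const (suc n) c = cong (c ℕ.+_) (sumℕ-const n c)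

-- The interval is lo ≤ a < hi; writing lo ≤ a as lo < 1 + a lets both comparisons reduce under successors.
interval : ℕ → ℕ → ℕ → Bool
interval lo hi a = (lo ℕ.<ᵇ suc a) ∧ (a ℕ.<ᵇ hi)

interval-count : ∀ n lo hi → ∑ℕ.sum {n} (λ a → 𝟙 (interval lo hi (toℕ a))) ℕ.≤ hi ℕ.∸ lo
interval-count zero    lo       hi       = ℕ.z≤n
interval-count (suc n) zero     zero     = interval-count n zero zero
interval-count (suc n) zero     (suc hi) = ℕ.s≤s (interval-count n zero hi)
interval-count (suc n) (suc lo) zero     = ℕ.≤-trans
  (sumℕ-mono {suc n} {g = λ _ → 0} (λ a → 𝟙-mono {interval (suc lo) 0 (toℕ a)} {false} (λ eq → ∧-trueʳ (lo ℕ.<ᵇ toℕ a) eq)))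
  (ℕ.≤-reflexive (trans (sumℕ-const (suc n) 0) (ℕ.*-zeroʳ n)))
interval-count (suc n) (suc lo) (suc hi) = interval-count n lo hi

count-below : ∀ n h → h ℕ.≤ n → ∑ℕ.sum {n} (λ a → 𝟙 (toℕ a ℕ.<ᵇ h)) ≡ h
count-below zero    zero    _   = refl
count-below (suc n) zero    _   = count-below n zero ℕ.z≤n
count-below (suc n) (suc h) h≤n = cong suc (count-below n h (ℕ.s≤s⁻¹ h≤n))

count-above : ∀ n t → ∑ℕ.sum {n} (λ a → 𝟙 (t ℕ.<ᵇ toℕ a)) ≡ n ℕ.∸ suc t
count-above zero    t       = refl
count-above (suc n) zero    = trans (sumℕ-const n 1) (ℕ.*-identityʳ n)
count-above (suc n) (suc t) = count-above n t

sum-except : ∀ {n} (h : Fin n → ℕ) a →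
  ∑ℕ.sum (λ x → if does (x Fin.≟ a) then 0 else h x) ℕ.+ h a ≡ ∑ℕ.sum h
sum-except {suc n} h zero    = ℕ.+-comm (∑ℕ.sum (h ∘ suc)) (h zero)
sum-except {suc n} h (suc a) = trans (ℕ.+-assoc (h zero) _ _)
  (cong (h zero ℕ.+_) (sum-except (h ∘ suc) a))

sum-𝟙-≟ : ∀ {n} (a : Fin n) → ∑ℕ.sum (λ x → 𝟙 (does (x Fin.≟ a))) ≡ 1
sum-𝟙-≟ {suc n} zero    = cong suc (trans (sumℕ-const n 0) (ℕ.*-zeroʳ n))
sum-𝟙-≟ {suc n} (suc a) = sum-𝟙-≟ a

card-tabulate : ∀ {n} (f : Fin n → Bool) → card (tabulate f) ≡ ∑ℕ.sum (𝟙 ∘ f)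
card-tabulate {zero}  f = refl
card-tabulate {suc n} f with f zero
... | true  = cong suc (card-tabulate (f ∘ suc))
... | false = card-tabulate (f ∘ suc)

∉-tabulate : ∀ {n} (f : Fin n → Bool) {x} → f x ≡ false → x ∉ tabulate f
∉-tabulate f {x} fx≡false x∈ with () ← trans (sym (Vec.[]=⇒lookup x∈)) (trans (Vec.lookup∘tabulate f x) fx≡false)

∉-tabulate⁻¹ : ∀ {n} (f : Fin n → Bool) {x} → x ∉ tabulate f → f x ≡ false
∉-tabulate⁻¹ f {x} x∉ with f x in fx
... | false = refl
... | true  = ⊥-elim (x∉ (Vec.lookup⇒[]= x (tabulate f) (trans (Vec.lookup∘tabulate f x) fx)))

-- Without loops, adjacency and equality exclude each other. Entrywise this is A + I ≤ J, used both
-- for forms of supported vectors and for the bound on degrees.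
adj-≟-≤1 : ∀ {n} (G : Graph n) i j → 𝟙 (adj G i j) ℕ.+ 𝟙 (does (j Fin.≟ i)) ℕ.≤ 1
adj-≟-≤1 G i j with j Fin.≟ i
... | yes refl rewrite adj-irrefl G i = ℕ.≤-refl
... | no _ with adj G i j
... | true  = ℕ.≤-refl
... | false = ℕ.z≤n

true⊎false : ∀ b → b ≡ true ⊎ b ≡ false
true⊎false true  = inj₁ refl
true⊎false false = inj₂ refl

false≢true : false ≢ true
false≢true ()

-- Edge boundaries in k-connected graphs

-- The first vertex is the end of rank above `t`, the second the end of rank at most `s`. For s ≤ t
-- this orientation counts every crossing edge once.
cutEdges : ∀ {n} → Graph n → ℕ → ℕ → Fin n → Fin n → Bool
cutEdges G s t i j = adj G i j ∧ (toℕ j ℕ.<ᵇ suc s) ∧ (t ℕ.<ᵇ toℕ i)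

module _ {n : ℕ} (G : Graph n) (s t : ℕ) where

  private
    h : Fin n → ℕ
    h i = ∑ℕ.sum (λ j → 𝟙 (cutEdges G s t i j))

    Low High : Fin n → Bool
    Low  x = toℕ x ℕ.<ᵇ suc s
    High x = t ℕ.<ᵇ toℕ x

  -- Deleting the vertices strictly between Low and High, the endpoints in High of the cut
  -- edges that avoid a, and the endpoints in Low of the cut edges at a, separates a from b.
  module Separator (a b : Fin n) (Ha : High a ≡ true) (Lb : Low b ≡ true) (a≁b : adj G a b ≡ false) where

    hits : Fin n → Bool
    hits x = does (Fin.any? (λ j → cutEdges G s t x j Bool.≟ true))

    separator : Fin n → Bool
    separator x = interval (suc s) (suc t) (toℕ x) ∨ ((not (does (x Fin.≟ a)) ∧ hits x) ∨ cutEdges G s t a x)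

    hits≤h : ∀ x → 𝟙 (hits x) ℕ.≤ h x
    hits≤h x with Fin.any? (λ j → cutEdges G s t x j Bool.≟ true)
    ... | no _ = ℕ.z≤n
    ... | yes (j , eq) = ℕ.≤-trans (𝟙-mono {true} (λ _ → eq)) (termℕ≤sum _ j)

    hits-edge : ∀ x j → cutEdges G s t x j ≡ true → hits x ≡ true
    hits-edge x j eq = dec-true (Fin.any? (λ j → cutEdges G s t x j Bool.≟ true)) (j , eq)

    𝟙-∨ : ∀ b c → 𝟙 (b ∨ c) ℕ.≤ 𝟙 b ℕ.+ 𝟙 c
    𝟙-∨ false c = ℕ.≤-refl
    𝟙-∨ true  c = ℕ.s≤s ℕ.z≤n

    except-≤ : ∀ x → 𝟙 (not (does (x Fin.≟ a)) ∧ hits x) ℕ.≤ (if does (x Fin.≟ a) then 0 else h x)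
    except-≤ x with does (x Fin.≟ a)
    ... | true  = ℕ.z≤n
    ... | false = hits≤h x

    -- Cut edges at `a` pay for their Low ends and all others for their High ends, so no edge pays
    -- twice. The count `h a` of the former fills the summand that `except` leaves out.
    card-separator : card (tabulate separator) ℕ.≤ (t ℕ.∸ s) ℕ.+ ∑ℕ.sum h
    card-separator = begin
      card (tabulate separator)
        ≡⟨ card-tabulate separator ⟩
      ∑ℕ.sum (𝟙 ∘ separator)
        ≤⟨ sumℕ-mono (λ x → ℕ.≤-trans (𝟙-∨ (interval (suc s) (suc t) (toℕ x)) _)
             (ℕ.+-monoʳ-≤ (𝟙 (interval (suc s) (suc t) (toℕ x)))
               (ℕ.≤-trans (𝟙-∨ (not (does (x Fin.≟ a)) ∧ hits x) _) (ℕ.+-monoˡ-≤ _ (except-≤ x))))) ⟩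
      ∑ℕ.sum (λ x → middle x ℕ.+ (except x ℕ.+ 𝟙 (cutEdges G s t a x)))
        ≡⟨ ∑ℕ.∑-distrib-+ middle (λ x → except x ℕ.+ 𝟙 (cutEdges G s t a x)) ⟩
      ∑ℕ.sum middle ℕ.+ ∑ℕ.sum (λ x → except x ℕ.+ 𝟙 (cutEdges G s t a x))
        ≡⟨ cong (∑ℕ.sum middle ℕ.+_) (trans (∑ℕ.∑-distrib-+ except (𝟙 ∘ cutEdges G s t a)) (sum-except h a)) ⟩
      ∑ℕ.sum middle ℕ.+ ∑ℕ.sum h
        ≤⟨ ℕ.+-monoˡ-≤ (∑ℕ.sum h) (interval-count n (suc s) (suc t)) ⟩
      (t ℕ.∸ s) ℕ.+ ∑ℕ.sum h ∎
      where
      open ℕ.≤-Reasoning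
      middle except : Fin n → ℕ
      middle x = 𝟙 (interval (suc s) (suc t) (toℕ x))
      except x = if does (x Fin.≟ a) then 0 else h x

    -- A step out of High would enter the deleted middle or follow a cut edge, and every cut edge
    -- has lost an end: the Low one if it starts at `a`, the High one otherwise.
    High-step : s ℕ.≤ t → ∀ x y → High x ≡ true → separator x ≡ false → separator y ≡ false →
      adj G x y ≡ true → High y ≡ true
    High-step s≤t x y Hx x∉ y∉ x~y with true⊎false (High y) | true⊎false (Low y)
    ... | inj₁ Hy | _       = Hy
    ... | inj₂ Hy | inj₂ Ly = ⊥-elim (false≢true (trans (sym y∉) (cong (_∨ rest) between)))
      where
      rest : Bool
      rest = (not (does (y Fin.≟ a)) ∧ hits y) ∨ cutEdges G s t a y
      s<y : s ℕ.< toℕ y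
      s<y = ℕ.≰⇒> (λ y≤s → false≢true (trans (sym Ly) (<ᵇ-true {toℕ y} {suc s} (ℕ.s≤s y≤s))))
      y≤t : toℕ y ℕ.≤ t
      y≤t = ℕ.≮⇒≥ (λ t<y → false≢true (trans (sym Hy) (<ᵇ-true {t} {toℕ y} t<y)))
      between : interval (suc s) (suc t) (toℕ y) ≡ true
      between = ∧-true {s ℕ.<ᵇ toℕ y} (<ᵇ-true s<y) (<ᵇ-true {toℕ y} {suc t} (ℕ.s≤s y≤t))
    ... | inj₂ Hy | inj₁ Ly = ⊥-elim (contradiction (x Fin.≟ a))
      where
      ∨-falseˡ : ∀ b {c} → b ∨ c ≡ false → b ≡ false
      ∨-falseˡ false _ = refl
      ∨-falseʳ : ∀ b {c} → b ∨ c ≡ false → c ≡ false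
      ∨-falseʳ false eq = eq
      cut : cutEdges G s t x y ≡ true
      cut = ∧-true x~y (∧-true Ly Hx)
      x∉′ : (not (does (x Fin.≟ a)) ∧ hits x) ∨ cutEdges G s t a x ≡ false
      x∉′ = ∨-falseʳ (interval (suc s) (suc t) (toℕ x)) x∉
      y∉′ : cutEdges G s t a y ≡ false
      y∉′ = ∨-falseʳ (not (does (y Fin.≟ a)) ∧ hits y) (∨-falseʳ (interval (suc s) (suc t) (toℕ y)) y∉)
      contradiction : Dec (x ≡ a) → ⊥
      contradiction (yes refl) with () ← trans (sym cut) y∉′
      contradiction (no x≢a)   with () ← trans
        (sym (∧-true (cong not (dec-false (x Fin.≟ a) x≢a)) (hits-edge x y cut)))
        (∨-falseˡ (not (does (x Fin.≟ a)) ∧ hits x) x∉′)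

    separates : s ℕ.≤ t → ¬ Star (AdjacentOutside G (tabulate separator)) a b
    separates s≤t path = ℕ.<-irrefl refl (ℕ.<-≤-trans (<ᵇ-true⁻¹ t (toℕ b) (High-end path Ha))
      (ℕ.≤-trans (ℕ.s≤s⁻¹ (<ᵇ-true⁻¹ (toℕ b) (suc s) Lb)) s≤t))
      where
      High-end : ∀ {x y} → Star (AdjacentOutside G (tabulate separator)) x y → High x ≡ true → High y ≡ true
      High-end ε Hx = Hx
      High-end (_◅_ {x} {y} (x∉ , y∉ , x~y) path) Hx = High-end path
        (High-step s≤t x y Hx (∉-tabulate⁻¹ separator x∉) (∉-tabulate⁻¹ separator y∉) x~y)

    a∉separator : separator a ≡ false
    a∉separator with interval (suc s) (suc t) (toℕ a) in mid
    ... | true = ⊥-elim (ℕ.<-irrefl refl (ℕ.<-≤-trans (<ᵇ-true⁻¹ t (toℕ a) Ha)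
            (ℕ.s≤s⁻¹ (<ᵇ-true⁻¹ (toℕ a) (suc t) (∧-trueʳ (s ℕ.<ᵇ toℕ a) mid)))))
    ... | false rewrite dec-true (a Fin.≟ a) refl | adj-irrefl G a = refl

    -- Here the nonadjacency of `a` and `b` enters: otherwise `b` could itself be the Low end of a
    -- cut edge at `a`.
    b∉separator : s ℕ.≤ t → separator b ≡ false
    b∉separator s≤t with interval (suc s) (suc t) (toℕ b) in mid
    ... | true = ⊥-elim (ℕ.<-irrefl refl (ℕ.<-≤-trans (<ᵇ-true⁻¹ s (toℕ b) (∧-trueˡ (s ℕ.<ᵇ toℕ b) mid))
            (ℕ.s≤s⁻¹ (<ᵇ-true⁻¹ (toℕ b) (suc s) Lb))))
    ... | false with Fin.any? (λ j → cutEdges G s t b j Bool.≟ true)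
    ... | yes (j , eq) = ⊥-elim (ℕ.<-irrefl refl (ℕ.<-≤-trans
            (<ᵇ-true⁻¹ t (toℕ b) (∧-trueʳ (toℕ j ℕ.<ᵇ suc s) (∧-trueʳ (adj G b j) eq)))
            (ℕ.≤-trans (ℕ.s≤s⁻¹ (<ᵇ-true⁻¹ (toℕ b) (suc s) Lb)) s≤t)))
    ... | no _ rewrite a≁b with does (b Fin.≟ a)
    ... | true  = refl
    ... | false = refl

  -- Subtraction-free form of "at least k - (t - s) cut edges". With fewer, a nonadjacent pair of a
  -- High and a Low vertex would be separated by fewer than k vertices.
  boundary-bound : ∀ {k} → KConnected G k → s ℕ.≤ t → suc t ℕ.< n → s ℕ.+ k ℕ.≤ t ℕ.+ ∑ℕ.sum h
  boundary-bound {k} (k<n , connected) s≤t t<n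
    with Fin.any? (λ a → Fin.any? (λ b → High a ∧ (Low b ∧ not (adj G a b)) Bool.≟ true))
  ... | yes (a , b , eq) = ℕ.≮⇒≥ impossible
    where
    Ha : High a ≡ true
    Ha = ∧-trueˡ (High a) eq
    Lb : Low b ≡ true
    Lb = ∧-trueˡ (Low b) (∧-trueʳ (High a) eq)
    a≁b : adj G a b ≡ false
    a≁b = Bool.not-injective (∧-trueʳ (Low b) (∧-trueʳ (High a) eq))
    open Separator a b Ha Lb a≁b
    impossible : ¬ (t ℕ.+ ∑ℕ.sum h ℕ.< s ℕ.+ k)
    impossible small = separates s≤t (connected (tabulate separator)
      (ℕ.≤-<-trans card-separator (ℕ.+-cancelˡ-< s _ _ (begin-strict
        s ℕ.+ ((t ℕ.∸ s) ℕ.+ ∑ℕ.sum h)  ≡⟨ ℕ.+-assoc s (t ℕ.∸ s) (∑ℕ.sum h) ⟨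
        s ℕ.+ (t ℕ.∸ s) ℕ.+ ∑ℕ.sum h    ≡⟨ cong (ℕ._+ ∑ℕ.sum h) (ℕ.m+[n∸m]≡n s≤t) ⟩
        t ℕ.+ ∑ℕ.sum h                  <⟨ small ⟩
        s ℕ.+ k                         ∎)))
      a b (∉-tabulate separator a∉separator) (∉-tabulate separator (b∉separator s≤t)))
      where open ℕ.≤-Reasoning
  -- All High-Low pairs are adjacent, so no separator is available and the edges are counted
  -- outright. With e = n - 1 - t ≥ 1 High vertices there are e (s + 1) ≥ e + s of them, and k < n
  -- gives k ≤ t + e.
  ... | no complete = begin
    s ℕ.+ k                                    ≤⟨ ℕ.+-monoʳ-≤ s (ℕ.s≤s⁻¹ (ℕ.≤-trans k<n (ℕ.≤-reflexive n≡1+t+e))) ⟩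
    s ℕ.+ (t ℕ.+ e)                            ≤⟨ ℕ.m≤m+n _ (s ℕ.* e′) ⟩
    s ℕ.+ (t ℕ.+ e) ℕ.+ s ℕ.* e′               ≡⟨ subst (λ m → s ℕ.+ (t ℕ.+ m) ℕ.+ s ℕ.* e′ ≡ t ℕ.+ m ℕ.* suc s) (sym e≡1+e′) (rearrange s t e′) ⟩
    t ℕ.+ e ℕ.* suc s                          ≡⟨ cong (t ℕ.+_) (cong (ℕ._* suc s) (sym (count-above n t))) ⟩
    t ℕ.+ ∑ℕ.sum (𝟙 ∘ High) ℕ.* suc s          ≡⟨ cong (t ℕ.+_) (∑ℕ.*-distribʳ-sum (suc s) (𝟙 ∘ High)) ⟩
    t ℕ.+ ∑ℕ.sum (λ i → 𝟙 (High i) ℕ.* suc s)  ≤⟨ ℕ.+-monoʳ-≤ t (sumℕ-mono row) ⟩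
    t ℕ.+ ∑ℕ.sum h                             ∎
    where
    open ℕ.≤-Reasoning
    e e′ : ℕ
    e = n ℕ.∸ suc t
    e′ = ℕ.pred e
    n≡1+t+e : n ≡ suc (t ℕ.+ e)
    n≡1+t+e = sym (ℕ.m+[n∸m]≡n (ℕ.<⇒≤ t<n))
    e≡1+e′ : e ≡ suc e′
    e≡1+e′ = sym (ℕ.suc-pred e {{ℕ.>-nonZero (ℕ.m<n⇒0<n∸m t<n)}})
    rearrange : ∀ s t e′ → s ℕ.+ (t ℕ.+ suc e′) ℕ.+ s ℕ.* e′ ≡ t ℕ.+ suc e′ ℕ.* suc s
    rearrange = ℕ-Solver.solve-∀
    adjacent : ∀ i j → High i ≡ true → Low j ≡ true → adj G i j ≡ true
    adjacent i j Hi Lj with true⊎false (adj G i j)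
    ... | inj₁ eq = eq
    ... | inj₂ eq = ⊥-elim (complete (i , j , ∧-true Hi (∧-true Lj (cong not eq))))
    row : ∀ i → 𝟙 (High i) ℕ.* suc s ℕ.≤ h i
    row i with true⊎false (High i)
    ... | inj₂ Hi rewrite Hi = ℕ.z≤n
    ... | inj₁ Hi = begin
      𝟙 (High i) ℕ.* suc s   ≡⟨ cong (λ b → 𝟙 b ℕ.* suc s) Hi ⟩
      1 ℕ.* suc s            ≡⟨ ℕ.*-identityˡ (suc s) ⟩
      suc s                  ≡⟨ count-below n (suc s) (ℕ.≤-trans (ℕ.s≤s s≤t) (ℕ.<⇒≤ t<n)) ⟨
      ∑ℕ.sum (𝟙 ∘ Low)       ≤⟨ sumℕ-mono (λ j → 𝟙-mono {Low j} (λ Lj → ∧-true (adjacent i j Hi Lj) (∧-true Lj Hi))) ⟩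
      h i                    ∎

ℚ-double-injective : ∀ {p q} → p + p ≡ q + q → p ≡ q
ℚ-double-injective {p} {q} eq = trans (halve p) (trans (cong (½ *_) eq) (sym (halve q)))
  where
  halve : ∀ p → p ≡ ½ * (p + p)
  halve p = trans (sym (ℚ.*-identityˡ p)) (trans (ℚ.*-distribʳ-+ p ½ ½) (sym (ℚ.*-distribˡ-+ ½ p p)))

-- Energy of a graph on ranked vertices

sq : ℚ → ℚ
sq q = q * q

-- Rows of χ are edges or windows, columns are gaps between consecutive ranks. This is the squared
-- norm of χ g, and `gram` gives the entries of χᵀχ.
energy : ∀ {m l} → (Fin m → Fin l → ℕ) → (Fin l → ℚ) → ℚ
energy χ g = sum (λ e → sq (sum (λ s → ℕ→ℚ (χ e s) * g s)))

gram : ∀ {m l} → (Fin m → Fin l → ℕ) → Fin l → Fin l → ℕ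
gram χ s t = ∑ℕ.sum (λ e → χ e s ℕ.* χ e t)

energy-gram : ∀ {m l} (χ : Fin m → Fin l → ℕ) (g : Fin l → ℚ) →
  energy χ g ≡ sum (λ s → sum (λ t → g s * g t * ℕ→ℚ (gram χ s t)))
energy-gram χ g = begin
  sum (λ e → sq (sum (λ s → c e s * g s)))
    ≡⟨ ∑ℚ.sum-cong-≗ (λ e → sum-product (λ s → c e s * g s) (λ t → c e t * g t)) ⟩
  sum (λ e → sum (λ s → sum (λ t → c e s * g s * (c e t * g t))))
    ≡⟨ ∑ℚ.∑-comm (λ e s → sum (λ t → c e s * g s * (c e t * g t))) ⟩
  sum (λ s → sum (λ e → sum (λ t → c e s * g s * (c e t * g t))))
    ≡⟨ ∑ℚ.sum-cong-≗ (λ s → ∑ℚ.∑-comm (λ e t → c e s * g s * (c e t * g t))) ⟩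
  sum (λ s → sum (λ t → sum (λ e → c e s * g s * (c e t * g t))))
    ≡⟨ ∑ℚ.sum-cong-≗ (λ s → ∑ℚ.sum-cong-≗ (λ t → entry s t)) ⟩
  sum (λ s → sum (λ t → g s * g t * ℕ→ℚ (gram χ s t))) ∎
  where
  open ≡-Reasoning
  c : ∀ e s → ℚ
  c e s = ℕ→ℚ (χ e s)
  swap : ∀ c d x y → c * x * (d * y) ≡ x * y * (c * d)
  swap = solve-∀ ℚ-ring
  entry : ∀ s t → sum (λ e → c e s * g s * (c e t * g t)) ≡ g s * g t * ℕ→ℚ (gram χ s t)
  entry s t = begin
    sum (λ e → c e s * g s * (c e t * g t))
      ≡⟨ ∑ℚ.sum-cong-≗ (λ e → trans (swap (c e s) (c e t) (g s) (g t))
           (cong (g s * g t *_) (sym (ℕ→ℚ-* (χ e s) (χ e t))))) ⟩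
    sum (λ e → g s * g t * ℕ→ℚ (χ e s ℕ.* χ e t))
      ≡⟨ sum-scale (g s * g t) (λ e → ℕ→ℚ (χ e s ℕ.* χ e t)) ⟩
    g s * g t * sum (λ e → ℕ→ℚ (χ e s ℕ.* χ e t))
      ≡⟨ cong (g s * g t *_) (sum-ℕ→ℚ (λ e → χ e s ℕ.* χ e t)) ⟩
    g s * g t * ℕ→ℚ (gram χ s t) ∎

-- The coefficient of g s · g t in the expanded energy is a Gram entry, so for nonnegative g an
-- entrywise inequality is enough. The family χ is indexed by one endpoint of an edge, its rows by
-- the other.
energy-compare : ∀ {m n l r} (χ : Fin m → Fin n → Fin l → ℕ) (ψ : Fin r → Fin l → ℕ) (g : Fin l → ℚ) →
  (∀ s → 0ℚ ≤ g s) →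
  (∀ s t → gram ψ s t ℕ.≤ ∑ℕ.sum (λ i → gram (χ i) s t)) →
  energy ψ g ≤ sum (λ i → energy (χ i) g)
energy-compare χ ψ g 0≤g ψ≤χ = begin
  energy ψ g
    ≡⟨ energy-gram ψ g ⟩
  sum (λ s → sum (λ t → g s * g t * ℕ→ℚ (gram ψ s t)))
    ≤⟨ sum-mono (λ s → sum-mono (λ t → *-mono-≤ˡ (g s * g t) (*-nonneg (0≤g s) (0≤g t)) (ℕ→ℚ-mono-≤ (ψ≤χ s t)))) ⟩
  sum (λ s → sum (λ t → g s * g t * ℕ→ℚ (∑ℕ.sum (λ i → gram (χ i) s t))))
    ≡⟨ ∑ℚ.sum-cong-≗ (λ s → ∑ℚ.sum-cong-≗ (λ t → trans
         (cong (g s * g t *_) (sym (sum-ℕ→ℚ (λ i → gram (χ i) s t))))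
         (sym (sum-scale (g s * g t) (λ i → ℕ→ℚ (gram (χ i) s t)))))) ⟩
  sum (λ s → sum (λ t → sum (λ i → g s * g t * ℕ→ℚ (gram (χ i) s t))))
    ≡⟨ ∑ℚ.sum-cong-≗ (λ s → ∑ℚ.∑-comm (λ t i → g s * g t * ℕ→ℚ (gram (χ i) s t))) ⟩
  sum (λ s → sum (λ i → sum (λ t → g s * g t * ℕ→ℚ (gram (χ i) s t))))
    ≡⟨ ∑ℚ.∑-comm (λ s i → sum (λ t → g s * g t * ℕ→ℚ (gram (χ i) s t))) ⟩
  sum (λ i → sum (λ s → sum (λ t → g s * g t * ℕ→ℚ (gram (χ i) s t))))
    ≡⟨ ∑ℚ.sum-cong-≗ (λ i → energy-gram (χ i) g) ⟨
  sum (λ i → energy (χ i) g) ∎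
  where open ℚ.≤-Reasoning

gram-sym : ∀ {m l} (χ : Fin m → Fin l → ℕ) s t → gram χ s t ≡ gram χ t s
gram-sym χ s t = ∑ℕ.sum-cong-≗ (λ e → ℕ.*-comm (χ e s) (χ e t))

gap : (ℕ → ℚ) → ℕ → ℚ
gap u s = u (suc s) - u s

-- The gaps inside the interval telescope. The minima with `l` cut off windows that run past the
-- last gap.
interval-sum : ∀ l lo hi (u : ℕ → ℚ) → lo ℕ.≤ hi →
  sum {l} (λ s → ℕ→ℚ (𝟙 (interval lo hi (toℕ s))) * gap u (toℕ s)) ≡ u (hi ℕ.⊓ l) - u (lo ℕ.⊓ l)
interval-sum zero lo hi u _ = begin
  0ℚ                                ≡⟨ ℚ.+-inverseʳ (u 0) ⟨
  u 0 - u 0                         ≡⟨ cong₂ (λ a b → u a - u b) (ℕ.⊓-zeroʳ hi) (ℕ.⊓-zeroʳ lo) ⟨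
  u (hi ℕ.⊓ 0) - u (lo ℕ.⊓ 0)       ∎
  where open ≡-Reasoning
interval-sum (suc l) zero zero u _ = begin
  sum {suc l} (λ s → 0ℚ * gap u (toℕ s))  ≡⟨ ∑ℚ.sum-cong-≗ {suc l} (λ s → ℚ.*-zeroˡ (gap u (toℕ s))) ⟩
  sum {suc l} (λ s → 0ℚ)                  ≡⟨ sum-zero (suc l) ⟩
  0ℚ                                      ≡⟨ ℚ.+-inverseʳ (u 0) ⟨
  u 0 - u 0                               ∎
  where open ≡-Reasoning
interval-sum (suc l) zero (suc hi) u _ = begin
  1ℚ * gap u 0 + _                               ≡⟨ cong (1ℚ * gap u 0 +_) (interval-sum l zero hi (u ∘ suc) ℕ.z≤n) ⟩
  1ℚ * (u 1 - u 0) + (u (suc (hi ℕ.⊓ l)) - u 1)  ≡⟨ telescope (u 0) (u 1) (u (suc (hi ℕ.⊓ l))) ⟩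
  u (suc (hi ℕ.⊓ l)) - u 0                       ∎
  where
  open ≡-Reasoning
  telescope : ∀ x y z → 1ℚ * (y - x) + (z - y) ≡ z - x
  telescope = solve-∀ ℚ-ring
interval-sum (suc l) (suc lo) (suc hi) u lo≤hi = begin
  0ℚ * gap u 0 + _                               ≡⟨ cong₂ _+_ (ℚ.*-zeroˡ (gap u 0)) (interval-sum l lo hi (u ∘ suc) (ℕ.s≤s⁻¹ lo≤hi)) ⟩
  0ℚ + (u (suc (hi ℕ.⊓ l)) - u (suc (lo ℕ.⊓ l))) ≡⟨ ℚ.+-identityˡ _ ⟩
  u (suc (hi ℕ.⊓ l)) - u (suc (lo ℕ.⊓ l))        ∎
  where open ≡-Reasoning

interval-empty : ∀ lo hi s → hi ℕ.≤ lo → interval lo hi s ≡ false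
interval-empty lo hi s hi≤lo with true⊎false (interval lo hi s)
... | inj₂ eq = eq
... | inj₁ eq = ⊥-elim (ℕ.<-irrefl refl (ℕ.≤-trans (<ᵇ-true⁻¹ s hi (∧-trueʳ (lo ℕ.<ᵇ suc s) eq))
                  (ℕ.≤-trans hi≤lo (ℕ.s≤s⁻¹ (<ᵇ-true⁻¹ lo (suc s) (∧-trueˡ _ eq))))))

𝟙-* : ∀ b c → 𝟙 b ℕ.* 𝟙 c ≡ 𝟙 (b ∧ c)
𝟙-* true  c = ℕ.+-identityʳ (𝟙 c)
𝟙-* false c = refl

-- With κ = k - 1, `a ∸ κ` is the rank a + 1 - k cut off at 0. The N + κ summands are exactly the
-- windows that meet the N gaps, so each gap lies in k of them.
windowEnergy : ℕ → ℕ → (ℕ → ℚ) → ℚ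
windowEnergy N κ u = sum {N ℕ.+ κ} (λ a → sq (u (suc (toℕ a)) - u (toℕ a ℕ.∸ κ)))

-- The quadratic form of ΔI - A

weight : ∀ {n} → Graph n → Fin n → Fin n → ℚ
weight G i j = ℕ→ℚ (𝟙 (adj G i j))

adjForm : ∀ {n} → Graph n → (Fin n → ℚ) → (Fin n → ℚ) → ℚ
adjForm G x y = sum (λ i → sum (λ j → weight G i j * (x i * y j)))

normSq : ∀ {n} → (Fin n → ℚ) → ℚ
normSq x = sum (λ i → sq (x i))

form : ∀ {n} → Graph n → ℕ → (Fin n → ℚ) → ℚ
form G Δ x = ℕ→ℚ Δ * normSq x - adjForm G x x

degree-sum : ∀ {n} (G : Graph n) i → degree G i ≡ ∑ℕ.sum (λ j → 𝟙 (adj G i j))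
degree-sum G i = card-tabulate (adj G i)

weight-sum : ∀ {n} (G : Graph n) i → sum (weight G i) ≡ ℕ→ℚ (degree G i)
weight-sum G i = trans (sum-ℕ→ℚ (λ j → 𝟙 (adj G i j))) (cong ℕ→ℚ (sym (degree-sum G i)))

sum₂ : ∀ {m n} → (Fin m → Fin n → ℚ) → ℚ
sum₂ f = sum (λ i → sum (f i))

sum₂-cong : ∀ {m n} {f g : Fin m → Fin n → ℚ} → (∀ i j → f i j ≡ g i j) → sum₂ f ≡ sum₂ g
sum₂-cong f≡g = ∑ℚ.sum-cong-≗ (λ i → ∑ℚ.sum-cong-≗ (f≡g i))

sum₂-mono : ∀ {m n} {f g : Fin m → Fin n → ℚ} → (∀ i j → f i j ≤ g i j) → sum₂ f ≤ sum₂ g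
sum₂-mono f≤g = sum-mono (λ i → sum-mono (f≤g i))

sum₂-+ : ∀ {m n} (f g : Fin m → Fin n → ℚ) → sum₂ (λ i j → f i j + g i j) ≡ sum₂ f + sum₂ g
sum₂-+ f g = trans (∑ℚ.sum-cong-≗ (λ i → ∑ℚ.∑-distrib-+ (f i) (g i)))
  (∑ℚ.∑-distrib-+ (λ i → sum (f i)) (λ i → sum (g i)))

weight-sym : ∀ {n} (G : Graph n) i j → weight G i j ≡ weight G j i
weight-sym G i j = cong (ℕ→ℚ ∘ 𝟙) (adj-sym G i j)

adjForm-sym : ∀ {n} (G : Graph n) x y → adjForm G x y ≡ adjForm G y x
adjForm-sym G x y = trans (∑ℚ.∑-comm (λ i j → weight G i j * (x i * y j)))
  (sum₂-cong (λ j i → cong₂ _*_ (weight-sym G i j) (ℚ.*-comm (x i) (y j))))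

0≤weight : ∀ {n} (G : Graph n) i j → 0ℚ ≤ weight G i j
0≤weight G i j = 0≤ℕ→ℚ (𝟙 (adj G i j))

weighted-rows : ∀ {n} (G : Graph n) (f : Fin n → ℚ) →
  sum₂ (λ i j → weight G i j * f i) ≡ sum (λ i → ℕ→ℚ (degree G i) * f i)
weighted-rows G f = ∑ℚ.sum-cong-≗ (λ i → trans (sym (∑ℚ.*-distribʳ-sum (f i) (weight G i)))
  (cong (_* f i) (weight-sum G i)))

weighted-rows-≤ : ∀ {n} (G : Graph n) {Δ} → (∀ i → degree G i ℕ.≤ Δ) → ∀ f → (∀ i → 0ℚ ≤ f i) →
  sum₂ (λ i j → weight G i j * f i) ≤ ℕ→ℚ Δ * sum f
weighted-rows-≤ G {Δ} deg≤Δ f 0≤f = begin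
  sum₂ (λ i j → weight G i j * f i)          ≡⟨ weighted-rows G f ⟩
  sum (λ i → ℕ→ℚ (degree G i) * f i)         ≤⟨ sum-mono (λ i → *-mono-≤ʳ (f i) (0≤f i) (ℕ→ℚ-mono-≤ (deg≤Δ i))) ⟩
  sum (λ i → ℕ→ℚ Δ * f i)                    ≡⟨ sum-scale (ℕ→ℚ Δ) f ⟩
  ℕ→ℚ Δ * sum f                              ∎
  where open ℚ.≤-Reasoning

-- The window energy bounds the form from below

module _ {N κ : ℕ} (G : Graph (suc N)) (connected : KConnected G (suc κ)) where

  private
    -- The row of an edge marks the gaps it crosses on the way down from `i` to `j`. The opposite
    -- orientation has an empty row, so that each edge contributes once.
    χ : Fin (suc N) → Fin (suc N) → Fin N → ℕ
    χ i j s = 𝟙 (adj G i j ∧ interval (toℕ j) (toℕ i) (toℕ s))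

    ψ : Fin (N ℕ.+ κ) → Fin N → ℕ
    ψ a s = 𝟙 (interval (toℕ a ℕ.∸ κ) (suc (toℕ a)) (toℕ s))

    -- A window that contains both gaps ends at a gap `a` with t ≤ a < s + k.
    ψ-gram : ∀ s t → toℕ s ℕ.≤ toℕ t → gram ψ s t ℕ.≤ (toℕ s ℕ.+ suc κ) ℕ.∸ toℕ t
    ψ-gram s t s≤t = ℕ.≤-trans (sumℕ-mono bound) (interval-count (N ℕ.+ κ) (toℕ t) (toℕ s ℕ.+ suc κ))
      where
      bound : ∀ a → ψ a s ℕ.* ψ a t ℕ.≤ 𝟙 (interval (toℕ t) (toℕ s ℕ.+ suc κ) (toℕ a))
      bound a = ℕ.≤-trans (ℕ.≤-reflexive (𝟙-* (I s) (I t))) (𝟙-mono {I s ∧ I t} inside)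
        where
        I : Fin N → Bool
        I s = interval (toℕ a ℕ.∸ κ) (suc (toℕ a)) (toℕ s)
        inside : I s ∧ I t ≡ true → interval (toℕ t) (toℕ s ℕ.+ suc κ) (toℕ a) ≡ true
        inside eq = ∧-true {toℕ t ℕ.<ᵇ suc (toℕ a)}
          (∧-trueʳ (toℕ a ℕ.∸ κ ℕ.<ᵇ suc (toℕ t)) (∧-trueʳ (I s) eq)) (<ᵇ-true a<s+k)
          where
          a-κ≤s : toℕ a ℕ.∸ κ ℕ.≤ toℕ s
          a-κ≤s = ℕ.s≤s⁻¹ (<ᵇ-true⁻¹ (toℕ a ℕ.∸ κ) (suc (toℕ s))
            (∧-trueˡ (toℕ a ℕ.∸ κ ℕ.<ᵇ suc (toℕ s)) (∧-trueˡ (I s) eq)))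
          a<s+k : toℕ a ℕ.< toℕ s ℕ.+ suc κ
          a<s+k = begin-strict
            toℕ a                       ≤⟨ ℕ.m≤n+m∸n (toℕ a) κ ⟩
            κ ℕ.+ (toℕ a ℕ.∸ κ)         ≤⟨ ℕ.+-monoʳ-≤ κ a-κ≤s ⟩
            κ ℕ.+ toℕ s                 ≡⟨ ℕ.+-comm κ (toℕ s) ⟩
            toℕ s ℕ.+ κ                 <⟨ ℕ.+-monoʳ-< (toℕ s) (ℕ.n<1+n κ) ⟩
            toℕ s ℕ.+ suc κ             ∎
            where open ℕ.≤-Reasoning

    -- Every cut edge for `s` and `t` crosses both gaps, so `boundary-bound` provides the count.
    χ-gram : ∀ s t → toℕ s ℕ.≤ toℕ t →
      (toℕ s ℕ.+ suc κ) ℕ.∸ toℕ t ℕ.≤ ∑ℕ.sum (λ i → gram (χ i) s t)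
    χ-gram s t s≤t = ℕ.≤-trans
      (ℕ.m≤n+o⇒m∸n≤o (toℕ s ℕ.+ suc κ) (toℕ t) (boundary-bound G (toℕ s) (toℕ t) connected s≤t (ℕ.s≤s (Fin.toℕ<n t))))
      (sumℕ-mono (λ i → sumℕ-mono (bound i)))
      where
      bound : ∀ i j → 𝟙 (cutEdges G (toℕ s) (toℕ t) i j) ℕ.≤ χ i j s ℕ.* χ i j t
      bound i j = ℕ.≤-trans
        (𝟙-mono {cutEdges G (toℕ s) (toℕ t) i j} λ eq →
          let i~j = ∧-trueˡ (adj G i j) eq
              low = ∧-trueʳ (adj G i j) eq
              j≤s = ∧-trueˡ (toℕ j ℕ.<ᵇ suc (toℕ s)) low
              t<i = ∧-trueʳ (toℕ j ℕ.<ᵇ suc (toℕ s)) low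
          in ∧-true {adj G i j ∧ interval (toℕ j) (toℕ i) (toℕ s)}
               (∧-true {adj G i j} i~j (∧-true {toℕ j ℕ.<ᵇ suc (toℕ s)} j≤s (<ᵇ-true (ℕ.≤-<-trans s≤t (<ᵇ-true⁻¹ (toℕ t) (toℕ i) t<i)))))
               (∧-true {adj G i j} i~j (∧-true {toℕ j ℕ.<ᵇ suc (toℕ t)} (<ᵇ-true (ℕ.<-≤-trans (<ᵇ-true⁻¹ (toℕ j) (suc (toℕ s)) j≤s) (ℕ.s≤s s≤t))) t<i)))
        (ℕ.≤-reflexive (sym (𝟙-* (adj G i j ∧ interval (toℕ j) (toℕ i) (toℕ s)) _)))

    gram-≤ : ∀ s t → gram ψ s t ℕ.≤ ∑ℕ.sum (λ i → gram (χ i) s t)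
    gram-≤ s t with ℕ.≤-total (toℕ s) (toℕ t)
    ... | inj₁ s≤t = ℕ.≤-trans (ψ-gram s t s≤t) (χ-gram s t s≤t)
    ... | inj₂ t≤s = begin
      gram ψ s t                         ≡⟨ gram-sym ψ s t ⟩
      gram ψ t s                         ≤⟨ ℕ.≤-trans (ψ-gram t s t≤s) (χ-gram t s t≤s) ⟩
      ∑ℕ.sum (λ i → gram (χ i) t s)      ≡⟨ ∑ℕ.sum-cong-≗ (λ i → gram-sym (χ i) t s) ⟩
      ∑ℕ.sum (λ i → gram (χ i) s t)      ∎
      where open ℕ.≤-Reasoning

  module _ (u : ℕ → ℚ) (u-mono : ∀ s → u s ≤ u (suc s)) (u-const : ∀ s → u (s ℕ.⊓ N) ≡ u s) where

    private
      rise : Fin (suc N) → Fin (suc N) → ℚ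
      rise i j = sum (λ s → ℕ→ℚ (χ i j s) * gap u (toℕ s))

      z : Fin (suc N) → ℚ
      z i = u (toℕ i)

      rise-adj : ∀ i j → toℕ j ℕ.≤ toℕ i → adj G i j ≡ true → rise i j ≡ z i - z j
      rise-adj i j j≤i i~j = begin
        rise i j
          ≡⟨ ∑ℚ.sum-cong-≗ {N} (λ s → cong (λ b → ℕ→ℚ (𝟙 (b ∧ interval (toℕ j) (toℕ i) (toℕ s))) * gap u (toℕ s)) i~j) ⟩
        sum {N} (λ s → ℕ→ℚ (𝟙 (interval (toℕ j) (toℕ i) (toℕ s))) * gap u (toℕ s))
          ≡⟨ interval-sum N (toℕ j) (toℕ i) u j≤i ⟩
        u (toℕ i ℕ.⊓ N) - u (toℕ j ℕ.⊓ N)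
          ≡⟨ cong₂ _-_ (u-const (toℕ i)) (u-const (toℕ j)) ⟩
        z i - z j ∎
        where open ≡-Reasoning

      rise-zero : ∀ i j → (∀ s → adj G i j ∧ interval (toℕ j) (toℕ i) s ≡ false) → rise i j ≡ 0ℚ
      rise-zero i j never = begin
        rise i j                                   ≡⟨ ∑ℚ.sum-cong-≗ {N} (λ s → cong (λ b → ℕ→ℚ (𝟙 b) * gap u (toℕ s)) (never (toℕ s))) ⟩
        sum {N} (λ s → 0ℚ * gap u (toℕ s))         ≡⟨ ∑ℚ.sum-cong-≗ {N} (λ s → ℚ.*-zeroˡ (gap u (toℕ s))) ⟩
        sum {N} (λ s → 0ℚ)                         ≡⟨ sum-zero N ⟩
        0ℚ                                         ∎
        where open ≡-Reasoning

      rise-≤ : ∀ i j → toℕ i ℕ.≤ toℕ j → rise i j ≡ 0ℚ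
      rise-≤ i j i≤j = rise-zero i j λ s → trans
        (cong (adj G i j ∧_) (interval-empty (toℕ j) (toℕ i) s i≤j)) (Bool.∧-zeroʳ (adj G i j))

      edge-rise : ∀ i j → weight G i j * sq (z i - z j) ≡ sq (rise i j) + sq (rise j i)
      edge-rise i j = [ (λ i~j → [ downward i~j , upward i~j ]′ (ℕ.≤-total (toℕ j) (toℕ i))) , non-edge ]′ (true⊎false (adj G i j))
        where
        open ≡-Reasoning
        non-edge : adj G i j ≡ false → weight G i j * sq (z i - z j) ≡ sq (rise i j) + sq (rise j i)
        non-edge i≁j = begin
          weight G i j * sq (z i - z j)  ≡⟨ cong (λ b → ℕ→ℚ (𝟙 b) * sq (z i - z j)) i≁j ⟩
          0ℚ * sq (z i - z j)            ≡⟨ ℚ.*-zeroˡ (sq (z i - z j)) ⟩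
          sq 0ℚ + sq 0ℚ                  ≡⟨ cong₂ (λ a b → sq a + sq b)
            (rise-zero i j (λ s → cong (_∧ interval (toℕ j) (toℕ i) s) i≁j))
            (rise-zero j i (λ s → cong (_∧ interval (toℕ i) (toℕ j) s) (trans (adj-sym G j i) i≁j))) ⟨
          sq (rise i j) + sq (rise j i)  ∎
        downward : adj G i j ≡ true → toℕ j ℕ.≤ toℕ i → weight G i j * sq (z i - z j) ≡ sq (rise i j) + sq (rise j i)
        downward i~j j≤i = begin
          weight G i j * sq (z i - z j)  ≡⟨ cong (λ b → ℕ→ℚ (𝟙 b) * sq (z i - z j)) i~j ⟩
          1ℚ * sq (z i - z j)            ≡⟨ lemma (z i) (z j) ⟩
          sq (z i - z j) + sq 0ℚ         ≡⟨ cong₂ (λ a b → sq a + sq b) (rise-adj i j j≤i i~j) (rise-≤ j i j≤i) ⟨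
          sq (rise i j) + sq (rise j i)  ∎
          where
          lemma : ∀ x y → 1ℚ * ((x - y) * (x - y)) ≡ (x - y) * (x - y) + 0ℚ * 0ℚ
          lemma = solve-∀ ℚ-ring
        upward : adj G i j ≡ true → toℕ i ℕ.≤ toℕ j → weight G i j * sq (z i - z j) ≡ sq (rise i j) + sq (rise j i)
        upward i~j i≤j = begin
          weight G i j * sq (z i - z j)  ≡⟨ cong (λ b → ℕ→ℚ (𝟙 b) * sq (z i - z j)) i~j ⟩
          1ℚ * sq (z i - z j)            ≡⟨ lemma (z i) (z j) ⟩
          sq 0ℚ + sq (z j - z i)         ≡⟨ cong₂ (λ a b → sq a + sq b) (rise-≤ i j i≤j)
            (rise-adj j i i≤j (trans (adj-sym G j i) i~j)) ⟨
          sq (rise i j) + sq (rise j i)  ∎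
          where
          lemma : ∀ x y → 1ℚ * ((x - y) * (x - y)) ≡ 0ℚ * 0ℚ + (y - x) * (y - x)
          lemma = solve-∀ ℚ-ring

    windowEnergy≤rises : windowEnergy N κ u ≤ sum (λ i → sum (λ j → sq (rise i j)))
    windowEnergy≤rises = subst (_≤ sum (λ i → energy (χ i) g))
      (∑ℚ.sum-cong-≗ {N ℕ.+ κ} (λ a → cong sq (trans
        (interval-sum N (toℕ a ℕ.∸ κ) (suc (toℕ a)) u (ℕ.≤-trans (ℕ.m∸n≤m (toℕ a) κ) (ℕ.n≤1+n (toℕ a))))
        (cong₂ _-_ (u-const (suc (toℕ a))) (u-const (toℕ a ℕ.∸ κ))))))
      (energy-compare χ ψ g (λ s → p≤q⇒0≤q-p (u-mono (toℕ s))) gram-≤)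
      where
      g : Fin N → ℚ
      g s = gap u (toℕ s)

    -- An edge has a nonzero rise in at most one of its two orientations but occurs twice in
    -- `adjForm`. Doubling the identity symmetrises it, after which it holds for each pair by
    -- polarisation.
    rises+adjForm : sum₂ (λ i j → sq (rise i j)) + adjForm G z z ≡ sum₂ (λ i j → weight G i j * sq (z i))
    rises+adjForm = ℚ-double-injective (begin
      (R + A) + (R + A)
        ≡⟨ rearrange R A ⟩
      (R + R) + (A + A)
        ≡⟨ cong₂ _+_ (cong (R +_) (∑ℚ.∑-comm (λ i j → sq (rise i j)))) refl ⟩
      (sum₂ (λ i j → sq (rise i j)) + sum₂ (λ i j → sq (rise j i))) + (A + A)
        ≡⟨ cong₂ _+_ (sum₂-+ (λ i j → sq (rise i j)) (λ i j → sq (rise j i))) (sum₂-+ a a) ⟨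
      sum₂ (λ i j → sq (rise i j) + sq (rise j i)) + sum₂ (λ i j → a i j + a i j)
        ≡⟨ sum₂-+ (λ i j → sq (rise i j) + sq (rise j i)) (λ i j → a i j + a i j) ⟨
      sum₂ (λ i j → (sq (rise i j) + sq (rise j i)) + (a i j + a i j))
        ≡⟨ sum₂-cong (λ i j → trans (cong (_+ (a i j + a i j)) (sym (edge-rise i j)))
             (trans (polarize (weight G i j) (z i) (z j))
               (cong (λ w → weight G i j * sq (z i) + w * sq (z j)) (weight-sym G i j)))) ⟩
      sum₂ (λ i j → weight G i j * sq (z i) + weight G j i * sq (z j))
        ≡⟨ sum₂-+ (λ i j → weight G i j * sq (z i)) (λ i j → weight G j i * sq (z j)) ⟩
      D + sum₂ (λ i j → weight G j i * sq (z j))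
        ≡⟨ cong (D +_) (∑ℚ.∑-comm (λ i j → weight G j i * sq (z j))) ⟩
      D + D ∎)
      where
      open ≡-Reasoning
      a : Fin (suc N) → Fin (suc N) → ℚ
      a i j = weight G i j * (z i * z j)
      R A D : ℚ
      R = sum₂ (λ i j → sq (rise i j))
      A = adjForm G z z
      D = sum₂ (λ i j → weight G i j * sq (z i))
      rearrange : ∀ R A → (R + A) + (R + A) ≡ (R + R) + (A + A)
      rearrange = solve-∀ ℚ-ring
      polarize : ∀ w x y → w * ((x - y) * (x - y)) + (w * (x * y) + w * (x * y)) ≡ w * (x * x) + w * (y * y)
      polarize = solve-∀ ℚ-ring

    windowEnergy≤form : ∀ {Δ} → (∀ i → degree G i ℕ.≤ Δ) → windowEnergy N κ u ≤ form G Δ z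
    windowEnergy≤form {Δ} deg≤Δ = begin
      windowEnergy N κ u
        ≤⟨ windowEnergy≤rises ⟩
      R
        ≡⟨ add-sub R A ⟩
      (R + A) - A
        ≡⟨ cong (_- A) rises+adjForm ⟩
      sum₂ (λ i j → weight G i j * sq (z i)) - A
        -- Raising every degree to Δ adds the nonnegative sum of (Δ - deg i) zᵢ².
        ≤⟨ ℚ.+-monoˡ-≤ (- A) (weighted-rows-≤ G deg≤Δ (λ i → sq (z i)) (λ i → square-nonneg (z i))) ⟩
      form G Δ z ∎
      where
      open ℚ.≤-Reasoning
      R A : ℚ
      R = sum₂ (λ i j → sq (rise i j))
      A = adjForm G z z
      add-sub : ∀ R A → R ≡ (R + A) - A
      add-sub = solve-∀ ℚ-ring

-- Cauchy–Schwarz and truncation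

-- The explicit support puts its size in place of n: Δ when a vector has been truncated, N when it
-- vanishes at one vertex. In the induction the cross term is bounded entry by entry through 2xy ≤
-- x² + y².
cauchy-schwarz : ∀ {n} (χ : Fin n → Bool) (f : Fin n → ℚ) → (∀ i → χ i ≡ false → f i ≡ 0ℚ) →
  sq (sum f) ≤ ℕ→ℚ (∑ℕ.sum (𝟙 ∘ χ)) * normSq f
cauchy-schwarz {zero} χ f _ = ℚ.≤-refl
cauchy-schwarz {suc n} χ f supp with χ zero | supp zero
... | false | f₀≡0 = begin
  sq (f zero + F)           ≡⟨ cong (λ x → sq (x + F)) (f₀≡0 refl) ⟩
  sq (0ℚ + F)               ≡⟨ cong sq (ℚ.+-identityˡ F) ⟩
  sq F                      ≤⟨ cauchy-schwarz (χ ∘ suc) (f ∘ suc) (supp ∘ suc) ⟩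
  m * S                     ≡⟨ cong (m *_) (ℚ.+-identityˡ S) ⟨
  m * (sq 0ℚ + S)           ≡⟨ cong (λ x → m * (sq x + S)) (f₀≡0 refl) ⟨
  m * (sq (f zero) + S)     ∎
  where
  open ℚ.≤-Reasoning
  m F S : ℚ
  m = ℕ→ℚ (∑ℕ.sum (𝟙 ∘ χ ∘ suc))
  F = sum (f ∘ suc)
  S = normSq (f ∘ suc)
... | true | _ = begin
  sq (x + F)                          ≡⟨ expand x F ⟩
  sq x + (2ℚ * x * F + sq F)          ≤⟨ ℚ.+-monoʳ-≤ (sq x) (ℚ.+-mono-≤ cross (cauchy-schwarz (χ ∘ suc) (f ∘ suc) (supp ∘ suc))) ⟩
  sq x + ((m * sq x + S) + m * S)     ≡⟨ collect x m S ⟩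
  (1ℚ + m) * (sq x + S)               ≡⟨ cong (_* (sq x + S)) (ℕ→ℚ-+ 1 M) ⟨
  ℕ→ℚ (suc M) * (sq x + S)            ∎
  where
  open ℚ.≤-Reasoning
  M : ℕ
  M = ∑ℕ.sum (𝟙 ∘ χ ∘ suc)
  x m F S : ℚ
  x = f zero
  m = ℕ→ℚ M
  F = sum (f ∘ suc)
  S = normSq (f ∘ suc)
  expand : ∀ x F → (x + F) * (x + F) ≡ x * x + ((1ℚ + 1ℚ) * x * F + F * F)
  expand = solve-∀ ℚ-ring
  collect : ∀ x m S → x * x + ((m * (x * x) + S) + m * S) ≡ (1ℚ + m) * (x * x + S)
  collect = solve-∀ ℚ-ring
  am-gm : ∀ x y → 1ℚ * (x * x) + y * y ≡ (1ℚ + 1ℚ) * x * y + (x - y) * (x - y)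
  am-gm = solve-∀ ℚ-ring
  vanish : ∀ x → 0ℚ * (x * x) + 0ℚ * 0ℚ ≡ (1ℚ + 1ℚ) * x * 0ℚ
  vanish = solve-∀ ℚ-ring
  term : ∀ i → 2ℚ * x * f (suc i) ≤ ℕ→ℚ (𝟙 (χ (suc i))) * sq x + sq (f (suc i))
  term i with χ (suc i) | supp (suc i)
  ... | true  | _   = offset-≤ (sq (x - f (suc i))) (am-gm x (f (suc i))) (square-nonneg (x - f (suc i)))
  ... | false | f≡0 rewrite f≡0 refl = ℚ.≤-reflexive (sym (vanish x))
  cross : 2ℚ * x * F ≤ m * sq x + S
  cross = begin
    2ℚ * x * F
      ≡⟨ sum-scale (2ℚ * x) (f ∘ suc) ⟨
    sum (λ i → 2ℚ * x * f (suc i))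
      ≤⟨ sum-mono term ⟩
    sum (λ i → ℕ→ℚ (𝟙 (χ (suc i))) * sq x + sq (f (suc i)))
      ≡⟨ ∑ℚ.∑-distrib-+ (λ i → ℕ→ℚ (𝟙 (χ (suc i))) * sq x) (λ i → sq (f (suc i))) ⟩
    sum (λ i → ℕ→ℚ (𝟙 (χ (suc i))) * sq x) + S
      ≡⟨ cong (_+ S) (∑ℚ.*-distribʳ-sum (sq x) (λ i → ℕ→ℚ (𝟙 (χ (suc i))))) ⟨
    sum (λ i → ℕ→ℚ (𝟙 (χ (suc i)))) * sq x + S
      ≡⟨ cong (λ c → c * sq x + S) (sum-ℕ→ℚ (λ i → 𝟙 (χ (suc i)))) ⟩
    m * sq x + S ∎

sum-δ : ∀ {n} (f : Fin n → ℚ) i → sum (λ j → ℕ→ℚ (𝟙 (does (j Fin.≟ i))) * f j) ≡ f i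
sum-δ {suc n} f zero = begin
  1ℚ * f zero + sum (λ j → 0ℚ * f (suc j))  ≡⟨ cong₂ _+_ (ℚ.*-identityˡ (f zero)) (∑ℚ.sum-cong-≗ (λ j → ℚ.*-zeroˡ (f (suc j)))) ⟩
  f zero + sum {n} (λ _ → 0ℚ)               ≡⟨ cong (f zero +_) (sum-zero n) ⟩
  f zero + 0ℚ                               ≡⟨ ℚ.+-identityʳ (f zero) ⟩
  f zero                                    ∎
  where open ≡-Reasoning
sum-δ {suc n} f (suc i) = trans (cong₂ _+_ (ℚ.*-zeroˡ (f zero)) (sum-δ (f ∘ suc) i)) (ℚ.+-identityˡ (f (suc i)))

-- A simple graph on r vertices has spectral radius at most r − 1.
adjForm-supported : ∀ {n} (G : Graph n) (χ : Fin n → Bool) (z : Fin n → ℚ) → (∀ i → 0ℚ ≤ z i) →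
  (∀ i → χ i ≡ false → z i ≡ 0ℚ) →
  adjForm G z z + normSq z ≤ ℕ→ℚ (∑ℕ.sum (𝟙 ∘ χ)) * normSq z
adjForm-supported G χ z 0≤z supp = begin
  adjForm G z z + normSq z
    ≡⟨ cong (adjForm G z z +_) (∑ℚ.sum-cong-≗ (λ i → sum-δ (λ j → z i * z j) i)) ⟨
  adjForm G z z + sum₂ (λ i j → δ i j * (z i * z j))
    ≡⟨ sum₂-+ (λ i j → weight G i j * (z i * z j)) (λ i j → δ i j * (z i * z j)) ⟨
  sum₂ (λ i j → weight G i j * (z i * z j) + δ i j * (z i * z j))
    ≤⟨ sum₂-mono entry ⟩
  sum₂ (λ i j → z i * z j)
    ≡⟨ sum-product z z ⟨
  sq (sum z)
    ≤⟨ cauchy-schwarz χ z supp ⟩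
  ℕ→ℚ (∑ℕ.sum (𝟙 ∘ χ)) * normSq z ∎
  where
  open ℚ.≤-Reasoning
  δ : ∀ i j → ℚ
  δ i j = ℕ→ℚ (𝟙 (does (j Fin.≟ i)))
  entry : ∀ i j → weight G i j * (z i * z j) + δ i j * (z i * z j) ≤ z i * z j
  entry i j = begin
    weight G i j * (z i * z j) + δ i j * (z i * z j)
      ≡⟨ ℚ.*-distribʳ-+ (z i * z j) (weight G i j) (δ i j) ⟨
    (weight G i j + δ i j) * (z i * z j)
      ≡⟨ cong (_* (z i * z j)) (ℕ→ℚ-+ (𝟙 (adj G i j)) (𝟙 (does (j Fin.≟ i)))) ⟨
    ℕ→ℚ (𝟙 (adj G i j) ℕ.+ 𝟙 (does (j Fin.≟ i))) * (z i * z j)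
      ≤⟨ *-mono-≤ʳ (z i * z j) (*-nonneg (0≤z i) (0≤z j)) (ℕ→ℚ-mono-≤ (adj-≟-≤1 G i j)) ⟩
    1ℚ * (z i * z j)
      ≡⟨ ℚ.*-identityˡ (z i * z j) ⟩
    z i * z j ∎

-- On a support of at most Δ vertices A has radius at most Δ - 1, which leaves at least the identity
-- of ΔI - A.
normSq≤form : ∀ {n} (G : Graph n) Δ (χ : Fin n → Bool) (z : Fin n → ℚ) → (∀ i → 0ℚ ≤ z i) →
  (∀ i → χ i ≡ false → z i ≡ 0ℚ) → ∑ℕ.sum (𝟙 ∘ χ) ℕ.≤ Δ → normSq z ≤ form G Δ z
normSq≤form G Δ χ z 0≤z supp count≤Δ = begin
  normSq z
    ≡⟨ add-sub (normSq z) (adjForm G z z) ⟩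
  (adjForm G z z + normSq z) - adjForm G z z
    ≤⟨ ℚ.+-monoˡ-≤ (- adjForm G z z) (ℚ.≤-trans (adjForm-supported G χ z 0≤z supp)
         (*-mono-≤ʳ (normSq z) (sum-nonneg (λ i → square-nonneg (z i))) (ℕ→ℚ-mono-≤ count≤Δ))) ⟩
  form G Δ z ∎
  where
  open ℚ.≤-Reasoning
  add-sub : ∀ S A → S ≡ (A + S) - A
  add-sub = solve-∀ ℚ-ring

-- The cross term is twice Δ Σ yᵢxᵢ - yᵀAx. Dominance bounds row i of yᵀAx by deg i · yᵢxᵢ. It is
-- available whenever x is largest wherever y lives: for a constant x, and for a truncation x with
-- excess y.
form-superadditive : ∀ {n} (G : Graph n) {Δ} → (∀ i → degree G i ℕ.≤ Δ) → (x y : Fin n → ℚ) →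
  (∀ i → 0ℚ ≤ y i * x i) → (∀ i j → y i * x j ≤ y i * x i) →
  form G Δ x + form G Δ y ≤ form G Δ (λ i → x i + y i)
form-superadditive G {Δ} deg≤Δ x y 0≤yx dominant = offset-≤ (2ℚ * (D * P - C)) identity
  (*-nonneg (ℚ.nonNegative⁻¹ 2ℚ) (p≤q⇒0≤q-p C≤DP))
  where
  D X Y P A B C : ℚ
  D = ℕ→ℚ Δ
  X = normSq x
  Y = normSq y
  P = sum (λ i → y i * x i)
  A = adjForm G x x
  B = adjForm G y y
  C = adjForm G y x
  C≤DP : C ≤ D * P
  C≤DP = begin
    C                                            ≤⟨ sum₂-mono (λ i j → *-mono-≤ˡ (weight G i j) (0≤weight G i j) (dominant i j)) ⟩
    sum₂ (λ i j → weight G i j * (y i * x i))    ≤⟨ weighted-rows-≤ G deg≤Δ (λ i → y i * x i) 0≤yx ⟩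
    D * P                                        ∎
    where open ℚ.≤-Reasoning
  normSq-+ : normSq (λ i → x i + y i) ≡ X + (Y + (P + P))
  normSq-+ = begin
    sum (λ i → sq (x i + y i))
      ≡⟨ ∑ℚ.sum-cong-≗ (λ i → binomial (x i) (y i)) ⟩
    sum (λ i → sq (x i) + (sq (y i) + (y i * x i + y i * x i)))
      ≡⟨ ∑ℚ.∑-distrib-+ (λ i → sq (x i)) (λ i → sq (y i) + (y i * x i + y i * x i)) ⟩
    X + sum (λ i → sq (y i) + (y i * x i + y i * x i))
      ≡⟨ cong (X +_) (∑ℚ.∑-distrib-+ (λ i → sq (y i)) (λ i → y i * x i + y i * x i)) ⟩
    X + (Y + sum (λ i → y i * x i + y i * x i))
      ≡⟨ cong (λ q → X + (Y + q)) (∑ℚ.∑-distrib-+ (λ i → y i * x i) (λ i → y i * x i)) ⟩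
    X + (Y + (P + P)) ∎
    where
    open ≡-Reasoning
    binomial : ∀ x y → (x + y) * (x + y) ≡ x * x + (y * y + (y * x + y * x))
    binomial = solve-∀ ℚ-ring
  adjForm-+ : adjForm G (λ i → x i + y i) (λ i → x i + y i) ≡ A + (B + (C + C))
  adjForm-+ = begin
    sum₂ (λ i j → w i j * ((x i + y i) * (x j + y j)))
      ≡⟨ sum₂-cong (λ i j → expand (w i j) (x i) (y i) (x j) (y j)) ⟩
    sum₂ (λ i j → w i j * (x i * x j) + (w i j * (y i * y j) + (w i j * (y i * x j) + w i j * (x i * y j))))
      ≡⟨ sum₂-+ (λ i j → w i j * (x i * x j)) (λ i j → w i j * (y i * y j) + (w i j * (y i * x j) + w i j * (x i * y j))) ⟩
    A + sum₂ (λ i j → w i j * (y i * y j) + (w i j * (y i * x j) + w i j * (x i * y j)))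
      ≡⟨ cong (A +_) (sum₂-+ (λ i j → w i j * (y i * y j)) (λ i j → w i j * (y i * x j) + w i j * (x i * y j))) ⟩
    A + (B + sum₂ (λ i j → w i j * (y i * x j) + w i j * (x i * y j)))
      ≡⟨ cong (λ q → A + (B + q)) (sum₂-+ (λ i j → w i j * (y i * x j)) (λ i j → w i j * (x i * y j))) ⟩
    A + (B + (C + adjForm G x y))
      ≡⟨ cong (λ q → A + (B + (C + q))) (adjForm-sym G x y) ⟩
    A + (B + (C + C)) ∎
    where
    open ≡-Reasoning
    w : ∀ i j → ℚ
    w = weight G
    expand : ∀ w a b c d → w * ((a + b) * (c + d)) ≡ w * (a * c) + (w * (b * d) + (w * (b * c) + w * (a * d)))
    expand = solve-∀ ℚ-ring
  identity : form G Δ (λ i → x i + y i) ≡ form G Δ x + form G Δ y + 2ℚ * (D * P - C)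
  identity = trans (cong₂ (λ a b → D * a - b) normSq-+ adjForm-+) (collect D X Y P A B C)
    where
    collect : ∀ D X Y P A B C → D * (X + (Y + (P + P))) - (A + (B + (C + C))) ≡
      (D * X - A) + (D * Y - B) + (1ℚ + 1ℚ) * (D * P - C)
    collect = solve-∀ ℚ-ring

-- Window sums

sum< : ℕ → (ℕ → ℚ) → ℚ
sum< n f = sum {n} (λ i → f (toℕ i))

sum<-split : ∀ m n (f : ℕ → ℚ) → sum< (m ℕ.+ n) f ≡ sum< m f + sum< n (λ i → f (m ℕ.+ i))
sum<-split zero    n f = sym (ℚ.+-identityˡ (sum< n f))
sum<-split (suc m) n f = trans (cong (f 0 +_) (sum<-split m n (f ∘ suc))) (sym (ℚ.+-assoc (f 0) _ _))

sum<-prefix : ∀ {m n} (f : ℕ → ℚ) → (∀ i → 0ℚ ≤ f i) → m ℕ.≤ n → sum< m f ≤ sum< n f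
sum<-prefix {m} {n} f 0≤f m≤n = offset-≤ (sum< (n ℕ.∸ m) (λ i → f (m ℕ.+ i)))
  (trans (cong (λ l → sum< l f) (sym (ℕ.m+[n∸m]≡n m≤n))) (sum<-split m (n ℕ.∸ m) f))
  (sum-nonneg {n ℕ.∸ m} (λ i → 0≤f (m ℕ.+ toℕ i)))

sum<-const : ∀ n {f : ℕ → ℚ} {q} → (∀ i → f i ≡ q) → sum< n f ≡ ℕ→ℚ n * q
sum<-const n {f} {q} f≡q = trans (∑ℚ.sum-cong-≗ {n} (λ i → f≡q (toℕ i))) (sum-const n q)

telescope : ∀ m (u : ℕ → ℚ) → sum< m (λ a → u (suc a)) + u 0 ≡ sum< m u + u m
telescope zero    u = refl
telescope (suc m) u = begin
  (u 1 + U) + u 0                   ≡⟨ rotate (u 1) U (u 0) ⟩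
  u 0 + (U + u 1)                   ≡⟨ cong (u 0 +_) (telescope m (u ∘ suc)) ⟩
  u 0 + (sum< m (u ∘ suc) + u (suc m))  ≡⟨ ℚ.+-assoc (u 0) _ _ ⟨
  sum< (suc m) u + u (suc m)        ∎
  where
  open ≡-Reasoning
  U : ℚ
  U = sum< m (λ a → u (suc (suc a)))
  rotate : ∀ a b c → (a + b) + c ≡ c + (b + a)
  rotate = solve-∀ ℚ-ring

window : ℕ → (ℕ → ℚ) → ℕ → ℚ
window κ u a = u (suc a) - u (a ℕ.∸ κ)

-- Every gap lies in k windows. In the proof the upper ends are u 1, ..., u m and κ copies of w, the
-- lower ends κ zeros and u 0, ..., u (m - 1).
window-sum : ∀ κ m (u : ℕ → ℚ) w → u 0 ≡ 0ℚ → (∀ j → u (m ℕ.+ j) ≡ w) →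
  sum< (m ℕ.+ κ) (window κ u) ≡ ℕ→ℚ (suc κ) * w
window-sum κ m u w u₀≡0 flat = begin
  sum< (m ℕ.+ κ) (window κ u)
    ≡⟨ sum-sub {m ℕ.+ κ} (λ a → u (suc (toℕ a))) (λ a → u (toℕ a ℕ.∸ κ)) ⟩
  sum< (m ℕ.+ κ) (λ a → u (suc a)) - sum< (m ℕ.+ κ) (λ a → u (a ℕ.∸ κ))
    ≡⟨ cong₂ _-_ upper lower ⟩
  (U₁ + ℕ→ℚ κ * w) - U₀
    ≡⟨ cong (λ q → (q + ℕ→ℚ κ * w) - U₀) U₁≡U₀+w ⟩
  ((U₀ + w) + ℕ→ℚ κ * w) - U₀
    ≡⟨ collect U₀ w (ℕ→ℚ κ) ⟩
  (1ℚ + ℕ→ℚ κ) * w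
    ≡⟨ cong (_* w) (ℕ→ℚ-+ 1 κ) ⟨
  ℕ→ℚ (suc κ) * w ∎
  where
  open ≡-Reasoning
  U₀ U₁ : ℚ
  U₀ = sum< m u
  U₁ = sum< m (λ a → u (suc a))
  collect : ∀ U w k → ((U + w) + k * w) - U ≡ (1ℚ + k) * w
  collect = solve-∀ ℚ-ring
  upper : sum< (m ℕ.+ κ) (λ a → u (suc a)) ≡ U₁ + ℕ→ℚ κ * w
  upper = trans (sum<-split m κ (λ a → u (suc a)))
    (cong (U₁ +_) (sum<-const κ (λ i → trans (cong u (sym (ℕ.+-suc m i))) (flat (suc i)))))
  lower : sum< (m ℕ.+ κ) (λ a → u (a ℕ.∸ κ)) ≡ U₀
  lower = begin
    sum< (m ℕ.+ κ) (λ a → u (a ℕ.∸ κ))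
      ≡⟨ cong (λ l → sum< l (λ a → u (a ℕ.∸ κ))) (ℕ.+-comm m κ) ⟩
    sum< (κ ℕ.+ m) (λ a → u (a ℕ.∸ κ))
      ≡⟨ sum<-split κ m (λ a → u (a ℕ.∸ κ)) ⟩
    sum< κ (λ a → u (a ℕ.∸ κ)) + sum< m (λ i → u (κ ℕ.+ i ℕ.∸ κ))
      ≡⟨ cong₂ _+_ (trans (∑ℚ.sum-cong-≗ {κ} (λ a → trans (cong u (ℕ.m≤n⇒m∸n≡0 (ℕ.<⇒≤ (Fin.toℕ<n a)))) u₀≡0)) (sum-zero κ))
           (∑ℚ.sum-cong-≗ {m} (λ i → cong u (ℕ.m+n∸m≡n κ (toℕ i)))) ⟩
    0ℚ + U₀
      ≡⟨ ℚ.+-identityˡ U₀ ⟩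
    U₀ ∎
  U₁≡U₀+w : U₁ ≡ U₀ + w
  U₁≡U₀+w = begin
    U₁         ≡⟨ ℚ.+-identityʳ U₁ ⟨
    U₁ + 0ℚ    ≡⟨ cong (U₁ +_) u₀≡0 ⟨
    U₁ + u 0   ≡⟨ telescope m u ⟩
    U₀ + u m   ≡⟨ cong (U₀ +_) (trans (cong u (sym (ℕ.+-identityʳ m))) (flat 0)) ⟩
    U₀ + w     ∎

-- This controls the top value alone. For a sequence flat from rank m on, only the first m + κ
-- windows can be nonzero, which sharpens the factor from N + κ.
window-cauchy : ∀ {N m} κ (u : ℕ → ℚ) w → m ℕ.≤ N → u 0 ≡ 0ℚ → (∀ j → u (m ℕ.+ j) ≡ w) →
  sq (ℕ→ℚ (suc κ) * w) ≤ ℕ→ℚ (m ℕ.+ κ) * windowEnergy N κ u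
window-cauchy {N} {m} κ u w m≤N u₀≡0 flat = begin
  sq (ℕ→ℚ (suc κ) * w)
    ≡⟨ cong sq (window-sum κ m u w u₀≡0 flat) ⟨
  sq (sum< (m ℕ.+ κ) (window κ u))
    ≤⟨ cauchy-schwarz {m ℕ.+ κ} (λ _ → true) (λ a → window κ u (toℕ a)) (λ _ ()) ⟩
  ℕ→ℚ (∑ℕ.sum {m ℕ.+ κ} (λ _ → 1)) * sum< (m ℕ.+ κ) (sq ∘ window κ u)
    ≡⟨ cong (λ c → ℕ→ℚ c * sum< (m ℕ.+ κ) (sq ∘ window κ u)) (trans (sumℕ-const (m ℕ.+ κ) 1) (ℕ.*-identityʳ (m ℕ.+ κ))) ⟩
  ℕ→ℚ (m ℕ.+ κ) * sum< (m ℕ.+ κ) (sq ∘ window κ u)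
    ≤⟨ *-mono-≤ˡ (ℕ→ℚ (m ℕ.+ κ)) (0≤ℕ→ℚ (m ℕ.+ κ))
         (sum<-prefix (sq ∘ window κ u) (λ a → square-nonneg (window κ u a)) (ℕ.+-monoˡ-≤ κ m≤N)) ⟩
  ℕ→ℚ (m ℕ.+ κ) * windowEnergy N κ u ∎
  where open ℚ.≤-Reasoning

-- The bound k² ‖z‖² ≤ T · form z on ranked vertices

sum<-mono : ∀ n {f g : ℕ → ℚ} → (∀ i → i ℕ.< n → f i ≤ g i) → sum< n f ≤ sum< n g
sum<-mono n f≤g = sum-mono {n} (λ i → f≤g (toℕ i) (Fin.toℕ<n i))

sum<-+ : ∀ n (f g : ℕ → ℚ) → sum< n (λ i → f i + g i) ≡ sum< n f + sum< n g
sum<-+ n f g = ∑ℚ.∑-distrib-+ {n} (λ i → f (toℕ i)) (λ i → g (toℕ i))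

sum<-scale : ∀ n q (f : ℕ → ℚ) → sum< n (λ i → q * f i) ≡ q * sum< n f
sum<-scale n q f = sum-scale {n} q (λ i → f (toℕ i))

sum<-cong : ∀ n {f g : ℕ → ℚ} → (∀ i → f i ≡ g i) → sum< n f ≡ sum< n g
sum<-cong n f≡g = ∑ℚ.sum-cong-≗ {n} (λ i → f≡g (toℕ i))

sum<-blocks : ∀ q k (f : ℕ → ℚ) → sum< (q ℕ.* k) f ≡ sum< q (λ j → sum< k (λ c → f (j ℕ.* k ℕ.+ c)))
sum<-blocks zero    k f = refl
sum<-blocks (suc q) k f = trans (sum<-split k (q ℕ.* k) f) (cong (sum< k f +_)
  (trans (sum<-blocks q k (λ i → f (k ℕ.+ i)))
    (sum<-cong q (λ j → sum<-cong k (λ c → cong f (sym (ℕ.+-assoc k (j ℕ.* k) c)))))))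

triangular : ∀ q → sum< q (λ j → ℕ→ℚ (suc j)) + sum< q (λ j → ℕ→ℚ (suc j)) ≡ ℕ→ℚ (q ℕ.* suc q)
triangular q = trans (sym (cong₂ _+_ eq eq)) (trans (sym (ℕ→ℚ-+ (∑ℕ.sum {q} (λ j → suc (toℕ j))) _)) (cong ℕ→ℚ (gauss q)))
  where
  eq : ℕ→ℚ (∑ℕ.sum {q} (λ j → suc (toℕ j))) ≡ sum< q (λ j → ℕ→ℚ (suc j))
  eq = sym (sum-ℕ→ℚ {q} (λ j → suc (toℕ j)))
  shift : ∀ q → ∑ℕ.sum {q} (λ j → suc (suc (toℕ j))) ≡ q ℕ.+ ∑ℕ.sum {q} (λ j → suc (toℕ j))
  shift q = trans (∑ℕ.∑-distrib-+ {q} (λ _ → 1) (λ j → suc (toℕ j)))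
    (cong (ℕ._+ ∑ℕ.sum {q} (λ j → suc (toℕ j))) (trans (sumℕ-const q 1) (ℕ.*-identityʳ q)))
  gauss : ∀ q → ∑ℕ.sum {q} (λ j → suc (toℕ j)) ℕ.+ ∑ℕ.sum {q} (λ j → suc (toℕ j)) ≡ q ℕ.* suc q
  gauss zero    = refl
  gauss (suc q) = begin
    suc (∑ℕ.sum {q} (λ j → suc (suc (toℕ j)))) ℕ.+ suc (∑ℕ.sum {q} (λ j → suc (suc (toℕ j))))
      ≡⟨ cong (λ s → suc s ℕ.+ suc s) (shift q) ⟩
    suc (q ℕ.+ X) ℕ.+ suc (q ℕ.+ X)
      ≡⟨ collect q X ⟩
    (X ℕ.+ X) ℕ.+ (2 ℕ.+ 2 ℕ.* q)
      ≡⟨ cong (ℕ._+ (2 ℕ.+ 2 ℕ.* q)) (gauss q) ⟩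
    q ℕ.* suc q ℕ.+ (2 ℕ.+ 2 ℕ.* q)
      ≡⟨ finish q ⟩
    suc q ℕ.* suc (suc q) ∎
    where
    open ≡-Reasoning
    X : ℕ
    X = ∑ℕ.sum {q} (λ j → suc (toℕ j))
    collect : ∀ q x → suc (q ℕ.+ x) ℕ.+ suc (q ℕ.+ x) ≡ (x ℕ.+ x) ℕ.+ (2 ℕ.+ 2 ℕ.* q)
    collect = ℕ-Solver.solve-∀
    finish : ∀ q → q ℕ.* suc q ℕ.+ (2 ℕ.+ 2 ℕ.* q) ≡ suc q ℕ.* suc (suc q)
    finish = ℕ-Solver.solve-∀

mono-≤ : ∀ (u : ℕ → ℚ) → (∀ s → u s ≤ u (suc s)) → ∀ {s t} → s ℕ.≤ t → u s ≤ u t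
mono-≤ u u-mono {s} {t} s≤t = subst (λ t → u s ≤ u t) (ℕ.m+[n∸m]≡n s≤t) (climb (t ℕ.∸ s))
  where
  climb : ∀ d → u s ≤ u (s ℕ.+ d)
  climb zero    = ℚ.≤-reflexive (cong u (sym (ℕ.+-identityʳ s)))
  climb (suc d) = ℚ.≤-trans (climb d) (ℚ.≤-trans (u-mono (s ℕ.+ d)) (ℚ.≤-reflexive (cong u (sym (ℕ.+-suc s d)))))

-- Ranks 1, …, qk fall into k arithmetic progressions of step k; each is a path climbing from 0.
path-bound : ∀ q κ (u : ℕ → ℚ) → u 0 ≡ 0ℚ →
  2ℚ * sum< (q ℕ.* suc κ) (λ i → sq (u (suc i))) ≤
  ℕ→ℚ (q ℕ.* suc q) * sum< (q ℕ.* suc κ) (sq ∘ window κ u)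
path-bound q κ u u₀≡0 = begin
  2ℚ * sum< (q ℕ.* k) (λ i → sq (u (suc i)))
    ≡⟨ cong (2ℚ *_) (sum<-blocks q k (λ i → sq (u (suc i)))) ⟩
  2ℚ * sum< q (λ j → sum< k (λ c → sq (u (suc (j ℕ.* k ℕ.+ c)))))
    ≤⟨ *-mono-≤ˡ 2ℚ (ℚ.nonNegative⁻¹ 2ℚ) (sum<-mono q (λ j j<q → sum<-mono k (λ c c<k → climb-≤ j c j<q c<k))) ⟩
  2ℚ * sum< q (λ j → sum< k (λ c → ℕ→ℚ (suc j) * V c))
    ≡⟨ cong (2ℚ *_) (sum<-cong q (λ j → sum<-scale k (ℕ→ℚ (suc j)) V)) ⟩
  2ℚ * sum< q (λ j → ℕ→ℚ (suc j) * sum< k V)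
    ≡⟨ cong (2ℚ *_) (∑ℚ.*-distribʳ-sum {q} (sum< k V) (λ j → ℕ→ℚ (suc (toℕ j)))) ⟨
  2ℚ * (sum< q (λ j → ℕ→ℚ (suc j)) * sum< k V)
    ≡⟨ double (sum< q (λ j → ℕ→ℚ (suc j))) (sum< k V) ⟩
  (sum< q (λ j → ℕ→ℚ (suc j)) + sum< q (λ j → ℕ→ℚ (suc j))) * sum< k V
    ≡⟨ cong₂ _*_ (triangular q) V-total ⟩
  ℕ→ℚ (q ℕ.* suc q) * sum< (q ℕ.* k) (sq ∘ window κ u) ∎
  where
  open ℚ.≤-Reasoning
  k : ℕ
  k = suc κ
  double : ∀ a b → (1ℚ + 1ℚ) * (a * b) ≡ (a + a) * b
  double = solve-∀ ℚ-ring
  step : ℕ → ℕ → ℚ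
  step c l = window κ u (l ℕ.* k ℕ.+ c)
  V : ℕ → ℚ
  V c = sum< q (λ l → sq (step c l))
  V-total : sum< k V ≡ sum< (q ℕ.* k) (sq ∘ window κ u)
  V-total = trans (∑ℚ.∑-comm {k} {q} (λ c l → sq (step (toℕ c) (toℕ l))))
    (sym (sum<-blocks q k (sq ∘ window κ u)))
  -- The windows numbered l k + c with c fixed abut: each starts at the rank where its predecessor
  -- ends, and the first, cut off because c < k, starts at rank 0.
  climb : ∀ j c → c ℕ.< k → sum< (suc j) (step c) ≡ u (suc (j ℕ.* k ℕ.+ c))
  climb j c c<k = begin-equality
    sum< (suc j) (step c)
      ≡⟨ sum-sub {suc j} (λ l → u (suc (toℕ l ℕ.* k ℕ.+ c))) (λ l → u (toℕ l ℕ.* k ℕ.+ c ℕ.∸ κ)) ⟩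
    sum< (suc j) (v ∘ suc) - (u (c ℕ.∸ κ) + sum< j (λ l → u (suc l ℕ.* k ℕ.+ c ℕ.∸ κ)))
      ≡⟨ cong₂ (λ a b → sum< (suc j) (v ∘ suc) - (a + b))
           (cong u (ℕ.m≤n⇒m∸n≡0 (ℕ.s≤s⁻¹ c<k))) (sum<-cong j (λ l → cong u (lower l))) ⟩
    sum< (suc j) (v ∘ suc) - sum< (suc j) v
      ≡⟨ shuffle (sum< (suc j) (v ∘ suc)) (sum< (suc j) v) ⟩
    sum< (suc j) (v ∘ suc) + 0ℚ - sum< (suc j) v
      ≡⟨ cong (_- sum< (suc j) v) (trans (cong (sum< (suc j) (v ∘ suc) +_) (sym u₀≡0)) (telescope (suc j) v)) ⟩
    sum< (suc j) v + u (suc (j ℕ.* k ℕ.+ c)) - sum< (suc j) v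
      ≡⟨ cancel (sum< (suc j) v) (u (suc (j ℕ.* k ℕ.+ c))) ⟩
    u (suc (j ℕ.* k ℕ.+ c)) ∎
    where
    v : ℕ → ℚ
    v zero    = u 0
    v (suc l) = u (suc (l ℕ.* k ℕ.+ c))
    lower : ∀ l → suc l ℕ.* k ℕ.+ c ℕ.∸ κ ≡ suc (l ℕ.* k ℕ.+ c)
    lower l = trans (cong (ℕ._∸ κ) (reorder κ (l ℕ.* k) c)) (ℕ.m+n∸m≡n κ (suc (l ℕ.* k ℕ.+ c)))
      where
      reorder : ∀ κ a c → suc κ ℕ.+ a ℕ.+ c ≡ κ ℕ.+ suc (a ℕ.+ c)
      reorder = ℕ-Solver.solve-∀
    shuffle : ∀ a b → a - b ≡ a + 0ℚ - b
    shuffle = solve-∀ ℚ-ring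
    cancel : ∀ a b → a + b - a ≡ b
    cancel = solve-∀ ℚ-ring
  climb-≤ : ∀ j c → j ℕ.< q → c ℕ.< k → sq (u (suc (j ℕ.* k ℕ.+ c))) ≤ ℕ→ℚ (suc j) * V c
  climb-≤ j c j<q c<k = begin
    sq (u (suc (j ℕ.* k ℕ.+ c)))
      ≡⟨ cong sq (climb j c c<k) ⟨
    sq (sum< (suc j) (step c))
      ≤⟨ cauchy-schwarz {suc j} (λ _ → true) (λ l → step c (toℕ l)) (λ _ ()) ⟩
    ℕ→ℚ (∑ℕ.sum {suc j} (λ _ → 1)) * sum< (suc j) (sq ∘ step c)
      ≡⟨ cong (λ n → ℕ→ℚ n * sum< (suc j) (sq ∘ step c)) (trans (sumℕ-const (suc j) 1) (ℕ.*-identityʳ (suc j))) ⟩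
    ℕ→ℚ (suc j) * sum< (suc j) (sq ∘ step c)
      ≤⟨ *-mono-≤ˡ (ℕ→ℚ (suc j)) (0≤ℕ→ℚ (suc j)) (sum<-prefix (sq ∘ step c) (λ l → square-nonneg (step c l)) j<q) ⟩
    ℕ→ℚ (suc j) * V c ∎

-- Weighted Cauchy-Schwarz for z = x + (z - x), cleared of denominators. The weights make constants
-- add: norm bounds Y/L for the first part and 1 for the second give Y/L + 1 for z.
weighted-split : ∀ Y L z x → Y * L * sq z ≤ (Y + L) * (L * sq x + Y * sq (z - x))
weighted-split Y L z x = offset-≤ _ (identity Y L z x) (square-nonneg (Y * (z - x) - L * x))
  where
  identity : ∀ Y L z x → (Y + L) * (L * (x * x) + Y * ((z - x) * (z - x))) ≡
    Y * L * (z * z) + (Y * (z - x) - L * x) * (Y * (z - x) - L * x)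
  identity = solve-∀ ℚ-ring

-- The term E M² is a loan: over the r pairs of `bound-short` it amounts to R E M², and the e middle
-- ranks repay it through `middle-inequality` at R M² each. Besides squares, the defect contains 2 E
-- M (M - y), whence the bounds on y and M.
pair-inequality : ∀ {R E x y M} → 0ℚ ≤ R → 0ℚ ≤ E → 0ℚ ≤ M → y ≤ M →
  (R + E) * (sq x + sq y) ≤ ((R + E) + 2ℚ * R) * ((sq x + sq (y - x)) + sq (M - y)) + E * sq M
pair-inequality {R} {E} {x} {y} {M} 0≤R 0≤E 0≤M y≤M = offset-≤ _ (sos R E x y M)
  (+-nonneg (+-nonneg (*-nonneg (+-nonneg 0≤R 0≤E) (square-nonneg (y - x)))
                      (*-nonneg 0≤R (square-nonneg (x + x - y))))
            (+-nonneg (*-nonneg (*-nonneg (ℚ.nonNegative⁻¹ 2ℚ) 0≤E) (*-nonneg 0≤M (p≤q⇒0≤q-p y≤M)))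
                      (*-nonneg (*-nonneg (ℚ.nonNegative⁻¹ (2ℚ + 1ℚ)) 0≤R) (square-nonneg (M - y)))))
  where
  sos : ∀ R E x y M →
    ((R + E) + (1ℚ + 1ℚ) * R) * ((x * x + (y - x) * (y - x)) + (M - y) * (M - y)) + E * (M * M) ≡
    (R + E) * (x * x + y * y) +
    (((R + E) * ((y - x) * (y - x)) + R * ((x + x - y) * (x + x - y))) +
     ((1ℚ + 1ℚ) * E * (M * (M - y)) + (1ℚ + 1ℚ + 1ℚ) * R * ((M - y) * (M - y))))
  sos = solve-∀ ℚ-ring

-- The surplus R M² is drawn from 2 (t² + (M - t)²) - M² = (2t - M)².
middle-inequality : ∀ {R E t M} → 0ℚ ≤ R → 0ℚ ≤ E →
  (R + E) * sq t + R * sq M ≤ ((R + E) + 2ℚ * R) * (sq t + sq (M - t))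
middle-inequality {R} {E} {t} {M} 0≤R 0≤E = offset-≤ _ (sos R E t M)
  (+-nonneg (*-nonneg (+-nonneg 0≤R 0≤E) (square-nonneg (M - t)))
            (*-nonneg 0≤R (square-nonneg (t + t - M))))
  where
  sos : ∀ R E t M → ((R + E) + (1ℚ + 1ℚ) * R) * (t * t + (M - t) * (M - t)) ≡
    ((R + E) * (t * t) + R * (M * M)) +
    ((R + E) * ((M - t) * (M - t)) + R * ((t + t - M) * (t + t - M)))
  sos = solve-∀ ℚ-ring

-- The cases on Δ and N

module Ranked {N κ Δ : ℕ} (G : Graph (suc N)) (connected : KConnected G (suc κ))
  (deg≤Δ : ∀ i → degree G i ℕ.≤ Δ) where

  k : ℕ
  k = suc κ

  K : ℚ
  K = ℕ→ℚ k

  -- The sorted values live on all of ℕ, constant beyond N, so that windows overrunning the last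
  -- rank are treated like the others.
  record Ranking : Set where
    field
      u       : ℕ → ℚ
      u₀≡0    : u 0 ≡ 0ℚ
      u-mono  : ∀ s → u s ≤ u (suc s)
      u-const : ∀ s → u (s ℕ.⊓ N) ≡ u s

    z : Fin (suc N) → ℚ
    z i = u (toℕ i)

    0≤u : ∀ s → 0ℚ ≤ u s
    0≤u s = subst (_≤ u s) u₀≡0 (mono-≤ u u-mono ℕ.z≤n)

    flat : ∀ j → u (N ℕ.+ j) ≡ u N
    flat j = trans (sym (u-const (N ℕ.+ j))) (cong u (ℕ.m≥n⇒m⊓n≡n (ℕ.m≤m+n N j)))

    W : ℚ
    W = windowEnergy N κ u

    0≤W : 0ℚ ≤ W
    0≤W = sum-nonneg {N ℕ.+ κ} (λ a → square-nonneg (window κ u (toℕ a)))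

    W≤form : W ≤ form G Δ z
    W≤form = windowEnergy≤form G connected u u-mono u-const deg≤Δ

    0≤form : 0ℚ ≤ form G Δ z
    0≤form = ℚ.≤-trans 0≤W W≤form

    normSq-z : normSq z ≡ sum< N (λ i → sq (u (suc i)))
    normSq-z = trans (cong (λ q → sq q + sum< N (λ i → sq (u (suc i)))) u₀≡0)
      (ℚ.+-identityˡ (sum< N (λ i → sq (u (suc i)))))

  Bound : Ranking → ℕ → Set
  Bound ρ T = ℕ→ℚ (k ℕ.* k) * normSq z ≤ ℕ→ℚ T * form G Δ z
    where open Ranking ρ

  Bound-mono : ∀ ρ {S T} → S ℕ.≤ T → Bound ρ S → Bound ρ T
  Bound-mono ρ S≤T bound = ℚ.≤-trans bound (*-mono-≤ʳ _ (Ranking.0≤form ρ) (ℕ→ℚ-mono-≤ S≤T))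

  -- Rank 0 carries the value 0, so z is supported on N ≤ Δ vertices and its norm is at most its
  -- form.
  bound-complete : ∀ ρ → N ℕ.≤ Δ → Bound ρ (k ℕ.* k)
  bound-complete ρ N≤Δ = *-mono-≤ˡ (ℕ→ℚ (k ℕ.* k)) (0≤ℕ→ℚ (k ℕ.* k))
    (normSq≤form G Δ (λ i → 0 ℕ.<ᵇ toℕ i) z (λ i → 0≤u (toℕ i)) vanish
      (ℕ.≤-trans (ℕ.≤-reflexive (count-above (suc N) 0)) N≤Δ))
    where
    open Ranking ρ
    vanish : ∀ i → (0 ℕ.<ᵇ toℕ i) ≡ false → z i ≡ 0ℚ
    vanish zero _ = u₀≡0

  -- Truncate at the value of rank m: the excess lives on the top Δ vertices, where the form
  -- dominates the norm, and the truncated part is controlled by the windows below rank m.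
  bound-dense : ∀ ρ m → N ≡ suc m ℕ.+ Δ → Bound ρ (N ℕ.* (suc m ℕ.+ κ) ℕ.+ k ℕ.* k)
  bound-dense ρ m′ N≡m+Δ = *-cancel-≤ˡ Y 0<Y (begin
    Y * (ℕ→ℚ (k ℕ.* k) * normSq z)
      ≡⟨ cong (λ c → Y * (c * normSq z)) (ℕ→ℚ-* k k) ⟩
    Y * (K * K * normSq z)
      ≡⟨ trans (sym (ℚ.*-assoc Y (K * K) (normSq z))) (sym (sum-scale (Y * (K * K)) (sq ∘ z))) ⟩
    sum (λ i → Y * (K * K) * sq (z i))
      ≤⟨ sum-mono {f = λ i → Y * (K * K) * sq (z i)} (λ i → weighted-split Y (K * K) (z i) (x i)) ⟩
    sum (λ i → (Y + K * K) * (K * K * sq (x i) + Y * sq (y i)))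
      ≡⟨ sum-scale (Y + K * K) (λ i → K * K * sq (x i) + Y * sq (y i)) ⟩
    (Y + K * K) * sum (λ i → K * K * sq (x i) + Y * sq (y i))
      ≡⟨ cong ((Y + K * K) *_) (trans (∑ℚ.∑-distrib-+ (λ i → K * K * sq (x i)) (λ i → Y * sq (y i)))
           (cong₂ _+_ (sum-scale (K * K) (sq ∘ x)) (sum-scale Y (sq ∘ y)))) ⟩
    (Y + K * K) * (K * K * normSq x + Y * normSq y)
      ≤⟨ *-mono-≤ˡ (Y + K * K) (+-nonneg (ℚ.<⇒≤ 0<Y) (square-nonneg K)) (ℚ.+-mono-≤ low high) ⟩
    (Y + K * K) * (Y * form G Δ x + Y * form G Δ y)
      ≡⟨ factor Y (K * K) (form G Δ x) (form G Δ y) ⟩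
    Y * ((Y + K * K) * (form G Δ x + form G Δ y))
      ≤⟨ *-mono-≤ˡ Y (ℚ.<⇒≤ 0<Y) (*-mono-≤ˡ (Y + K * K) (+-nonneg (ℚ.<⇒≤ 0<Y) (square-nonneg K)) split) ⟩
    Y * ((Y + K * K) * form G Δ z)
      ≡⟨ cong (λ c → Y * (c * form G Δ z)) (trans (cong (Y +_) (sym (ℕ→ℚ-* k k))) (sym (ℕ→ℚ-+ (N ℕ.* (m ℕ.+ κ)) (k ℕ.* k)))) ⟩
    Y * (ℕ→ℚ (N ℕ.* (m ℕ.+ κ) ℕ.+ k ℕ.* k) * form G Δ z) ∎)
    where
    open ℚ.≤-Reasoning
    open Ranking ρ
    m : ℕ
    -- This is N - Δ, so exactly Δ ranks lie above it, as many as `normSq≤form` admits.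
    m = suc m′
    m≤N : m ℕ.≤ N
    m≤N = subst (m ℕ.≤_) (sym N≡m+Δ) (ℕ.m≤m+n m Δ)
    Y w : ℚ
    Y = ℕ→ℚ (N ℕ.* (m ℕ.+ κ))
    w = u m
    0<Y : 0ℚ < Y
    0<Y = 0<ℕ→ℚ (ℕ.*-mono-≤ {1} {N} {1} {m ℕ.+ κ} (ℕ.≤-trans (ℕ.s≤s ℕ.z≤n) m≤N) (ℕ.s≤s ℕ.z≤n))
    low-ranking : Ranking
    low-ranking = record
      { u       = λ s → u (s ℕ.⊓ m)
      ; u₀≡0    = u₀≡0
      ; u-mono  = λ s → mono-≤ u u-mono (ℕ.⊓-monoˡ-≤ m (ℕ.n≤1+n s))
      ; u-const = λ s → cong u (trans (ℕ.⊓-assoc s N m) (cong (s ℕ.⊓_) (ℕ.m≥n⇒m⊓n≡n m≤N)))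
      }
    x y : Fin (suc N) → ℚ
    x = Ranking.z low-ranking
    y i = u (toℕ i) - x i
    x≤w : ∀ i → x i ≤ w
    x≤w i = mono-≤ u u-mono (ℕ.m⊓n≤n (toℕ i) m)
    0≤x : ∀ i → 0ℚ ≤ x i
    0≤x i = 0≤u (toℕ i ℕ.⊓ m)
    0≤y : ∀ i → 0ℚ ≤ y i
    0≤y i = p≤q⇒0≤q-p (mono-≤ u u-mono (ℕ.m⊓n≤m (toℕ i) m))
    y-low : ∀ i → toℕ i ℕ.≤ m → y i ≡ 0ℚ
    y-low i i≤m = trans (cong (λ s → u (toℕ i) - u s) (ℕ.m≤n⇒m⊓n≡m i≤m)) (ℚ.+-inverseʳ (u (toℕ i)))
    y-supp : ∀ i → (m ℕ.<ᵇ toℕ i) ≡ false → y i ≡ 0ℚ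
    y-supp i eq = y-low i (ℕ.≮⇒≥ (λ m<i → false≢true (trans (sym eq) (<ᵇ-true m<i))))
    dominant : ∀ i j → y i * x j ≤ y i * x i
    dominant i j with ℕ.≤-total (toℕ i) m
    ... | inj₂ m≤i = *-mono-≤ˡ (y i) (0≤y i) (subst (x j ≤_) (cong u (sym (ℕ.m≥n⇒m⊓n≡n m≤i))) (x≤w j))
    ... | inj₁ i≤m = ℚ.≤-reflexive (trans (trans (cong (_* x j) (y-low i i≤m)) (ℚ.*-zeroˡ (x j)))
                       (sym (trans (cong (_* x i) (y-low i i≤m)) (ℚ.*-zeroˡ (x i)))))
    split : form G Δ x + form G Δ y ≤ form G Δ z
    split = subst (form G Δ x + form G Δ y ≤_) reassemble
      (form-superadditive G deg≤Δ x y (λ i → *-nonneg (0≤y i) (0≤x i)) dominant)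
      where
      x+y : ∀ a b → a + (b - a) ≡ b
      x+y = solve-∀ ℚ-ring
      reassemble : form G Δ (λ i → x i + y i) ≡ form G Δ z
      reassemble = cong₂ (λ a b → ℕ→ℚ Δ * a - b)
        (∑ℚ.sum-cong-≗ (λ i → cong sq (x+y (x i) (z i))))
        (sum₂-cong (λ i j → cong₂ (λ a b → weight G i j * (a * b)) (x+y (x i) (z i)) (x+y (x j) (z j))))
    high : Y * normSq y ≤ Y * form G Δ y
    high = *-mono-≤ˡ Y (ℚ.<⇒≤ 0<Y) (normSq≤form G Δ (λ i → m ℕ.<ᵇ toℕ i) y 0≤y y-supp
      (ℕ.≤-reflexive (trans (count-above (suc N) m) (trans (cong (ℕ._∸ m) N≡m+Δ) (ℕ.m+n∸m≡n m Δ)))))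
    low : K * K * normSq x ≤ Y * form G Δ x
    low = begin
      K * K * normSq x
        ≡⟨ cong (K * K *_) (Ranking.normSq-z low-ranking) ⟩
      K * K * sum< N (λ i → sq (u (suc i ℕ.⊓ m)))
        ≤⟨ *-mono-≤ˡ (K * K) (square-nonneg K) (sum<-mono N (λ i _ →
             square-mono-≤ (0≤u (suc i ℕ.⊓ m)) (mono-≤ u u-mono (ℕ.m⊓n≤n (suc i) m)))) ⟩
      K * K * sum< N (λ i → sq w)
        ≡⟨ cong (K * K *_) (sum-const N (sq w)) ⟩
      K * K * (ℕ→ℚ N * sq w)
        ≡⟨ regroup K (ℕ→ℚ N) w ⟩
      ℕ→ℚ N * sq (K * w)
        ≤⟨ *-mono-≤ˡ (ℕ→ℚ N) (0≤ℕ→ℚ N) (ℚ.≤-trans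
             (window-cauchy κ (Ranking.u low-ranking) w m≤N u₀≡0
               (λ j → cong u (ℕ.m≥n⇒m⊓n≡n (ℕ.m≤m+n m j))))
             (*-mono-≤ˡ (ℕ→ℚ (m ℕ.+ κ)) (0≤ℕ→ℚ (m ℕ.+ κ)) (Ranking.W≤form low-ranking))) ⟩
      ℕ→ℚ N * (ℕ→ℚ (m ℕ.+ κ) * form G Δ x)
        ≡⟨ trans (sym (ℚ.*-assoc (ℕ→ℚ N) (ℕ→ℚ (m ℕ.+ κ)) (form G Δ x)))
             (cong (_* form G Δ x) (sym (ℕ→ℚ-* N (m ℕ.+ κ)))) ⟩
      Y * form G Δ x ∎
      where
      regroup : ∀ K n w → K * K * (n * (w * w)) ≡ n * ((K * w) * (K * w))
      regroup = solve-∀ ℚ-ring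
    factor : ∀ Y L a b → (Y + L) * (Y * a + Y * b) ≡ Y * ((Y + L) * (a + b))
    factor = solve-∀ ℚ-ring

  -- Each rank b ≤ r is paired with b + k; the ranks in between are compared with the top value directly.
  bound-short : ∀ ρ r e → k ≡ r ℕ.+ e → N ≡ k ℕ.+ r → Bound ρ (k ℕ.* (k ℕ.+ 2 ℕ.* r))
  bound-short ρ r e k≡r+e N≡k+r = begin
    ℕ→ℚ (k ℕ.* k) * normSq z
      ≡⟨ cong₂ _*_ (ℕ→ℚ-* k k) normSq-split ⟩
    K * K * (sum< r (λ b → sq (x b) + sq (y b)) + sum< e (sq ∘ t))
      ≡⟨ ℚ.*-assoc K K _ ⟩
    K * (K * (sum< r (λ b → sq (x b) + sq (y b)) + sum< e (sq ∘ t)))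
      ≤⟨ *-mono-≤ˡ K (0≤ℕ→ℚ k) paired ⟩
    K * (L * (sum< r pair + sum< e middle))
      ≡⟨ cong (λ q → K * (L * q)) W-split ⟨
    K * (L * W)
      ≤⟨ *-mono-≤ˡ K (0≤ℕ→ℚ k) (*-mono-≤ˡ L 0≤L W≤form) ⟩
    K * (L * form G Δ z)
      ≡⟨ trans (sym (ℚ.*-assoc K L (form G Δ z))) (cong (_* form G Δ z) (sym KL)) ⟩
    ℕ→ℚ (k ℕ.* (k ℕ.+ 2 ℕ.* r)) * form G Δ z ∎
    where
    open ℚ.≤-Reasoning
    open Ranking ρ
    R E L M : ℚ
    R = ℕ→ℚ r
    E = ℕ→ℚ e
    L = (R + E) + 2ℚ * R
    M = u N
    K≡R+E : K ≡ R + E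
    K≡R+E = trans (cong ℕ→ℚ k≡r+e) (ℕ→ℚ-+ r e)
    KL : ℕ→ℚ (k ℕ.* (k ℕ.+ 2 ℕ.* r)) ≡ K * L
    KL = trans (ℕ→ℚ-* k (k ℕ.+ 2 ℕ.* r)) (cong (K *_)
      (trans (ℕ→ℚ-+ k (2 ℕ.* r)) (cong₂ _+_ K≡R+E (ℕ→ℚ-* 2 r))))
    0≤L : 0ℚ ≤ L
    0≤L = +-nonneg (+-nonneg (0≤ℕ→ℚ r) (0≤ℕ→ℚ e)) (*-nonneg (ℚ.nonNegative⁻¹ 2ℚ) (0≤ℕ→ℚ r))
    x y t pair middle : ℕ → ℚ
    x b = u (suc b)
    y b = u (suc (k ℕ.+ b))
    t c = u (suc (r ℕ.+ c))
    -- These are the windows on the path 0, b + 1, b + 1 + k, N, whose last window is cut off at N.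
    -- In `middle` the path is 0, r + 1 + c, N.
    pair b = (sq (x b) + sq (y b - x b)) + sq (M - y b)
    middle c = sq (t c) + sq (M - t c)
    low-split : sum< k (λ i → sq (u (suc i))) ≡ sum< r (sq ∘ x) + sum< e (sq ∘ t)
    low-split = trans (cong (λ l → sum< l (λ i → sq (u (suc i)))) k≡r+e) (sum<-split r e (λ i → sq (u (suc i))))
    normSq-split : normSq z ≡ sum< r (λ b → sq (x b) + sq (y b)) + sum< e (sq ∘ t)
    normSq-split = begin-equality
      normSq z
        ≡⟨ trans normSq-z (cong (λ l → sum< l (λ i → sq (u (suc i)))) N≡k+r) ⟩
      sum< (k ℕ.+ r) (λ i → sq (u (suc i)))
        ≡⟨ sum<-split k r (λ i → sq (u (suc i))) ⟩
      sum< k (λ i → sq (u (suc i))) + sum< r (sq ∘ y)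
        ≡⟨ cong (_+ sum< r (sq ∘ y)) low-split ⟩
      sum< r (sq ∘ x) + sum< e (sq ∘ t) + sum< r (sq ∘ y)
        ≡⟨ rotate (sum< r (sq ∘ x)) (sum< e (sq ∘ t)) (sum< r (sq ∘ y)) ⟩
      sum< r (sq ∘ x) + sum< r (sq ∘ y) + sum< e (sq ∘ t)
        ≡⟨ cong (_+ sum< e (sq ∘ t)) (sum<-+ r (sq ∘ x) (sq ∘ y)) ⟨
      sum< r (λ b → sq (x b) + sq (y b)) + sum< e (sq ∘ t) ∎
      where
      rotate : ∀ a b c → a + b + c ≡ a + c + b
      rotate = solve-∀ ℚ-ring
    top : ∀ c → u (suc (k ℕ.+ (r ℕ.+ c))) ≡ M
    top c = trans (cong u (trans (sym (ℕ.+-suc k (r ℕ.+ c))) (trans (cong (k ℕ.+_) (sym (ℕ.+-suc r c)))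
      (trans (sym (ℕ.+-assoc k r (suc c))) (cong (ℕ._+ suc c) (sym N≡k+r)))))) (flat (suc c))
    low-window : ∀ a → a ℕ.< k → window κ u a ≡ u (suc a)
    low-window a a<k = trans (cong (λ q → u (suc a) - q) (trans (cong u (ℕ.m≤n⇒m∸n≡0 (ℕ.s≤s⁻¹ a<k))) u₀≡0)) (ℚ.+-identityʳ (u (suc a)))
    high-window : ∀ b → window κ u (k ℕ.+ b) ≡ u (suc (k ℕ.+ b)) - u (suc b)
    high-window b = cong (λ s → u (suc (k ℕ.+ b)) - u s)
      (trans (cong (ℕ._∸ κ) (sym (ℕ.+-suc κ b))) (ℕ.m+n∸m≡n κ (suc b)))
    defect : ℕ → ℚ
    defect c = sq (M - u (suc (r ℕ.+ c)))
    -- The window starting at rank N vanishes and completes the last block to length k.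
    last-window : sum< κ defect ≡ sum< k defect
    last-window = sym (begin-equality
      sum< k defect                             ≡⟨ cong (λ l → sum< l defect) (ℕ.+-comm 1 κ) ⟩
      sum< (κ ℕ.+ 1) defect                     ≡⟨ sum<-split κ 1 defect ⟩
      sum< κ defect + (defect (κ ℕ.+ 0) + 0ℚ)   ≡⟨ cong (λ q → sum< κ defect + (sq (M - q) + 0ℚ)) (trans (cong u (trans (reorder r κ) (sym N≡k+r))) refl) ⟩
      sum< κ defect + (sq (M - M) + 0ℚ)         ≡⟨ vanish (sum< κ defect) M ⟩
      sum< κ defect                             ∎)
      where
      reorder : ∀ r κ → suc (r ℕ.+ (κ ℕ.+ 0)) ≡ suc κ ℕ.+ r
      reorder = ℕ-Solver.solve-∀
      vanish : ∀ s M → s + ((M - M) * (M - M) + 0ℚ) ≡ s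
      vanish = solve-∀ ℚ-ring
    defect-split : sum< k defect ≡ sum< e (λ c → sq (M - t c)) + sum< r (λ b → sq (M - y b))
    defect-split = begin-equality
      sum< k defect
        ≡⟨ cong (λ l → sum< l defect) (trans k≡r+e (ℕ.+-comm r e)) ⟩
      sum< (e ℕ.+ r) defect
        ≡⟨ sum<-split e r defect ⟩
      sum< e defect + sum< r (λ b → defect (e ℕ.+ b))
        ≡⟨ cong (sum< e defect +_) (sum<-cong r (λ b → cong (λ s → sq (M - u (suc s)))
             (trans (sym (ℕ.+-assoc r e b)) (cong (ℕ._+ b) (sym k≡r+e))))) ⟩
      sum< e (λ c → sq (M - t c)) + sum< r (λ b → sq (M - y b)) ∎
    W-split : W ≡ sum< r pair + sum< e middle
    W-split = begin-equality
      sum< (N ℕ.+ κ) (sq ∘ window κ u)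
        ≡⟨ cong (λ l → sum< l (sq ∘ window κ u)) (trans (cong (ℕ._+ κ) N≡k+r) (ℕ.+-assoc k r κ)) ⟩
      sum< (k ℕ.+ (r ℕ.+ κ)) (sq ∘ window κ u)
        ≡⟨ trans (sum<-split k (r ℕ.+ κ) (sq ∘ window κ u))
             (cong (sum< k (sq ∘ window κ u) +_) (sum<-split r κ (λ i → sq (window κ u (k ℕ.+ i))))) ⟩
      sum< k (sq ∘ window κ u) + (sum< r (λ b → sq (window κ u (k ℕ.+ b))) + sum< κ (λ c → sq (window κ u (k ℕ.+ (r ℕ.+ c)))))
        ≡⟨ cong₂ _+_ (∑ℚ.sum-cong-≗ {k} (λ a → cong sq (low-window (toℕ a) (Fin.toℕ<n a))))
             (cong₂ _+_ (sum<-cong r (λ b → cong sq (high-window b)))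
               (sum<-cong κ (λ c → cong sq (trans (high-window (r ℕ.+ c)) (cong (_- u (suc (r ℕ.+ c))) (top c)))))) ⟩
      sum< k (λ i → sq (u (suc i))) + (sum< r (λ b → sq (y b - x b)) + sum< κ defect)
        ≡⟨ cong₂ (λ p q → p + (sum< r (λ b → sq (y b - x b)) + q)) low-split (trans last-window defect-split) ⟩
      (X + T) + (B + (D + F))
        ≡⟨ rearrange X T B D F ⟩
      ((X + B) + F) + (T + D)
        ≡⟨ cong₂ _+_ (trans (sum<-+ r (λ b → sq (x b) + sq (y b - x b)) (λ b → sq (M - y b)))
             (cong (_+ F) (sum<-+ r (sq ∘ x) (λ b → sq (y b - x b)))))
             (sum<-+ e (sq ∘ t) (λ c → sq (M - t c))) ⟨
      sum< r pair + sum< e middle ∎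
      where
      X T B D F : ℚ
      X = sum< r (sq ∘ x)
      T = sum< e (sq ∘ t)
      B = sum< r (λ b → sq (y b - x b))
      D = sum< e (λ c → sq (M - t c))
      F = sum< r (λ b → sq (M - y b))
      rearrange : ∀ X T B D F → (X + T) + (B + (D + F)) ≡ ((X + B) + F) + (T + D)
      rearrange = solve-∀ ℚ-ring
    pair-≤ : ∀ b → b ℕ.< r → K * (sq (x b) + sq (y b)) ≤ L * pair b + E * sq M
    pair-≤ b b<r = subst (λ q → q * (sq (x b) + sq (y b)) ≤ L * pair b + E * sq M) (sym K≡R+E)
      (pair-inequality {x = x b} {y b} (0≤ℕ→ℚ r) (0≤ℕ→ℚ e) (0≤u N) (mono-≤ u u-mono
        (subst (suc (k ℕ.+ b) ℕ.≤_) (sym N≡k+r) (ℕ.+-monoʳ-< k b<r))))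
    middle-≤ : ∀ c → K * sq (t c) + R * sq M ≤ L * middle c
    middle-≤ c = subst (λ q → q * sq (t c) + R * sq M ≤ L * middle c) (sym K≡R+E)
      (middle-inequality {t = t c} {M} (0≤ℕ→ℚ r) (0≤ℕ→ℚ e))
    paired : K * (sum< r (λ b → sq (x b) + sq (y b)) + sum< e (sq ∘ t)) ≤ L * (sum< r pair + sum< e middle)
    paired = 0≤q-p⇒p≤q (subst (0ℚ ≤_) (difference K L P Q P′ Q′ R E (sq M)) (+-nonneg (p≤q⇒0≤q-p pairs) (p≤q⇒0≤q-p middles)))
      where
      P Q P′ Q′ : ℚ
      P = sum< r (λ b → sq (x b) + sq (y b))
      Q = sum< e (sq ∘ t)
      P′ = sum< r pair
      Q′ = sum< e middle
      pairs : K * P ≤ L * P′ + R * (E * sq M)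
      pairs = begin
        K * P
          ≡⟨ sum<-scale r K (λ b → sq (x b) + sq (y b)) ⟨
        sum< r (λ b → K * (sq (x b) + sq (y b)))
          ≤⟨ sum<-mono r pair-≤ ⟩
        sum< r (λ b → L * pair b + E * sq M)
          ≡⟨ sum<-+ r (λ b → L * pair b) (λ b → E * sq M) ⟩
        sum< r (λ b → L * pair b) + sum< r (λ b → E * sq M)
          ≡⟨ cong₂ _+_ (sum<-scale r L pair) (sum-const r (E * sq M)) ⟩
        L * P′ + R * (E * sq M) ∎
      middles : K * Q + E * (R * sq M) ≤ L * Q′
      middles = begin
        K * Q + E * (R * sq M)
          ≡⟨ cong₂ _+_ (sum<-scale e K (sq ∘ t)) (sum-const e (R * sq M)) ⟨
        sum< e (λ c → K * sq (t c)) + sum< e (λ c → R * sq M)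
          ≡⟨ sum<-+ e (λ c → K * sq (t c)) (λ c → R * sq M) ⟨
        sum< e (λ c → K * sq (t c) + R * sq M)
          ≤⟨ sum<-mono e (λ c _ → middle-≤ c) ⟩
        sum< e (λ c → L * middle c)
          ≡⟨ sum<-scale e L middle ⟩
        L * Q′ ∎
      difference : ∀ K L P Q P′ Q′ R E S →
        (L * P′ + R * (E * S) - K * P) + (L * Q′ - (K * Q + E * (R * S))) ≡ L * (P′ + Q′) - K * (P + Q)
      difference = solve-∀ ℚ-ring

  -- The blocks of k ranks above 0 are controlled by the paths of step k, the r′ leftover ranks by the top value.
  bound-long : ∀ ρ q r′ T → N ≡ q ℕ.* k ℕ.+ r′ →
    k ℕ.* k ℕ.* (q ℕ.* suc q) ℕ.+ 2 ℕ.* (r′ ℕ.* (N ℕ.+ κ)) ℕ.≤ 2 ℕ.* T → Bound ρ T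
  bound-long ρ q r′ T N≡qk+r′ arith = *-cancel-≤ˡ 2ℚ (ℚ.positive⁻¹ 2ℚ) (begin
    2ℚ * (ℕ→ℚ (k ℕ.* k) * normSq z)
      ≡⟨ cong₂ (λ a b → 2ℚ * (a * b)) (ℕ→ℚ-* k k) (trans normSq-z (trans (cong (λ l → sum< l (λ i → sq (u (suc i)))) N≡qk+r′)
           (sum<-split (q ℕ.* k) r′ (λ i → sq (u (suc i)))))) ⟩
    2ℚ * (K * K * (P + sum< r′ (λ i → sq (u (suc (q ℕ.* k ℕ.+ i))))))
      ≤⟨ *-mono-≤ˡ 2ℚ 0≤2 (*-mono-≤ˡ (K * K) (square-nonneg K) (ℚ.+-monoʳ-≤ P (sum<-mono r′ top-≤))) ⟩
    2ℚ * (K * K * (P + sum< r′ (λ i → sq (u N))))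
      ≡⟨ cong (λ s → 2ℚ * (K * K * (P + s))) (sum-const r′ (sq (u N))) ⟩
    2ℚ * (K * K * (P + ℕ→ℚ r′ * sq (u N)))
      ≡⟨ expand K P (ℕ→ℚ r′) (u N) ⟩
    K * K * (2ℚ * P) + 2ℚ * (ℕ→ℚ r′ * sq (K * u N))
      ≤⟨ ℚ.+-mono-≤
           (*-mono-≤ˡ (K * K) (square-nonneg K) (ℚ.≤-trans (path-bound q κ u u₀≡0) (*-mono-≤ˡ (ℕ→ℚ (q ℕ.* suc q)) (0≤ℕ→ℚ (q ℕ.* suc q)) V≤W)))
           (*-mono-≤ˡ 2ℚ 0≤2 (*-mono-≤ˡ (ℕ→ℚ r′) (0≤ℕ→ℚ r′) (window-cauchy κ u (u N) ℕ.≤-refl u₀≡0 flat))) ⟩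
    K * K * (ℕ→ℚ (q ℕ.* suc q) * W) + 2ℚ * (ℕ→ℚ r′ * (ℕ→ℚ (N ℕ.+ κ) * W))
      ≡⟨ factor (K * K) (ℕ→ℚ (q ℕ.* suc q)) (ℕ→ℚ r′) (ℕ→ℚ (N ℕ.+ κ)) W ⟩
    (K * K * ℕ→ℚ (q ℕ.* suc q) + 2ℚ * (ℕ→ℚ r′ * ℕ→ℚ (N ℕ.+ κ))) * W
      ≡⟨ cong (_* W) cast ⟨
    ℕ→ℚ (k ℕ.* k ℕ.* (q ℕ.* suc q) ℕ.+ 2 ℕ.* (r′ ℕ.* (N ℕ.+ κ))) * W
      ≤⟨ *-mono-≤ʳ W 0≤W (ℕ→ℚ-mono-≤ arith) ⟩
    ℕ→ℚ (2 ℕ.* T) * W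
      ≤⟨ *-mono-≤ˡ (ℕ→ℚ (2 ℕ.* T)) (0≤ℕ→ℚ (2 ℕ.* T)) W≤form ⟩
    ℕ→ℚ (2 ℕ.* T) * form G Δ z
      ≡⟨ trans (cong (_* form G Δ z) (ℕ→ℚ-* 2 T)) (ℚ.*-assoc 2ℚ (ℕ→ℚ T) (form G Δ z)) ⟩
    2ℚ * (ℕ→ℚ T * form G Δ z) ∎)
    where
    open ℚ.≤-Reasoning
    open Ranking ρ
    0≤2 : 0ℚ ≤ 2ℚ
    0≤2 = ℚ.nonNegative⁻¹ 2ℚ
    P : ℚ
    P = sum< (q ℕ.* k) (λ i → sq (u (suc i)))
    top-≤ : ∀ i → i ℕ.< r′ → sq (u (suc (q ℕ.* k ℕ.+ i))) ≤ sq (u N)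
    top-≤ i i<r′ = square-mono-≤ (0≤u _) (mono-≤ u u-mono
      (subst (suc (q ℕ.* k ℕ.+ i) ℕ.≤_) (sym N≡qk+r′) (ℕ.+-monoʳ-< (q ℕ.* k) i<r′)))
    V≤W : sum< (q ℕ.* k) (sq ∘ window κ u) ≤ W
    V≤W = sum<-prefix (sq ∘ window κ u) (λ a → square-nonneg (window κ u a))
      (ℕ.≤-trans (subst (q ℕ.* k ℕ.≤_) (sym N≡qk+r′) (ℕ.m≤m+n (q ℕ.* k) r′)) (ℕ.m≤m+n N κ))
    expand : ∀ K P r M → (1ℚ + 1ℚ) * (K * K * (P + r * (M * M))) ≡ K * K * ((1ℚ + 1ℚ) * P) + (1ℚ + 1ℚ) * (r * ((K * M) * (K * M)))
    expand = solve-∀ ℚ-ring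
    factor : ∀ a b c d W → a * (b * W) + (1ℚ + 1ℚ) * (c * (d * W)) ≡ (a * b + (1ℚ + 1ℚ) * (c * d)) * W
    factor = solve-∀ ℚ-ring
    cast : ℕ→ℚ (k ℕ.* k ℕ.* (q ℕ.* suc q) ℕ.+ 2 ℕ.* (r′ ℕ.* (N ℕ.+ κ))) ≡
      K * K * ℕ→ℚ (q ℕ.* suc q) + 2ℚ * (ℕ→ℚ r′ * ℕ→ℚ (N ℕ.+ κ))
    cast = trans (ℕ→ℚ-+ (k ℕ.* k ℕ.* (q ℕ.* suc q)) (2 ℕ.* (r′ ℕ.* (N ℕ.+ κ)))) (cong₂ _+_
      (trans (ℕ→ℚ-* (k ℕ.* k) (q ℕ.* suc q)) (cong (_* ℕ→ℚ (q ℕ.* suc q)) (ℕ→ℚ-* k k)))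
      (trans (ℕ→ℚ-* 2 (r′ ℕ.* (N ℕ.+ κ))) (cong (2ℚ *_) (ℕ→ℚ-* r′ (N ℕ.+ κ)))))

  -- The equation defines T = N² − r (Δ − k + 1) without subtraction.
  ranked-cases : ∀ ρ r T → N ≡ k ℕ.+ r → Δ ℕ.≤ N → T ℕ.+ r ℕ.* suc Δ ≡ N ℕ.* N ℕ.+ r ℕ.* k →
    Dec (N ℕ.≤ Δ) → Dec (k ℕ.≤ r) → Dec (2 ℕ.* k ℕ.≤ suc Δ) → Bound ρ T
  ranked-cases ρ r T N≡k+r Δ≤N T-def (yes N≤Δ) _ _ = Bound-mono ρ (cancel-T (begin
    k ℕ.* k ℕ.+ r ℕ.* suc Δ
      ≡⟨ cong (λ d → k ℕ.* k ℕ.+ r ℕ.* suc d) (trans (ℕ.≤-antisym Δ≤N N≤Δ) N≡k+r) ⟩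
    k ℕ.* k ℕ.+ r ℕ.* suc (k ℕ.+ r)
      ≤⟨ ℕ.m≤m+n _ (r ℕ.* (κ ℕ.+ k)) ⟩
    k ℕ.* k ℕ.+ r ℕ.* suc (k ℕ.+ r) ℕ.+ r ℕ.* (κ ℕ.+ k)
      ≡⟨ identity κ r ⟩
    (k ℕ.+ r) ℕ.* (k ℕ.+ r) ℕ.+ r ℕ.* k
      ≡⟨ cong (λ n → n ℕ.* n ℕ.+ r ℕ.* k) N≡k+r ⟨
    N ℕ.* N ℕ.+ r ℕ.* k ∎)) (bound-complete ρ N≤Δ)
    where
    open ℕ.≤-Reasoning
    cancel-T : ∀ {S} → S ℕ.+ r ℕ.* suc Δ ℕ.≤ N ℕ.* N ℕ.+ r ℕ.* k → S ℕ.≤ T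
    cancel-T {S} le = ℕ.+-cancelʳ-≤ (r ℕ.* suc Δ) S T (ℕ.≤-trans le (ℕ.≤-reflexive (sym T-def)))
    identity : ∀ κ r → suc κ ℕ.* suc κ ℕ.+ r ℕ.* suc (suc κ ℕ.+ r) ℕ.+ r ℕ.* (κ ℕ.+ suc κ) ≡
      (suc κ ℕ.+ r) ℕ.* (suc κ ℕ.+ r) ℕ.+ r ℕ.* suc κ
    identity = ℕ-Solver.solve-∀
  -- T decreases in Δ, and k (k + 2r) = N² - r² is its value at Δ = N - 1.
  ranked-cases ρ r T N≡k+r Δ≤N T-def (no N≰Δ) (no k≰r) _ = Bound-mono ρ
    (ℕ.+-cancelʳ-≤ (r ℕ.* suc Δ) _ T (begin
      k ℕ.* (k ℕ.+ 2 ℕ.* r) ℕ.+ r ℕ.* suc Δ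
        ≤⟨ ℕ.+-monoʳ-≤ (k ℕ.* (k ℕ.+ 2 ℕ.* r)) (ℕ.*-monoʳ-≤ r (ℕ.≤-trans (ℕ.≰⇒> N≰Δ) (ℕ.≤-reflexive N≡k+r))) ⟩
      k ℕ.* (k ℕ.+ 2 ℕ.* r) ℕ.+ r ℕ.* (k ℕ.+ r)
        ≡⟨ identity k r ⟩
      (k ℕ.+ r) ℕ.* (k ℕ.+ r) ℕ.+ r ℕ.* k
        ≡⟨ cong (λ n → n ℕ.* n ℕ.+ r ℕ.* k) N≡k+r ⟨
      N ℕ.* N ℕ.+ r ℕ.* k
        ≡⟨ T-def ⟨
      T ℕ.+ r ℕ.* suc Δ ∎))
    (bound-short ρ r (k ℕ.∸ r) (sym (ℕ.m+[n∸m]≡n (ℕ.<⇒≤ (ℕ.≰⇒> k≰r)))) N≡k+r)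
    where
    open ℕ.≤-Reasoning
    identity : ∀ k r → k ℕ.* (k ℕ.+ 2 ℕ.* r) ℕ.+ r ℕ.* (k ℕ.+ r) ≡ (k ℕ.+ r) ℕ.* (k ℕ.+ r) ℕ.+ r ℕ.* k
    identity = ℕ-Solver.solve-∀
  -- T exceeds the constant of `bound-dense` by exactly k f with f = Δ + 1 - 2k, which is why the
  -- cases are divided at 2k.
  ranked-cases ρ r T N≡k+r Δ≤N T-def (no N≰Δ) (yes k≤r) (yes 2k≤1+Δ) = Bound-mono ρ
    (ℕ.+-cancelʳ-≤ (r ℕ.* suc Δ) _ T (ℕ.≤-trans arith (ℕ.≤-reflexive (sym T-def))))
    (bound-dense ρ m N≡1+m+Δ)
    where
    m f : ℕ
    m = N ℕ.∸ suc Δ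
    f = suc Δ ℕ.∸ 2 ℕ.* k
    1+Δ≡2k+f : suc Δ ≡ 2 ℕ.* k ℕ.+ f
    1+Δ≡2k+f = sym (ℕ.m+[n∸m]≡n 2k≤1+Δ)
    N≡m+1+Δ : N ≡ m ℕ.+ suc Δ
    N≡m+1+Δ = sym (ℕ.m∸n+n≡m (ℕ.≰⇒> N≰Δ))
    N≡1+m+Δ : N ≡ suc m ℕ.+ Δ
    N≡1+m+Δ = trans N≡m+1+Δ (ℕ.+-suc m Δ)
    N≡ : N ≡ m ℕ.+ (2 ℕ.* k ℕ.+ f)
    N≡ = trans N≡m+1+Δ (cong (m ℕ.+_) 1+Δ≡2k+f)
    r≡ : r ≡ m ℕ.+ k ℕ.+ f
    r≡ = ℕ.+-cancelˡ-≡ k _ _ (trans (sym N≡k+r) (trans N≡ (reorder m k f)))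
      where
      reorder : ∀ m k f → m ℕ.+ (2 ℕ.* k ℕ.+ f) ≡ k ℕ.+ (m ℕ.+ k ℕ.+ f)
      reorder = ℕ-Solver.solve-∀
    arith : N ℕ.* (suc m ℕ.+ κ) ℕ.+ k ℕ.* k ℕ.+ r ℕ.* suc Δ ℕ.≤ N ℕ.* N ℕ.+ r ℕ.* k
    arith = begin
      N ℕ.* (suc m ℕ.+ κ) ℕ.+ k ℕ.* k ℕ.+ r ℕ.* suc Δ
        ≡⟨ cong₂ (λ a b → N ℕ.* (suc m ℕ.+ κ) ℕ.+ k ℕ.* k ℕ.+ a ℕ.* b) r≡ 1+Δ≡2k+f ⟩
      N ℕ.* (suc m ℕ.+ κ) ℕ.+ k ℕ.* k ℕ.+ (m ℕ.+ k ℕ.+ f) ℕ.* (2 ℕ.* k ℕ.+ f)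
        ≡⟨ cong (λ n → n ℕ.* (suc m ℕ.+ κ) ℕ.+ k ℕ.* k ℕ.+ (m ℕ.+ k ℕ.+ f) ℕ.* (2 ℕ.* k ℕ.+ f)) N≡ ⟩
      (m ℕ.+ (2 ℕ.* k ℕ.+ f)) ℕ.* (suc m ℕ.+ κ) ℕ.+ k ℕ.* k ℕ.+ (m ℕ.+ k ℕ.+ f) ℕ.* (2 ℕ.* k ℕ.+ f)
        ≤⟨ ℕ.m≤m+n _ (k ℕ.* f) ⟩
      _ ≡⟨ identity m κ f ⟩
      (m ℕ.+ (2 ℕ.* k ℕ.+ f)) ℕ.* (m ℕ.+ (2 ℕ.* k ℕ.+ f)) ℕ.+ (m ℕ.+ k ℕ.+ f) ℕ.* k
        ≡⟨ cong₂ (λ a b → a ℕ.* a ℕ.+ b ℕ.* k) N≡ r≡ ⟨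
      N ℕ.* N ℕ.+ r ℕ.* k ∎
      where
      open ℕ.≤-Reasoning
      identity : ∀ m κ f →
        (m ℕ.+ (2 ℕ.* suc κ ℕ.+ f)) ℕ.* (suc m ℕ.+ κ) ℕ.+ suc κ ℕ.* suc κ ℕ.+ (m ℕ.+ suc κ ℕ.+ f) ℕ.* (2 ℕ.* suc κ ℕ.+ f) ℕ.+ suc κ ℕ.* f ≡
        (m ℕ.+ (2 ℕ.* suc κ ℕ.+ f)) ℕ.* (m ℕ.+ (2 ℕ.* suc κ ℕ.+ f)) ℕ.+ (m ℕ.+ suc κ ℕ.+ f) ℕ.* suc κ
      identity = ℕ-Solver.solve-∀
  -- Here Δ + 1 ≤ 2k - 1 = κ + k, and T is smallest at equality. Since N ≥ 2k there are at least two
  -- full blocks, N = (2 + q) k + s. The polynomial added below is the exact difference of the two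
  -- sides at Δ + 1 = κ + k.
  ranked-cases ρ r T N≡k+r Δ≤N T-def (no N≰Δ) (yes k≤r) (no 2k≰1+Δ) = bound-long ρ (2 ℕ.+ q) s T N≡
    (ℕ.+-cancelʳ-≤ (2 ℕ.* (r ℕ.* suc Δ)) _ (2 ℕ.* T) (begin
      k ℕ.* k ℕ.* ((2 ℕ.+ q) ℕ.* suc (2 ℕ.+ q)) ℕ.+ 2 ℕ.* (s ℕ.* (N ℕ.+ κ)) ℕ.+ 2 ℕ.* (r ℕ.* suc Δ)
        ≤⟨ ℕ.+-monoʳ-≤ (k ℕ.* k ℕ.* ((2 ℕ.+ q) ℕ.* suc (2 ℕ.+ q)) ℕ.+ 2 ℕ.* (s ℕ.* (N ℕ.+ κ)))
             (ℕ.*-monoʳ-≤ 2 (ℕ.*-monoʳ-≤ r 1+Δ≤κ+k)) ⟩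
      k ℕ.* k ℕ.* ((2 ℕ.+ q) ℕ.* suc (2 ℕ.+ q)) ℕ.+ 2 ℕ.* (s ℕ.* (N ℕ.+ κ)) ℕ.+ 2 ℕ.* (r ℕ.* (κ ℕ.+ k))
        ≡⟨ cong₂ (λ n r → k ℕ.* k ℕ.* ((2 ℕ.+ q) ℕ.* suc (2 ℕ.+ q)) ℕ.+ 2 ℕ.* (s ℕ.* (n ℕ.+ κ)) ℕ.+ 2 ℕ.* (r ℕ.* (κ ℕ.+ k))) N≡ r≡ ⟩
      _ ≤⟨ ℕ.m≤m+n _ ((1 ℕ.+ q) ℕ.* k ℕ.* (k ℕ.* q ℕ.+ 2) ℕ.+ 2 ℕ.* (s ℕ.* (q ℕ.* k ℕ.+ 2))) ⟩
      _ ≡⟨ identity q κ s ⟩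
      _ ≡⟨ cong₂ (λ n r → 2 ℕ.* (n ℕ.* n ℕ.+ r ℕ.* k)) N≡ r≡ ⟨
      2 ℕ.* (N ℕ.* N ℕ.+ r ℕ.* k)
        ≡⟨ trans (cong (2 ℕ.*_) (sym T-def)) (ℕ.*-distribˡ-+ 2 T (r ℕ.* suc Δ)) ⟩
      2 ℕ.* T ℕ.+ 2 ℕ.* (r ℕ.* suc Δ) ∎))
    where
    open ℕ.≤-Reasoning
    q s : ℕ
    q = (r ℕ.∸ k) / k
    s = (r ℕ.∸ k) % k
    r≡ : r ≡ (1 ℕ.+ q) ℕ.* k ℕ.+ s
    r≡ = trans (sym (ℕ.m+[n∸m]≡n k≤r)) (trans (cong (k ℕ.+_) (m≡m%n+[m/n]*n (r ℕ.∸ k) k)) (reorder k s (q ℕ.* k)))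
      where
      reorder : ∀ k s a → k ℕ.+ (s ℕ.+ a) ≡ (k ℕ.+ a) ℕ.+ s
      reorder = ℕ-Solver.solve-∀
    N≡ : N ≡ (2 ℕ.+ q) ℕ.* k ℕ.+ s
    N≡ = trans N≡k+r (trans (cong (k ℕ.+_) r≡) (sym (ℕ.+-assoc k ((1 ℕ.+ q) ℕ.* k) s)))
    1+Δ≤κ+k : suc Δ ℕ.≤ κ ℕ.+ k
    1+Δ≤κ+k = ℕ.s≤s⁻¹ (subst (suc (suc Δ) ℕ.≤_) (cong suc (cong (κ ℕ.+_) (ℕ.+-identityʳ k))) (ℕ.≰⇒> 2k≰1+Δ))
    identity : ∀ q κ s →
      suc κ ℕ.* suc κ ℕ.* ((2 ℕ.+ q) ℕ.* suc (2 ℕ.+ q)) ℕ.+ 2 ℕ.* (s ℕ.* ((2 ℕ.+ q) ℕ.* suc κ ℕ.+ s ℕ.+ κ)) ℕ.+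
        2 ℕ.* (((1 ℕ.+ q) ℕ.* suc κ ℕ.+ s) ℕ.* (κ ℕ.+ suc κ)) ℕ.+
        ((1 ℕ.+ q) ℕ.* suc κ ℕ.* (suc κ ℕ.* q ℕ.+ 2) ℕ.+ 2 ℕ.* (s ℕ.* (q ℕ.* suc κ ℕ.+ 2))) ≡
      2 ℕ.* (((2 ℕ.+ q) ℕ.* suc κ ℕ.+ s) ℕ.* ((2 ℕ.+ q) ℕ.* suc κ ℕ.+ s) ℕ.+ ((1 ℕ.+ q) ℕ.* suc κ ℕ.+ s) ℕ.* suc κ)
    identity = ℕ-Solver.solve-∀

  ranked-bound : ∀ ρ r T → N ≡ k ℕ.+ r → Δ ℕ.≤ N → T ℕ.+ r ℕ.* suc Δ ≡ N ℕ.* N ℕ.+ r ℕ.* k → Bound ρ T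
  ranked-bound ρ r T N≡k+r Δ≤N T-def =
    ranked-cases ρ r T N≡k+r Δ≤N T-def (N ℕ.≤? Δ) (k ℕ.≤? r) (2 ℕ.* k ℕ.≤? suc Δ)

-- Relabelling vertices by rank

relabel : ∀ {n} → Graph n → Permutation′ n → Graph n
relabel G π = record
  { adj        = λ i j → adj G (π ⟨$⟩ʳ i) (π ⟨$⟩ʳ j)
  ; adj-sym    = λ i j → adj-sym G (π ⟨$⟩ʳ i) (π ⟨$⟩ʳ j)
  ; adj-irrefl = λ i → adj-irrefl G (π ⟨$⟩ʳ i)
  }

relabel-connected : ∀ {n k} (G : Graph n) (π : Permutation′ n) → KConnected G k → KConnected (relabel G π) k
relabel-connected {n} {k} G π (k<n , connected) = k<n , connected′
  where
  connected′ : ∀ S → card S ℕ.< k → ConnectedOutside (relabel G π) S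
  connected′ S S<k i j i∉S j∉S = subst₂ (Star (AdjacentOutside (relabel G π) S)) (Perm.inverseˡ π) (Perm.inverseˡ π)
    (gmap (π ⟨$⟩ˡ_) pull (connected S′ (subst (ℕ._< k) (sym card-S′) S<k) (π ⟨$⟩ʳ i) (π ⟨$⟩ʳ j)
      (push (subst (_∉ S) (sym (Perm.inverseˡ π)) i∉S)) (push (subst (_∉ S) (sym (Perm.inverseˡ π)) j∉S))))
    where
    member : Fin n → Bool
    member x = lookup S (π ⟨$⟩ˡ x)
    S′ : Subset n
    S′ = tabulate member
    card-S′ : card S′ ≡ card S
    card-S′ = begin
      card S′                                         ≡⟨ card-tabulate member ⟩
      ∑ℕ.sum (𝟙 ∘ member)                             ≡⟨ ∑ℕ.sum-permute (𝟙 ∘ member) π ⟩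
      ∑ℕ.sum (λ i → 𝟙 (member (π ⟨$⟩ʳ i)))            ≡⟨ ∑ℕ.sum-cong-≗ {n} (λ i → cong (λ x → 𝟙 (lookup S x)) (Perm.inverseˡ π {i})) ⟩
      ∑ℕ.sum (𝟙 ∘ lookup S)                           ≡⟨ card-tabulate (lookup S) ⟨
      card (tabulate (lookup S))                      ≡⟨ cong card (Vec.tabulate∘lookup S) ⟩
      card S                                          ∎
      where open ≡-Reasoning
    push : ∀ {x} → π ⟨$⟩ˡ x ∉ S → x ∉ S′
    push {x} ∉S = ∉-tabulate member (case true⊎false (member x) of λ where
      (inj₁ eq) → ⊥-elim (∉S (Vec.lookup⇒[]= _ S eq))
      (inj₂ eq) → eq)
    unpush : ∀ {x} → x ∉ S′ → π ⟨$⟩ˡ x ∉ S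
    unpush {x} x∉S′ ∈S = false≢true (trans (sym (∉-tabulate⁻¹ member x∉S′)) (Vec.[]=⇒lookup ∈S))
    pull : ∀ {x y} → AdjacentOutside G S′ x y → AdjacentOutside (relabel G π) S (π ⟨$⟩ˡ x) (π ⟨$⟩ˡ y)
    pull (x∉ , y∉ , x~y) = unpush x∉ , unpush y∉ , trans (cong₂ (adj G) (Perm.inverseʳ π) (Perm.inverseʳ π)) x~y

relabel-degree : ∀ {n} (G : Graph n) (π : Permutation′ n) i → degree (relabel G π) i ≡ degree G (π ⟨$⟩ʳ i)
relabel-degree G π i = begin
  degree (relabel G π) i                                          ≡⟨ degree-sum (relabel G π) i ⟩
  ∑ℕ.sum (λ j → 𝟙 (adj G (π ⟨$⟩ʳ i) (π ⟨$⟩ʳ j)))                  ≡⟨ ∑ℕ.sum-permute (λ j → 𝟙 (adj G (π ⟨$⟩ʳ i) j)) π ⟨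
  ∑ℕ.sum (λ j → 𝟙 (adj G (π ⟨$⟩ʳ i) j))                           ≡⟨ degree-sum G (π ⟨$⟩ʳ i) ⟨
  degree G (π ⟨$⟩ʳ i)                                             ∎
  where open ≡-Reasoning

normSq-cong : ∀ {n} {x y : Fin n → ℚ} → (∀ i → x i ≡ y i) → normSq x ≡ normSq y
normSq-cong x≡y = ∑ℚ.sum-cong-≗ (λ i → cong sq (x≡y i))

form-cong : ∀ {n} (G : Graph n) Δ {x y : Fin n → ℚ} → (∀ i → x i ≡ y i) → form G Δ x ≡ form G Δ y
form-cong G Δ x≡y = cong₂ (λ a b → ℕ→ℚ Δ * a - b) (normSq-cong x≡y)
  (sum₂-cong (λ i j → cong₂ (λ a b → weight G i j * (a * b)) (x≡y i) (x≡y j)))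

relabel-normSq : ∀ {n} (π : Permutation′ n) (x : Fin n → ℚ) → normSq (λ i → x (π ⟨$⟩ʳ i)) ≡ normSq x
relabel-normSq π x = sym (∑ℚ.sum-permute (sq ∘ x) π)

relabel-form : ∀ {n} (G : Graph n) (π : Permutation′ n) Δ (x : Fin n → ℚ) →
  form (relabel G π) Δ (λ i → x (π ⟨$⟩ʳ i)) ≡ form G Δ x
relabel-form G π Δ x = cong₂ (λ a b → ℕ→ℚ Δ * a - b) (relabel-normSq π x) (sym (trans
  (∑ℚ.sum-permute (λ i → sum (λ j → weight G i j * (x i * x j))) π)
  (∑ℚ.sum-cong-≗ (λ i → ∑ℚ.sum-permute (λ j → weight G (π ⟨$⟩ʳ i) j * (x (π ⟨$⟩ʳ i) * x j)) π))))

argmin : ∀ {n} (f : Fin (suc n) → ℚ) → ∃[ i ] (∀ j → f i ≤ f j)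
argmin {zero} f = zero , λ { zero → ℚ.≤-refl }
argmin {suc n} f with argmin (f ∘ suc)
... | i , least with ℚ.≤-total (f zero) (f (suc i))
... | inj₁ f₀≤fᵢ = zero , λ where
  zero    → ℚ.≤-refl
  (suc j) → ℚ.≤-trans f₀≤fᵢ (least j)
... | inj₂ fᵢ≤f₀ = suc i , λ where
  zero    → fᵢ≤f₀
  (suc j) → least j

-- Selection sort: rank 0 goes to a minimiser and the rest is sorted recursively. A permutation is
-- returned so that sums over vertices can be reindexed.
sort : ∀ {n} (f : Fin n → ℚ) → Σ[ π ∈ Permutation′ n ] (∀ i j → i Fin.≤ j → f (π ⟨$⟩ʳ i) ≤ f (π ⟨$⟩ʳ j))
sort {zero}  f = Perm.id , λ ()
sort {suc n} f with argmin f
... | m , least with sort (λ i → f (Fin.punchIn m i))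
... | π , ordered = Perm.insert zero m π , ordered′
  where
  at-suc : ∀ i → Perm.insert zero m π ⟨$⟩ʳ suc i ≡ Fin.punchIn m (π ⟨$⟩ʳ i)
  at-suc = Perm.insert-punchIn zero m π
  ordered′ : ∀ i j → i Fin.≤ j → f (Perm.insert zero m π ⟨$⟩ʳ i) ≤ f (Perm.insert zero m π ⟨$⟩ʳ j)
  ordered′ zero    j       _   = least _
  ordered′ (suc i) (suc j) i≤j = subst₂ _≤_ (cong f (sym (at-suc i))) (cong f (sym (at-suc j)))
    (ordered i j (ℕ.s≤s⁻¹ i≤j))

-- A Poincaré inequality with the boundary condition zᵥ = 0. After sorting, the value at rank 0 is
-- at most zᵥ, hence 0, and clamping ranks to N gives the constant extension.
dirichlet-bound : ∀ {N κ Δ} (G : Graph (suc N)) → KConnected G (suc κ) → (∀ i → degree G i ℕ.≤ Δ) →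
  ∀ r T → N ≡ suc κ ℕ.+ r → Δ ℕ.≤ N → T ℕ.+ r ℕ.* suc Δ ≡ N ℕ.* N ℕ.+ r ℕ.* suc κ →
  (z : Fin (suc N) → ℚ) → (∀ i → 0ℚ ≤ z i) → ∀ v → z v ≡ 0ℚ →
  ℕ→ℚ (suc κ ℕ.* suc κ) * normSq z ≤ ℕ→ℚ T * form G Δ z
dirichlet-bound {N} {κ} {Δ} G connected deg≤Δ r T N≡k+r Δ≤N T-def z 0≤z v zᵥ≡0 =
  subst₂ (λ a b → ℕ→ℚ (suc κ ℕ.* suc κ) * a ≤ ℕ→ℚ T * b)
    (trans (normSq-cong u-rank) (relabel-normSq π z))
    (trans (form-cong (relabel G π) Δ u-rank) (relabel-form G π Δ z))
    (ranked-bound ranking r T N≡k+r Δ≤N T-def)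
  where
  π : Permutation′ (suc N)
  π = proj₁ (sort z)
  ordered : ∀ i j → i Fin.≤ j → z (π ⟨$⟩ʳ i) ≤ z (π ⟨$⟩ʳ j)
  ordered = proj₂ (sort z)
  open Ranked {Δ = Δ} (relabel G π) (relabel-connected G π connected)
    (λ i → subst (ℕ._≤ Δ) (sym (relabel-degree G π i)) (deg≤Δ (π ⟨$⟩ʳ i)))
  clamp : ℕ → Fin (suc N)
  clamp s = fromℕ< (ℕ.s≤s (ℕ.m⊓n≤n s N))
  toℕ-clamp : ∀ s → toℕ (clamp s) ≡ s ℕ.⊓ N
  toℕ-clamp s = Fin.toℕ-fromℕ< _
  u : ℕ → ℚ
  u s = z (π ⟨$⟩ʳ clamp s)
  u-rank : ∀ i → u (toℕ i) ≡ z (π ⟨$⟩ʳ i)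
  u-rank i = cong (λ j → z (π ⟨$⟩ʳ j)) (Fin.toℕ-injective (trans (toℕ-clamp (toℕ i))
    (ℕ.m≤n⇒m⊓n≡m (ℕ.s≤s⁻¹ (Fin.toℕ<n i)))))
  u-≤ : ∀ s t → s ℕ.⊓ N ℕ.≤ t ℕ.⊓ N → u s ≤ u t
  u-≤ s t le = ordered (clamp s) (clamp t) (subst₂ ℕ._≤_ (sym (toℕ-clamp s)) (sym (toℕ-clamp t)) le)
  ranking : Ranking
  ranking = record
    { u       = u
    ; u₀≡0    = ℚ.≤-antisym
        (ℚ.≤-trans (ordered (clamp 0) (π ⟨$⟩ˡ v) (subst (ℕ._≤ toℕ (π ⟨$⟩ˡ v)) (sym (toℕ-clamp 0)) ℕ.z≤n))
          (ℚ.≤-reflexive (trans (cong z (Perm.inverseʳ π)) zᵥ≡0)))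
        (0≤z _)
    ; u-mono  = λ s → u-≤ s (suc s) (ℕ.⊓-monoˡ-≤ N (ℕ.n≤1+n s))
    ; u-const = λ s → cong (λ j → z (π ⟨$⟩ʳ j)) (Fin.toℕ-injective (trans (toℕ-clamp (s ℕ.⊓ N))
        (trans (trans (ℕ.⊓-assoc s N N) (cong (s ℕ.⊓_) (ℕ.⊓-idem N))) (sym (toℕ-clamp s)))))
    }

-- Degrees and edges

foldr-⊔-upper : ∀ {n} (f : Fin n → ℕ) i → f i ℕ.≤ foldr ℕ._⊔_ 0 f
foldr-⊔-upper f zero    = ℕ.m≤m⊔n (f zero) _
foldr-⊔-upper f (suc i) = ℕ.≤-trans (foldr-⊔-upper (f ∘ suc) i) (ℕ.m≤n⊔m (f zero) _)

foldr-⊔-least : ∀ {n b} (f : Fin n → ℕ) → (∀ i → f i ℕ.≤ b) → foldr ℕ._⊔_ 0 f ℕ.≤ b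
foldr-⊔-least {zero}  f f≤b = ℕ.z≤n
foldr-⊔-least {suc n} f f≤b = ℕ.⊔-lub (f≤b zero) (foldr-⊔-least (f ∘ suc) (f≤b ∘ suc))

sumℕ-mono-< : ∀ {n} {f g : Fin n → ℕ} → (∀ i → f i ℕ.≤ g i) → ∀ i → f i ℕ.< g i → ∑ℕ.sum f ℕ.< ∑ℕ.sum g
sumℕ-mono-< f≤g zero    f<g = ℕ.+-mono-<-≤ f<g (sumℕ-mono (f≤g ∘ suc))
sumℕ-mono-< f≤g (suc i) f<g = ℕ.+-mono-≤-< (f≤g zero) (sumℕ-mono-< (f≤g ∘ suc) i f<g)

count-others : ∀ {N} (v : Fin (suc N)) → ∑ℕ.sum (λ i → 𝟙 (not (does (i Fin.≟ v)))) ≡ N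
count-others {N}     zero    = trans (sumℕ-const N 1) (ℕ.*-identityʳ N)
count-others {suc N} (suc v) = cong suc (count-others v)

degree≤N : ∀ {N} (G : Graph (suc N)) i → degree G i ℕ.≤ N
degree≤N {N} G i = ℕ.+-cancelʳ-≤ 1 (degree G i) N (begin
  degree G i ℕ.+ 1
    ≡⟨ cong₂ ℕ._+_ (degree-sum G i) (sym (sum-𝟙-≟ i)) ⟩
  ∑ℕ.sum (λ j → 𝟙 (adj G i j)) ℕ.+ ∑ℕ.sum (λ j → 𝟙 (does (j Fin.≟ i)))
    ≡⟨ ∑ℕ.∑-distrib-+ (λ j → 𝟙 (adj G i j)) (λ j → 𝟙 (does (j Fin.≟ i))) ⟨
  ∑ℕ.sum (λ j → 𝟙 (adj G i j) ℕ.+ 𝟙 (does (j Fin.≟ i)))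
    ≤⟨ sumℕ-mono (adj-≟-≤1 G i) ⟩
  ∑ℕ.sum {suc N} (λ _ → 1)
    ≡⟨ trans (sumℕ-const (suc N) 1) (ℕ.*-identityʳ (suc N)) ⟩
  suc N
    ≡⟨ ℕ.+-comm 1 N ⟩
  N ℕ.+ 1 ∎)
  where open ℕ.≤-Reasoning

handshake : ∀ {n} (G : Graph n) → ∑ℕ.sum (degree G) ≡ size G ℕ.+ size G
handshake {n} G = begin
  ∑ℕ.sum (degree G)
    ≡⟨ ∑ℕ.sum-cong-≗ (degree-sum G) ⟩
  ∑ℕ.sum (λ i → ∑ℕ.sum (λ j → 𝟙 (adj G i j)))
    ≡⟨ ∑ℕ.sum-cong-≗ (λ i → trans (∑ℕ.sum-cong-≗ (orient i)) (∑ℕ.∑-distrib-+ (up i) (λ j → up j i))) ⟩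
  ∑ℕ.sum (λ i → ∑ℕ.sum (up i) ℕ.+ ∑ℕ.sum (λ j → up j i))
    ≡⟨ ∑ℕ.∑-distrib-+ (λ i → ∑ℕ.sum (up i)) (λ i → ∑ℕ.sum (λ j → up j i)) ⟩
  ∑ℕ.sum (λ i → ∑ℕ.sum (up i)) ℕ.+ ∑ℕ.sum (λ i → ∑ℕ.sum (λ j → up j i))
    ≡⟨ cong (∑ℕ.sum (λ i → ∑ℕ.sum (up i)) ℕ.+_) (∑ℕ.∑-comm (λ i j → up j i)) ⟩
  ∑ℕ.sum (λ i → ∑ℕ.sum (up i)) ℕ.+ ∑ℕ.sum (λ i → ∑ℕ.sum (up i))
    ≡⟨ cong₂ ℕ._+_ edges edges ⟨
  size G ℕ.+ size G ∎
  where
  open ≡-Reasoning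
  up : Fin n → Fin n → ℕ
  up i j = 𝟙 (⌊ i Fin.<? j ⌋ ∧ adj G i j)
  edges : size G ≡ ∑ℕ.sum (λ i → ∑ℕ.sum (up i))
  edges = ∑ℕ.sum-cong-≗ (λ i → card-tabulate (λ j → ⌊ i Fin.<? j ⌋ ∧ adj G i j))
  orient : ∀ i j → 𝟙 (adj G i j) ≡ up i j ℕ.+ up j i
  orient i j with i Fin.<? j | j Fin.<? i
  ... | yes i<j | yes j<i = ⊥-elim (ℕ.<-asym i<j j<i)
  ... | yes _   | no  _   = sym (ℕ.+-identityʳ (𝟙 (adj G i j)))
  ... | no  _   | yes _   = cong 𝟙 (adj-sym G i j)
  ... | no  i≮j | no  j≮i = cong 𝟙 (subst (λ j → adj G i j ≡ false)
    (Fin.toℕ-injective (ℕ.≤-antisym (ℕ.≮⇒≥ j≮i) (ℕ.≮⇒≥ i≮j))) (adj-irrefl G i))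

irregular-deficit : ∀ {n} (G : Graph n) → Irregular G → size G ℕ.+ size G ℕ.< n ℕ.* maxDegree G
irregular-deficit {n} G irregular with Fin.any? (λ i → degree G i ℕ.<? maxDegree G)
... | yes (i , dᵢ<Δ) = subst₂ ℕ._<_ (handshake G) (sumℕ-const n (maxDegree G))
  (sumℕ-mono-< (foldr-⊔-upper (degree G)) i dᵢ<Δ)
... | no regular = ⊥-elim (irregular (λ i j → trans (saturated i) (sym (saturated j))))
  where
  saturated : ∀ i → degree G i ≡ maxDegree G
  saturated i = ℕ.≤-antisym (foldr-⊔-upper (degree G) i) (ℕ.≮⇒≥ (λ dᵢ<Δ → regular (i , dᵢ<Δ)))

-- Spelled like `p` in the theorem so that the two agree by definition. For Δ the maximum degree,
-- the handshake identity makes it the sum of Δ - deg i.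
deficit : ∀ {n} → Graph n → ℕ → ℚ
deficit {n} G Δ = ℕ→ℚ n * ℕ→ℚ Δ - ℕ→ℚ 2 * ℕ→ℚ (size G)

0<deficit : ∀ {n} (G : Graph n) → Irregular G → 0ℚ < deficit G (maxDegree G)
0<deficit {n} G irregular = p<q⇒0<q-p (subst₂ _<_ 2m (ℕ→ℚ-* n (maxDegree G)) (ℕ→ℚ-mono-< (irregular-deficit G irregular)))
  where
  2m : ℕ→ℚ (size G ℕ.+ size G) ≡ ℕ→ℚ 2 * ℕ→ℚ (size G)
  2m = trans (cong (λ s → ℕ→ℚ (size G ℕ.+ s)) (sym (ℕ.+-identityʳ (size G)))) (ℕ→ℚ-* 2 (size G))
  ℕ→ℚ-mono-< : ∀ {a b} → a ℕ.< b → ℕ→ℚ a < ℕ→ℚ b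
  ℕ→ℚ-mono-< {a} a<b = ℚ.<-≤-trans (offset-< 1ℚ (trans (ℕ→ℚ-+ 1 a) (ℚ.+-comm 1ℚ (ℕ→ℚ a))) (ℚ.positive⁻¹ 1ℚ)) (ℕ→ℚ-mono-≤ a<b)

-- Splitting off the least absolute value

form-const : ∀ {n} (G : Graph n) Δ a → form G Δ (λ _ → a) ≡ deficit G Δ * sq a
form-const {n} G Δ a = begin
  ℕ→ℚ Δ * normSq {n} (λ _ → a) - adjForm G (λ _ → a) (λ _ → a)
    ≡⟨ cong₂ (λ s t → ℕ→ℚ Δ * s - t) (sum-const n (sq a)) (weighted-rows G (λ _ → sq a)) ⟩
  ℕ→ℚ Δ * (ℕ→ℚ n * sq a) - sum (λ i → ℕ→ℚ (degree G i) * sq a)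
    ≡⟨ cong (λ s → ℕ→ℚ Δ * (ℕ→ℚ n * sq a) - s) (trans (sym (∑ℚ.*-distribʳ-sum (sq a) (λ i → ℕ→ℚ (degree G i))))
         (cong (_* sq a) (trans (sum-ℕ→ℚ (degree G)) (trans (cong ℕ→ℚ (handshake G)) (ℕ→ℚ-+ (size G) (size G)))))) ⟩
  ℕ→ℚ Δ * (ℕ→ℚ n * sq a) - (ℕ→ℚ (size G) + ℕ→ℚ (size G)) * sq a
    ≡⟨ collect (ℕ→ℚ Δ) (ℕ→ℚ n) (ℕ→ℚ (size G)) (sq a) ⟩
  deficit G Δ * sq a ∎
  where
  open ≡-Reasoning
  collect : ∀ d n m s → d * (n * s) - (m + m) * s ≡ (n * d - (1ℚ + 1ℚ) * m) * s
  collect = solve-∀ ℚ-ring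

form-abs : ∀ {n} (G : Graph n) Δ (x : Fin n → ℚ) → form G Δ (λ i → ∣ x i ∣) ≤ form G Δ x
form-abs G Δ x = ℚ.+-mono-≤
  (ℚ.≤-reflexive (cong (ℕ→ℚ Δ *_) (∑ℚ.sum-cong-≗ (λ i → ∣p∣*∣p∣≡p*p (x i)))))
  (ℚ.neg-antimono-≤ (sum₂-mono (λ i j → *-mono-≤ˡ (weight G i j) (0≤weight G i j)
    (ℚ.≤-trans (p≤∣p∣ (x i * x j)) (ℚ.≤-reflexive (ℚ.∣p*q∣≡∣p∣*∣q∣ (x i) (x j)))))))

-- With P = H / V, the claimed constant is p / (n + P).  Because S₁² ≤ N S₂, and not merely n S₂, it can be
-- improved to p / (n + P (N + P) / (n + P)): this is where strictness comes from.
combine-bounds : ∀ N V p T {a S₁ S₂ F} → 0ℚ < N → 0ℚ < V → 0ℚ < p → 0ℚ < T →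
  V * S₂ ≤ T * F → sq S₁ ≤ N * S₂ →
  let n = 1ℚ + N
      H = p * T
      D = H + n * V
  in p * V * D * (n * sq a + (2ℚ * a * S₁ + S₂)) ≤ (D * D - H * V) * (p * sq a + F)
combine-bounds N V p T {a} {S₁} {S₂} {F} 0<N 0<V 0<p 0<T VS₂≤TF S₁²≤NS₂ =
  0≤q-p⇒p≤q (*-cancel-≤ˡ H 0<H (subst (_≤ H * (D′ * (p * sq a + F) - p * V * D * (n * sq a + (2ℚ * a * S₁ + S₂))))
    (sym (ℚ.*-zeroʳ H)) (subst (0ℚ ≤_) (sym final) (+-nonneg (*-nonneg (ℚ.<⇒≤ 0<p) 0≤E)
      (*-nonneg 0≤D′ (*-nonneg (ℚ.<⇒≤ 0<p) (p≤q⇒0≤q-p VS₂≤TF)))))))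
  where
  n H B D D′ E : ℚ
  n = 1ℚ + N
  H = p * T
  B = N * V + H
  D = H + n * V
  D′ = D * D - H * V
  E = (H * H * B * (a * a) - (1ℚ + 1ℚ) * H * V * D * (a * S₁)) + V * V * (n * n * V + N * H) * S₂
  0<H : 0ℚ < H
  0<H = *-positive 0<p 0<T
  0≤H : 0ℚ ≤ H
  0≤H = ℚ.<⇒≤ 0<H
  0≤V : 0ℚ ≤ V
  0≤V = ℚ.<⇒≤ 0<V
  0≤N : 0ℚ ≤ N
  0≤N = ℚ.<⇒≤ 0<N
  0≤n : 0ℚ ≤ n
  0≤n = +-nonneg (ℚ.nonNegative⁻¹ 1ℚ) 0≤N
  0<B : 0ℚ < B
  0<B = ℚ.+-mono-< (*-positive 0<N 0<V) 0<H
  0≤D : 0ℚ ≤ D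
  0≤D = +-nonneg 0≤H (*-nonneg 0≤n 0≤V)
  0≤D′ : 0ℚ ≤ D′
  0≤D′ = subst (0ℚ ≤_) (sym (expand N V H)) (+-nonneg (*-nonneg (*-nonneg 0≤n 0≤V) 0≤D) (*-nonneg 0≤H (ℚ.<⇒≤ 0<B)))
    where
    expand : ∀ N V H → (H + (1ℚ + N) * V) * (H + (1ℚ + N) * V) - H * V ≡
      (1ℚ + N) * V * (H + (1ℚ + N) * V) + H * (N * V + H)
    expand = solve-∀ ℚ-ring
  0≤E : 0ℚ ≤ E
  -- The factor N B completes the square in a and S₁. The S₁² terms then match because B (n² V + N
  -- H) = N D² + V H, an identity that rests on n - N = 1.
  0≤E = *-cancel-≤ˡ (N * B) (*-positive 0<N 0<B) (subst₂ _≤_ (sym (ℚ.*-zeroʳ (N * B))) (sym (sos N V H a S₁ S₂))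
    (+-nonneg (+-nonneg (*-nonneg 0≤N (square-nonneg (B * (H * a) - D * (V * S₁))))
                        (*-nonneg (*-nonneg 0≤V 0≤H) (square-nonneg (V * S₁))))
              (*-nonneg (*-nonneg (ℚ.<⇒≤ 0<B) (square-nonneg V))
                (*-nonneg (+-nonneg (*-nonneg (square-nonneg n) 0≤V) (*-nonneg 0≤N 0≤H)) (p≤q⇒0≤q-p S₁²≤NS₂)))))
    where
    sos : ∀ N V H a S₁ S₂ →
      N * (N * V + H) * ((H * H * (N * V + H) * (a * a) - (1ℚ + 1ℚ) * H * V * (H + (1ℚ + N) * V) * (a * S₁)) +
        V * V * ((1ℚ + N) * (1ℚ + N) * V + N * H) * S₂) ≡
      (N * (((N * V + H) * (H * a) - (H + (1ℚ + N) * V) * (V * S₁)) * ((N * V + H) * (H * a) - (H + (1ℚ + N) * V) * (V * S₁))) +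
        V * H * ((V * S₁) * (V * S₁))) +
      (N * V + H) * (V * V) * (((1ℚ + N) * (1ℚ + N) * V + N * H) * (N * S₂ - S₁ * S₁))
    sos = solve-∀ ℚ-ring
  -- The factor H = p T trades F for S₂ with T F - V S₂ as the error; what remains is p E, a
  -- quadratic expression in a and S₁, linear in S₂.
  final : H * (D′ * (p * sq a + F) - p * V * D * (n * sq a + (2ℚ * a * S₁ + S₂))) ≡
    p * E + D′ * (p * (T * F - V * S₂))
  final = trans (identity N V H p a S₁ S₂ F) (cong (λ q → p * E + D′ * q) (regroup p T V F S₂))
    where
    identity : ∀ N V H p a S₁ S₂ F →
      H * (((H + (1ℚ + N) * V) * (H + (1ℚ + N) * V) - H * V) * (p * (a * a) + F) -
        p * V * (H + (1ℚ + N) * V) * ((1ℚ + N) * (a * a) + ((1ℚ + 1ℚ) * a * S₁ + S₂))) ≡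
      p * ((H * H * (N * V + H) * (a * a) - (1ℚ + 1ℚ) * H * V * (H + (1ℚ + N) * V) * (a * S₁)) +
        V * V * ((1ℚ + N) * (1ℚ + N) * V + N * H) * S₂) +
      ((H + (1ℚ + N) * V) * (H + (1ℚ + N) * V) - H * V) * (H * F - p * V * S₂)
    identity = solve-∀ ℚ-ring
    regroup : ∀ p T V F S → p * T * F - p * V * S ≡ p * (T * F - V * S)
    regroup = solve-∀ ℚ-ring

form-bound : ∀ {N κ Δ} (G : Graph (suc N)) → KConnected G (suc κ) → (∀ i → degree G i ℕ.≤ Δ) →
  ∀ r T → N ≡ suc κ ℕ.+ r → Δ ℕ.≤ N → T ℕ.+ r ℕ.* suc Δ ≡ N ℕ.* N ℕ.+ r ℕ.* suc κ →
  0 ℕ.< T → 0ℚ < deficit G Δ →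
  let p = deficit G Δ
      V = ℕ→ℚ (suc κ ℕ.* suc κ)
      H = p * ℕ→ℚ T
      D = H + (1ℚ + ℕ→ℚ N) * V
  in ∀ x → p * V * D * normSq x ≤ (D * D - H * V) * form G Δ x
form-bound {N} {κ} {Δ} G connected deg≤Δ r T N≡k+r Δ≤N T-def 0<T 0<p x = begin
  p * V * D * normSq x
    ≡⟨ cong (p * V * D *_) normSq-x ⟩
  p * V * D * ((1ℚ + ℕ→ℚ N) * sq a + (2ℚ * a * sum z + normSq z))
    ≤⟨ combine-bounds (ℕ→ℚ N) V p (ℕ→ℚ T) {a} {sum z} 0<N (0<ℕ→ℚ {suc κ ℕ.* suc κ} (ℕ.s≤s ℕ.z≤n)) 0<p (0<ℕ→ℚ 0<T)
         (dirichlet-bound G connected deg≤Δ r T N≡k+r Δ≤N T-def z 0≤z v zᵥ≡0) S₁²≤NS₂ ⟩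
  D′ * (p * sq a + form G Δ z)
    ≤⟨ *-mono-≤ˡ D′ 0≤D′ (ℚ.≤-trans split (form-abs G Δ x)) ⟩
  D′ * form G Δ x ∎
  where
  open ℚ.≤-Reasoning
  p V H D D′ : ℚ
  p = deficit G Δ
  V = ℕ→ℚ (suc κ ℕ.* suc κ)
  H = p * ℕ→ℚ T
  D = H + (1ℚ + ℕ→ℚ N) * V
  D′ = D * D - H * V
  v : Fin (suc N)
  v = proj₁ (argmin (λ i → ∣ x i ∣))
  a : ℚ
  a = ∣ x v ∣
  z : Fin (suc N) → ℚ
  z i = ∣ x i ∣ - a
  0≤z : ∀ i → 0ℚ ≤ z i
  0≤z i = p≤q⇒0≤q-p (proj₂ (argmin (λ i → ∣ x i ∣)) i)
  zᵥ≡0 : z v ≡ 0ℚ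
  zᵥ≡0 = ℚ.+-inverseʳ a
  0<N : 0ℚ < ℕ→ℚ N
  0<N = 0<ℕ→ℚ (subst (0 ℕ.<_) (sym N≡k+r) (ℕ.s≤s ℕ.z≤n))
  0≤D′ : 0ℚ ≤ D′
  0≤D′ = subst (0ℚ ≤_) (sym (expand H V (ℕ→ℚ N)))
    (+-nonneg (square-nonneg H) (*-nonneg (0≤ℕ→ℚ (suc κ ℕ.* suc κ)) (+-nonneg
      (*-nonneg (+-nonneg (ℚ.nonNegative⁻¹ 1ℚ) (+-nonneg (0≤ℕ→ℚ N) (0≤ℕ→ℚ N))) (*-nonneg (ℚ.<⇒≤ 0<p) (0≤ℕ→ℚ T)))
      (*-nonneg (square-nonneg (1ℚ + ℕ→ℚ N)) (0≤ℕ→ℚ (suc κ ℕ.* suc κ))))))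
    where
    expand : ∀ H V N → (H + (1ℚ + N) * V) * (H + (1ℚ + N) * V) - H * V ≡
      H * H + V * ((1ℚ + (N + N)) * H + (1ℚ + N) * (1ℚ + N) * V)
    expand = solve-∀ ℚ-ring
  recover : ∀ a b → a + (b - a) ≡ b
  recover = solve-∀ ℚ-ring
  split : p * sq a + form G Δ z ≤ form G Δ (λ i → ∣ x i ∣)
  split = subst₂ (λ s t → s + form G Δ z ≤ t) (form-const G Δ a) (form-cong G Δ (λ i → recover a ∣ x i ∣))
    (form-superadditive G deg≤Δ (λ _ → a) z (λ i → *-nonneg (0≤z i) (ℚ.0≤∣p∣ (x v))) (λ i j → ℚ.≤-refl))
  normSq-x : normSq x ≡ (1ℚ + ℕ→ℚ N) * sq a + (2ℚ * a * sum z + normSq z)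
  normSq-x = begin-equality
    sum (λ i → sq (x i))
      ≡⟨ ∑ℚ.sum-cong-≗ (λ i → trans (sym (∣p∣*∣p∣≡p*p (x i))) (binomial a ∣ x i ∣)) ⟩
    sum (λ i → sq a + (2ℚ * a * z i + sq (z i)))
      ≡⟨ ∑ℚ.∑-distrib-+ (λ _ → sq a) (λ i → 2ℚ * a * z i + sq (z i)) ⟩
    sum {suc N} (λ _ → sq a) + sum (λ i → 2ℚ * a * z i + sq (z i))
      ≡⟨ cong₂ _+_ (trans (sum-const (suc N) (sq a)) (cong (_* sq a) (ℕ→ℚ-+ 1 N)))
           (trans (∑ℚ.∑-distrib-+ (λ i → 2ℚ * a * z i) (λ i → sq (z i))) (cong (_+ normSq z) (sum-scale (2ℚ * a) z))) ⟩
    (1ℚ + ℕ→ℚ N) * sq a + (2ℚ * a * sum z + normSq z) ∎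
    where
    binomial : ∀ a b → b * b ≡ a * a + ((1ℚ + 1ℚ) * a * (b - a) + (b - a) * (b - a))
    binomial = solve-∀ ℚ-ring
  others : Fin (suc N) → Bool
  others i = not (does (i Fin.≟ v))
  -- The zero at `v` leaves N coordinates instead of N + 1. This saving is the source of the strict
  -- inequality.
  S₁²≤NS₂ : sq (sum z) ≤ ℕ→ℚ N * normSq z
  S₁²≤NS₂ = subst (λ c → sq (sum z) ≤ ℕ→ℚ c * normSq z) (count-others v) (cauchy-schwarz others z vanish)
    where
    vanish : ∀ i → others i ≡ false → z i ≡ 0ℚ
    vanish i eq with i Fin.≟ v
    ... | yes refl = zᵥ≡0

-- From rational vectors to real eigenvectors

seq-∑ʳ : ∀ {n} (f : Fin n → ℝ) t → seq (∑ʳ f) t ≡ sum (λ j → seq (f j) t)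
seq-∑ʳ {zero}  f t = refl
seq-∑ʳ {suc n} f t = cong (seq (f zero) t +_) (seq-∑ʳ (f ∘ suc) t)

seq-adjacencyMatrix : ∀ {n} (G : Graph n) i j t → seq (adjacencyMatrix G i j) t ≡ weight G i j
seq-adjacencyMatrix G i j t with adj G i j
... | true  = refl
... | false = refl

eventually-all : ∀ {n} (P : Fin n → ℕ → Set) → (∀ i → ∃[ M ] (∀ t → M ℕ.≤ t → P i t)) →
  ∃[ M ] (∀ t → M ℕ.≤ t → ∀ i → P i t)
eventually-all {zero}  P ev = 0 , λ _ _ ()
eventually-all {suc n} P ev =
  let M₀ , h₀ = ev zero
      M₁ , h₁ = eventually-all (P ∘ suc) (ev ∘ suc)
  in M₀ ℕ.⊔ M₁ , λ where
    t M≤t zero    → h₀ t (ℕ.m⊔n≤o⇒m≤o M₀ M₁ M≤t)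
    t M≤t (suc i) → h₁ t (ℕ.m⊔n≤o⇒n≤o M₀ M₁ M≤t) i

divide : ∀ {p q} → 0ℚ < p → 0ℚ < q → ∃[ δ ] (0ℚ < δ × p * δ ≡ q)
divide {p} {q} 0<p 0<q = p⁻¹ * q , *-positive (ℚ.positive⁻¹ p⁻¹ {{ℚ.1/pos⇒pos p {{p>0}}}}) 0<q ,
  trans (sym (ℚ.*-assoc p p⁻¹ q)) (trans (cong (_* q) (ℚ.*-inverseʳ p {{p≢0}})) (ℚ.*-identityˡ q))
  where
  p>0 : ℚ.Positive p
  p>0 = ℚ.positive 0<p
  p≢0 : NonZero p
  p≢0 = ℚ.pos⇒nonZero p {{p>0}}
  p⁻¹ : ℚ
  p⁻¹ = (ℚ.1/ p) {{p≢0}}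

residual : ∀ {n} → Graph n → ℚ → (Fin n → ℚ) → Fin n → ℚ
residual G μ x i = sum (λ j → weight G i j * x j) - μ * x i

form-residual : ∀ {n} (G : Graph n) Δ μ x →
  form G Δ x ≡ (ℕ→ℚ Δ - μ) * normSq x - sum (λ i → x i * residual G μ x i)
form-residual G Δ μ x = trans (cong (λ q → ℕ→ℚ Δ * normSq x - q) adjForm-x) (collect (ℕ→ℚ Δ) μ (normSq x) _)
  where
  open ≡-Reasoning
  collect : ∀ d m S R → d * S - (m * S + R) ≡ (d - m) * S - R
  collect = solve-∀ ℚ-ring
  pull : ∀ w a b → w * (a * b) ≡ a * (w * b)
  pull = solve-∀ ℚ-ring
  row : ∀ x A m → x * A ≡ m * (x * x) + x * (A - m * x)
  row = solve-∀ ℚ-ring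
  adjForm-x : adjForm G x x ≡ μ * normSq x + sum (λ i → x i * residual G μ x i)
  adjForm-x = begin
    sum₂ (λ i j → weight G i j * (x i * x j))
      ≡⟨ ∑ℚ.sum-cong-≗ (λ i → trans (∑ℚ.sum-cong-≗ (λ j → pull (weight G i j) (x i) (x j)))
           (sum-scale (x i) (λ j → weight G i j * x j))) ⟩
    sum (λ i → x i * sum (λ j → weight G i j * x j))
      ≡⟨ ∑ℚ.sum-cong-≗ (λ i → row (x i) (sum (λ j → weight G i j * x j)) μ) ⟩
    sum (λ i → μ * sq (x i) + x i * residual G μ x i)
      ≡⟨ ∑ℚ.∑-distrib-+ (λ i → μ * sq (x i)) (λ i → x i * residual G μ x i) ⟩
    sum (λ i → μ * sq (x i)) + sum (λ i → x i * residual G μ x i)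
      ≡⟨ cong (_+ sum (λ i → x i * residual G μ x i)) (sum-scale μ (λ i → sq (x i))) ⟩
    μ * normSq x + sum (λ i → x i * residual G μ x i) ∎

-- With R and E as below, -R ≤ δ S + E/δ ≤ 2δ S, so the residual costs 2δ of the margin 4δ. One
-- further δ makes the inequality strict, and the last is the fixed separation that `<ʳ` demands.
approximate-gap : ∀ {n} (G : Graph n) Δ μ x {c δ} → 0ℚ < δ → 0ℚ < normSq x →
  (c + ℕ→ℚ 4 * δ) * normSq x ≤ form G Δ x →
  normSq (residual G μ x) ≤ sq δ * normSq x →
  c + δ < ℕ→ℚ Δ - μ
approximate-gap G Δ μ x {c} {δ} 0<δ 0<S gap small = ℚ.<-≤-trans
  (offset-< δ (double c δ) 0<δ)
  (*-cancel-≤ˡ (δ * S) (*-positive 0<δ 0<S) (0≤q-p⇒p≤q (subst (0ℚ ≤_) (balance (ℕ→ℚ Δ) μ S R E c δ)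
    (+-nonneg (*-nonneg 0≤δ (p≤q⇒0≤q-p (subst ((c + ℕ→ℚ 4 * δ) * S ≤_) (form-residual G Δ μ x) gap)))
      (+-nonneg (p≤q⇒0≤q-p small) cross)))))
  where
  0≤δ : 0ℚ ≤ δ
  0≤δ = ℚ.<⇒≤ 0<δ
  S R E : ℚ
  S = normSq x
  R = sum (λ i → x i * residual G μ x i)
  E = normSq (residual G μ x)
  double : ∀ c δ → c + (1ℚ + 1ℚ) * δ ≡ (c + δ) + δ
  double = solve-∀ ℚ-ring
  balance : ∀ d m S R E c δ →
    δ * (((d - m) * S - R) - (c + (1ℚ + 1ℚ + 1ℚ + 1ℚ) * δ) * S) + ((δ * δ * S - E) + (δ * δ * S + (δ * R + E))) ≡
    δ * S * (d - m) - δ * S * (c + (1ℚ + 1ℚ) * δ)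
  balance = solve-∀ ℚ-ring
  square : ∀ δ x e → δ * δ * (x * x) + (δ * (x * e) + e * e) ≡ (δ * x + ½ * e) * (δ * x + ½ * e) + (½ * ½ + ½) * (e * e)
  square = solve-∀ ℚ-ring
  cross : 0ℚ ≤ sq δ * S + (δ * R + E)
  cross = subst (0ℚ ≤_) regroup (sum-nonneg (λ i → subst (0ℚ ≤_) (sym (square δ (x i) (residual G μ x i)))
    (+-nonneg (square-nonneg (δ * x i + ½ * residual G μ x i))
      (*-nonneg (ℚ.nonNegative⁻¹ (½ * ½ + ½)) (square-nonneg (residual G μ x i))))))
    where
    open ≡-Reasoning
    e : Fin _ → ℚ
    e = residual G μ x
    regroup : sum (λ i → sq δ * sq (x i) + (δ * (x i * e i) + sq (e i))) ≡ sq δ * S + (δ * R + E)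
    regroup = begin
      sum (λ i → sq δ * sq (x i) + (δ * (x i * e i) + sq (e i)))
        ≡⟨ ∑ℚ.∑-distrib-+ (λ i → sq δ * sq (x i)) (λ i → δ * (x i * e i) + sq (e i)) ⟩
      sum (λ i → sq δ * sq (x i)) + sum (λ i → δ * (x i * e i) + sq (e i))
        ≡⟨ cong₂ _+_ (sum-scale (sq δ) (λ i → sq (x i))) (∑ℚ.∑-distrib-+ (λ i → δ * (x i * e i)) (λ i → sq (e i))) ⟩
      sq δ * S + (sum (λ i → δ * (x i * e i)) + E)
        ≡⟨ cong (λ q → sq δ * S + (q + E)) (sum-scale δ (λ i → x i * e i)) ⟩
      sq δ * S + (δ * R + E) ∎

-- Apartness supplies a sign and a uniform distance from 0. Squaring forgets the sign and keeps ‖x‖²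
-- away from 0 along the sequence.
#0⇒eventually-large : ∀ y → y #ʳ 0ʳ → ∃[ τ ] (0ℚ < τ × ∃[ M ] (∀ t → M ℕ.≤ t → sq τ ≤ sq (seq y t)))
#0⇒eventually-large y (inj₁ (τ , 0<τ , M , y<0)) = τ , 0<τ , M , λ t M≤t →
  subst (sq τ ≤_) (neg-square (seq y t)) (square-mono-≤ {τ} { - seq y t} (ℚ.<⇒≤ 0<τ)
    (0≤q-p⇒p≤q (subst (0ℚ ≤_) (swap (seq y t) τ) (p≤q⇒0≤q-p (ℚ.<⇒≤ (y<0 t M≤t))))))
  where
  neg-square : ∀ y → (- y) * (- y) ≡ y * y
  neg-square = solve-∀ ℚ-ring
  swap : ∀ y τ → 0ℚ - (y + τ) ≡ - y - τ
  swap = solve-∀ ℚ-ring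
#0⇒eventually-large y (inj₂ (τ , 0<τ , M , 0<y)) = τ , 0<τ , M , λ t M≤t →
  square-mono-≤ (ℚ.<⇒≤ 0<τ) (ℚ.≤-trans (ℚ.≤-reflexive (sym (ℚ.+-identityˡ τ))) (ℚ.<⇒≤ (0<y t M≤t)))

-- The t-th terms of eigenvalue and eigenvector form a rational approximate eigenpair, to which the
-- rational gap applies for all large t with one and the same δ.
eigenvalue-gap : ∀ {N} (G : Graph (suc N)) Δ {c δ} → 0ℚ < δ →
  (∀ x → (c + ℕ→ℚ 4 * δ) * normSq x ≤ form G Δ x) →
  ∀ μ → IsEigenvalue (adjacencyMatrix G) μ → fromℚ c <ʳ fromℚ (ℕ→ℚ Δ) -ʳ μ
eigenvalue-gap {N} G Δ {c} {δ} 0<δ gap μ (v , (i₀ , vᵢ#0) , eigen) =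
  let τ , 0<τ , M₀ , large = #0⇒eventually-large (v i₀) vᵢ#0
      -- Residual entries below η have squares summing to at most n η² ≤ (n η)² = (δ τ)², and τ² ≤
      -- ‖x‖².
      η , 0<η , nη≡δτ = divide {ℕ→ℚ (suc N)} (0<ℕ→ℚ {suc N} (ℕ.s≤s ℕ.z≤n)) (*-positive 0<δ 0<τ)
      M₁ , small = eventually-all (λ i t → ∣ residual G (seq μ t) (x t) i ∣ < η)
        (λ i → let M , h = eigen i η 0<η in M , λ t M≤t → subst (λ q → ∣ q ∣ < η) (seq-residual i t) (h t M≤t))
  in δ , 0<δ , M₀ ℕ.⊔ M₁ , λ t M≤t →
    let τ²≤S = ℚ.≤-trans (large t (ℕ.m⊔n≤o⇒m≤o M₀ M₁ M≤t)) (term≤sum (λ i → square-nonneg (x t i)) i₀)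
    in approximate-gap G Δ (seq μ t) (x t) {c} 0<δ (ℚ.<-≤-trans (*-positive 0<τ 0<τ) τ²≤S) (gap (x t))
         (residual-small t {τ} {η} nη≡δτ τ²≤S (small t (ℕ.m⊔n≤o⇒n≤o M₀ M₁ M≤t)))
  where
  x : ℕ → Fin (suc N) → ℚ
  x t i = seq (v i) t
  product : Fin (suc N) → Fin (suc N) → ℝ
  product i j = adjacencyMatrix G i j *ʳ v j
  row-seq : ∀ i t → seq (∑ʳ (product i)) t ≡ sum (λ j → weight G i j * x t j)
  row-seq i t = begin
    seq (∑ʳ (product i)) t
      ≡⟨ seq-∑ʳ (product i) t ⟩
    sum (λ j → seq (adjacencyMatrix G i j) t * x t j)
      ≡⟨ ∑ℚ.sum-cong-≗ {suc N} {λ j → seq (adjacencyMatrix G i j) t * x t j} {λ j → weight G i j * x t j}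
           (λ j → cong (_* x t j) (seq-adjacencyMatrix G i j t)) ⟩
    sum (λ j → weight G i j * x t j) ∎
    where open ≡-Reasoning
  seq-residual : ∀ i t → seq (∑ʳ (product i)) t - seq (μ *ʳ v i) t ≡ residual G (seq μ t) (x t) i
  seq-residual i t = cong (λ q → q - seq μ t * x t i) (row-seq i t)
  residual-small : ∀ t {τ η} → ℕ→ℚ (suc N) * η ≡ δ * τ → sq τ ≤ normSq (x t) →
    (∀ i → ∣ residual G (seq μ t) (x t) i ∣ < η) → normSq (residual G (seq μ t) (x t)) ≤ sq δ * normSq (x t)
  residual-small t {τ} {η} nη≡δτ τ²≤S small = begin
    normSq (residual G (seq μ t) (x t))
      ≤⟨ sum-mono (λ i → ℚ.≤-trans (ℚ.≤-reflexive (sym (∣p∣*∣p∣≡p*p (residual G (seq μ t) (x t) i))))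
           (square-mono-≤ (ℚ.0≤∣p∣ (residual G (seq μ t) (x t) i)) (ℚ.<⇒≤ (small i)))) ⟩
    sum {suc N} (λ _ → sq η)
      ≡⟨ sum-const (suc N) (sq η) ⟩
    n * sq η
      ≤⟨ *-mono-≤ʳ (sq η) (square-nonneg η) (ℚ.≤-trans (ℚ.≤-reflexive (sym (ℚ.*-identityˡ n)))
           (*-mono-≤ʳ n (0≤ℕ→ℚ (suc N)) (ℕ→ℚ-mono-≤ {1} {suc N} (ℕ.s≤s ℕ.z≤n)))) ⟩
    n * n * sq η
      ≡⟨ regroup n η ⟩
    sq (n * η)
      ≡⟨ cong sq nη≡δτ ⟩
    sq (δ * τ)
      ≡⟨ regroup δ τ ⟨
    δ * δ * sq τ
      ≤⟨ *-mono-≤ˡ (sq δ) (square-nonneg δ) τ²≤S ⟩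
    sq δ * normSq (x t) ∎
    where
    open ℚ.≤-Reasoning
    n : ℚ
    n = ℕ→ℚ (suc N)
    regroup : ∀ a b → a * a * (b * b) ≡ (a * b) * (a * b)
    regroup = solve-∀ ℚ-ring

theorem1p6 : ∀ (k n m Δ : ℕ) (G : Graph n) (λ₁ : ℝ) →
    0 ℕ.< k →
    KConnected G k →
    Irregular G →
    size G ≡ m →
    maxDegree G ≡ Δ →
    IsSpectralRadius G λ₁ →
    let k′ = ℕ→ℚ k
        n′ = ℕ→ℚ n
        Δ′ = ℕ→ℚ Δ
        p  = n′ * Δ′ - ℕ→ℚ 2 * ℕ→ℚ m
        numerator   = p * (k′ * k′)
        denominator = p * ((n′ - 1ℚ) * (n′ - 1ℚ) - (n′ - k′ - 1ℚ) * (Δ′ - k′ + 1ℚ)) + n′ * (k′ * k′)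
    in Σ[ den≢0 ∈ NonZero denominator ]
         fromℚ ((numerator ÷ denominator) {{den≢0}}) <ʳ fromℚ Δ′ -ʳ λ₁
theorem1p6 (suc κ) (suc N) m Δ G λ₁ 0<k connected irregular refl refl (eigenvalue , _) =
  den≢0 , eigenvalue-gap G Δ {c} {δ} 0<δ form-gap λ₁ eigenvalue
  where
  k r T : ℕ
  k = suc κ
  r = N ℕ.∸ k
  T = (N ℕ.* N ℕ.+ r ℕ.* k) ℕ.∸ r ℕ.* suc Δ
  N≡k+r : N ≡ k ℕ.+ r
  N≡k+r = sym (ℕ.m+[n∸m]≡n (ℕ.s≤s⁻¹ (proj₁ connected)))
  Δ≤N : Δ ℕ.≤ N
  Δ≤N = foldr-⊔-least (degree G) (degree≤N G)
  -- This shows both that the truncated subtraction in `T` is a true one and that T ≥ N k > 0.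
  Nk+r[1+Δ]≤ : N ℕ.* k ℕ.+ r ℕ.* suc Δ ℕ.≤ N ℕ.* N ℕ.+ r ℕ.* k
  Nk+r[1+Δ]≤ = begin
    N ℕ.* k ℕ.+ r ℕ.* suc Δ
      ≤⟨ ℕ.+-monoʳ-≤ (N ℕ.* k) (ℕ.*-monoʳ-≤ r (ℕ.s≤s Δ≤N)) ⟩
    N ℕ.* k ℕ.+ r ℕ.* suc N
      ≤⟨ ℕ.m≤m+n _ (r ℕ.* κ) ⟩
    N ℕ.* k ℕ.+ r ℕ.* suc N ℕ.+ r ℕ.* κ
      ≡⟨ rearrange N κ r ⟩
    N ℕ.* (k ℕ.+ r) ℕ.+ r ℕ.* k
      ≡⟨ cong (λ a → N ℕ.* a ℕ.+ r ℕ.* k) N≡k+r ⟨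
    N ℕ.* N ℕ.+ r ℕ.* k ∎
    where
    open ℕ.≤-Reasoning
    rearrange : ∀ N κ r → N ℕ.* suc κ ℕ.+ r ℕ.* suc N ℕ.+ r ℕ.* κ ≡ N ℕ.* (suc κ ℕ.+ r) ℕ.+ r ℕ.* suc κ
    rearrange = ℕ-Solver.solve-∀
  T-def : T ℕ.+ r ℕ.* suc Δ ≡ N ℕ.* N ℕ.+ r ℕ.* k
  T-def = ℕ.m∸n+n≡m (ℕ.≤-trans (ℕ.m≤n+m _ (N ℕ.* k)) Nk+r[1+Δ]≤)
  0<T : 0 ℕ.< T
  0<T = ℕ.≤-trans (ℕ.*-mono-≤ {1} {N} {1} {k} (subst (1 ℕ.≤_) (sym N≡k+r) (ℕ.s≤s ℕ.z≤n)) (ℕ.s≤s ℕ.z≤n))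
    (ℕ.+-cancelʳ-≤ (r ℕ.* suc Δ) (N ℕ.* k) T (ℕ.≤-trans Nk+r[1+Δ]≤ (ℕ.≤-reflexive (sym T-def))))
  k′ n′ Δ′ p numerator denominator V H D D′ c : ℚ
  k′ = ℕ→ℚ k
  n′ = ℕ→ℚ (suc N)
  Δ′ = ℕ→ℚ Δ
  p  = deficit G Δ
  numerator   = p * (k′ * k′)
  denominator = p * ((n′ - 1ℚ) * (n′ - 1ℚ) - (n′ - k′ - 1ℚ) * (Δ′ - k′ + 1ℚ)) + n′ * (k′ * k′)
  V = ℕ→ℚ (k ℕ.* k)
  H = p * ℕ→ℚ T
  D = H + (1ℚ + ℕ→ℚ N) * V
  D′ = D * D - H * V
  0<p : 0ℚ < p
  0<p = 0<deficit G irregular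
  0<V : 0ℚ < V
  0<V = 0<ℕ→ℚ {k ℕ.* k} (ℕ.s≤s ℕ.z≤n)
  0<H : 0ℚ < H
  0<H = *-positive 0<p (0<ℕ→ℚ 0<T)
  0<1+N : 0ℚ < 1ℚ + ℕ→ℚ N
  0<1+N = subst (0ℚ <_) (ℕ→ℚ-+ 1 N) (0<ℕ→ℚ {suc N} (ℕ.s≤s ℕ.z≤n))
  0<D : 0ℚ < D
  0<D = ℚ.+-mono-< 0<H (*-positive 0<1+N 0<V)
  0<D′ : 0ℚ < D′
  0<D′ = subst (0ℚ <_) (sym (expand H (ℕ→ℚ N) V)) (ℚ.+-mono-<
    (*-positive 0<D (*-positive 0<1+N 0<V))
    (*-positive 0<H (ℚ.+-mono-<-≤ 0<H (*-nonneg (0≤ℕ→ℚ N) (ℚ.<⇒≤ 0<V)))))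
    where
    expand : ∀ H N V → (H + (1ℚ + N) * V) * (H + (1ℚ + N) * V) - H * V ≡
      (H + (1ℚ + N) * V) * ((1ℚ + N) * V) + H * (H + N * V)
    expand = solve-∀ ℚ-ring
  denominator≡D : denominator ≡ D
  denominator≡D = begin
    denominator
      ≡⟨ cong₂ (λ a b → p * ((a - 1ℚ) * (a - 1ℚ) - (a - k′ - 1ℚ) * (Δ′ - k′ + 1ℚ)) + a * b) (ℕ→ℚ-+ 1 N) (sym (ℕ→ℚ-* k k)) ⟩
    p * (((1ℚ + ℕ→ℚ N) - 1ℚ) * ((1ℚ + ℕ→ℚ N) - 1ℚ) - ((1ℚ + ℕ→ℚ N) - k′ - 1ℚ) * (Δ′ - k′ + 1ℚ)) + (1ℚ + ℕ→ℚ N) * V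
      ≡⟨ cong (λ q → p * q + (1ℚ + ℕ→ℚ N) * V) factor ⟩
    D ∎
    where
    open ≡-Reasoning
    N′ r′ T′ : ℚ
    N′ = ℕ→ℚ N
    r′ = ℕ→ℚ r
    T′ = ℕ→ℚ T
    T-defℚ : T′ + r′ * (1ℚ + Δ′) ≡ N′ * N′ + r′ * k′
    T-defℚ = begin
      T′ + r′ * (1ℚ + Δ′)                ≡⟨ cong (λ q → T′ + r′ * q) (ℕ→ℚ-+ 1 Δ) ⟨
      T′ + r′ * ℕ→ℚ (suc Δ)              ≡⟨ cong (T′ +_) (ℕ→ℚ-* r (suc Δ)) ⟨
      T′ + ℕ→ℚ (r ℕ.* suc Δ)             ≡⟨ ℕ→ℚ-+ T (r ℕ.* suc Δ) ⟨
      ℕ→ℚ (T ℕ.+ r ℕ.* suc Δ)            ≡⟨ cong ℕ→ℚ T-def ⟩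
      ℕ→ℚ (N ℕ.* N ℕ.+ r ℕ.* k)          ≡⟨ ℕ→ℚ-+ (N ℕ.* N) (r ℕ.* k) ⟩
      ℕ→ℚ (N ℕ.* N) + ℕ→ℚ (r ℕ.* k)      ≡⟨ cong₂ _+_ (ℕ→ℚ-* N N) (ℕ→ℚ-* r k) ⟩
      N′ * N′ + r′ * k′                  ∎
    -- Since n - k - 1 = r, the bracket of the claimed denominator is N² - r (Δ - k + 1), which is
    -- T.
    factor : ((1ℚ + N′) - 1ℚ) * ((1ℚ + N′) - 1ℚ) - ((1ℚ + N′) - k′ - 1ℚ) * (Δ′ - k′ + 1ℚ) ≡ T′
    factor = begin
      ((1ℚ + N′) - 1ℚ) * ((1ℚ + N′) - 1ℚ) - ((1ℚ + N′) - k′ - 1ℚ) * (Δ′ - k′ + 1ℚ)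
        ≡⟨ cong (λ a → ((1ℚ + N′) - 1ℚ) * ((1ℚ + N′) - 1ℚ) - ((1ℚ + a) - k′ - 1ℚ) * (Δ′ - k′ + 1ℚ)) (trans (cong ℕ→ℚ N≡k+r) (ℕ→ℚ-+ k r)) ⟩
      ((1ℚ + N′) - 1ℚ) * ((1ℚ + N′) - 1ℚ) - ((1ℚ + (k′ + r′)) - k′ - 1ℚ) * (Δ′ - k′ + 1ℚ)
        ≡⟨ expand N′ k′ r′ Δ′ ⟩
      (N′ * N′ + r′ * k′) - r′ * (1ℚ + Δ′)
        ≡⟨ cong (_- r′ * (1ℚ + Δ′)) T-defℚ ⟨
      (T′ + r′ * (1ℚ + Δ′)) - r′ * (1ℚ + Δ′)
        ≡⟨ cancel T′ (r′ * (1ℚ + Δ′)) ⟩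
      T′ ∎
      where
      expand : ∀ N k r d → ((1ℚ + N) - 1ℚ) * ((1ℚ + N) - 1ℚ) - ((1ℚ + (k + r)) - k - 1ℚ) * (d - k + 1ℚ) ≡
        (N * N + r * k) - r * (1ℚ + d)
      expand = solve-∀ ℚ-ring
      cancel : ∀ a b → (a + b) - b ≡ a
      cancel = solve-∀ ℚ-ring
  den≢0 : NonZero denominator
  den≢0 = ℚ.pos⇒nonZero denominator {{ℚ.positive (subst (0ℚ <_) (sym denominator≡D) 0<D)}}
  c = (numerator ÷ denominator) {{den≢0}}
  Dc≡pV : D * c ≡ p * V
  Dc≡pV = begin
    D * (numerator * 1/den)             ≡⟨ cong (_* (numerator * 1/den)) denominator≡D ⟨
    denominator * (numerator * 1/den)   ≡⟨ swap denominator numerator 1/den ⟩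
    numerator * (denominator * 1/den)   ≡⟨ cong (numerator *_) (ℚ.*-inverseʳ denominator {{den≢0}}) ⟩
    numerator * 1ℚ                      ≡⟨ ℚ.*-identityʳ numerator ⟩
    numerator                           ≡⟨ cong (p *_) (ℕ→ℚ-* k k) ⟨
    p * V                               ∎
    where
    open ≡-Reasoning
    1/den : ℚ
    1/den = (ℚ.1/ denominator) {{den≢0}}
    swap : ∀ a b c → a * (b * c) ≡ b * (a * c)
    swap = solve-∀ ℚ-ring
  0<DD′4 : 0ℚ < D * D′ * ℕ→ℚ 4
  0<DD′4 = *-positive (*-positive 0<D 0<D′) (ℚ.positive⁻¹ (ℕ→ℚ 4))
  -- `form-bound` yields the constant p V D / D′, which exceeds the claimed c = p V / D by p V · H V
  -- / (D D′). A quarter of this excess is δ.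
  slack : ∃[ δ ] (0ℚ < δ × D * D′ * ℕ→ℚ 4 * δ ≡ p * V * (H * V))
  slack = divide 0<DD′4 (*-positive (*-positive 0<p 0<V) (*-positive 0<H 0<V))
  δ : ℚ
  δ = proj₁ slack
  0<δ : 0ℚ < δ
  0<δ = proj₁ (proj₂ slack)
  form-gap : ∀ x → (c + ℕ→ℚ 4 * δ) * normSq x ≤ form G Δ x
  form-gap x = *-cancel-≤ˡ (D * D′) (*-positive 0<D 0<D′) (begin
    D * D′ * ((c + ℕ→ℚ 4 * δ) * normSq x)
      ≡⟨ distribute D D′ c δ (normSq x) ⟩
    (D′ * (D * c) + D * D′ * ℕ→ℚ 4 * δ) * normSq x
      ≡⟨ cong₂ (λ a b → (D′ * a + b) * normSq x) Dc≡pV (proj₂ (proj₂ slack)) ⟩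
    (D′ * (p * V) + p * V * (H * V)) * normSq x
      ≡⟨ complete D H V p (normSq x) ⟩
    D * (p * V * D * normSq x)
      ≤⟨ *-mono-≤ˡ D (ℚ.<⇒≤ 0<D) (form-bound G connected (foldr-⊔-upper (degree G)) r T N≡k+r Δ≤N T-def 0<T 0<p x) ⟩
    D * (D′ * form G Δ x)
      ≡⟨ ℚ.*-assoc D D′ (form G Δ x) ⟨
    D * D′ * form G Δ x ∎)
    where
    open ℚ.≤-Reasoning
    distribute : ∀ D E c δ S → D * E * ((c + (1ℚ + 1ℚ + 1ℚ + 1ℚ) * δ) * S) ≡ (E * (D * c) + D * E * (1ℚ + 1ℚ + 1ℚ + 1ℚ) * δ) * S
    distribute = solve-∀ ℚ-ring
    complete : ∀ D H V p S → ((D * D - H * V) * (p * V) + p * V * (H * V)) * S ≡ D * (p * V * D * S)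
    complete = solve-∀ ℚ-ring
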